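{- For any $\beta>0$ there exist $\gamma>0$ and $n_3\in\mathbb N$ such that the following holds. Let $n>n_3$ be an even integer and let $\mathcal H$ be a 3-uniform hypergraph on $n$ vertices with $\delta_1(\mathcal H)\ge(\frac7{16}-\gamma)\binom n2$. If $\mathcal H$ is not $\beta$-extremal, then $\mathcal H$ contains a loose Hamilton cycle.
   Context: For a 3-graph $\mathcal H$, $\delta_1(\mathcal H)$ is the minimum over vertices $v$ of the number of edges containing $v$. For $\beta>0$, a 3-graph $\mathcal H$ on $n$ vertices is $\beta$-extremal if there is a set $B\subseteq V(\mathcal H)$ with $|B|=\lfloor 3n/4\rfloor$ and at most $\beta n^3$ edges of $\mathcal H$ contained in $B$. A loose Hamilton cycle is a spanning subhypergraph whose vertices can be ordered cyclically so that each edge consists of $3$ consecutive vertices and every two consecutive edges share exactly one vertex. -}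

module Defs where

open import Data.Nat using (ℕ; zero; suc; _+_; _*_; _≤_; _<_; _^_)
open import Data.Nat.DivMod using (_/_; _mod_)
open import Data.Nat.Divisibility using (_∣_)
open import Data.Bool using (Bool; true; false; _∧_; if_then_else_)
open import Data.Fin using (Fin; toℕ)
open import Data.Fin.Subset using (Subset; ∣_∣)
open import Data.Vec using (lookup)
open import Data.List using (List; map; allFin)
open import Data.Nat.ListAction using (sum)
open import Data.Product using (Σ; ∃; _×_; _,_)
open import Data.Empty using (⊥)
open import Data.Integer using (+_)
open import Data.Rational using (ℚ; 0ℚ) renaming (_≤_ to _≤ℚ_; _*_ to _*ℚ_; _/_ to _/ℚ_)
open import Function.Definitions using (Injective)
open import Relation.Binary.PropositionalEquality using (_≡_)
open import Relation.Nullary using (does)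
open import Data.Fin.Properties using (_<?_)

-- A 3-uniform hypergraph on vertex set Fin n.  edge a b c = true means that
-- {a,b,c} is an edge.  Edges are 3-element sets: the indicator is invariant
-- under permuting its arguments and vanishes when two arguments coincide.
record Hypergraph3 (n : ℕ) : Set where
  field
    edge       : Fin n → Fin n → Fin n → Bool
    sym₁₂      : ∀ a b c → edge a b c ≡ edge b a c
    sym₂₃      : ∀ a b c → edge a b c ≡ edge a c b
    distinct₁₂ : ∀ a c → edge a a c ≡ false
open Hypergraph3 public

sumFin : (n : ℕ) → (Fin n → ℕ) → ℕ
sumFin n f = sum (map f (allFin n))

𝟙 : Bool → ℕ
𝟙 b = if b then 1 else 0

_<ᵇ_ : ∀ {n} → Fin n → Fin n → Bool
a <ᵇ b = does (a <? b)

degree : ∀ {n} → Hypergraph3 n → Fin n → ℕ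
degree {n} H v =
  sumFin n (λ u → sumFin n (λ w → 𝟙 ((u <ᵇ w) ∧ edge H v u w)))

minDegreeAtLeast : ∀ {n} → Hypergraph3 n → ℚ → Set
minDegreeAtLeast {n} H x = ∀ v → x ≤ℚ ((+ degree H v) /ℚ 1)

edgesIn : ∀ {n} → Hypergraph3 n → Subset n → ℕ
edgesIn {n} H B =
  sumFin n (λ a → sumFin n (λ b → sumFin n (λ c →
    𝟙 ((a <ᵇ b) ∧ (b <ᵇ c) ∧ lookup B a ∧ lookup B b ∧ lookup B c ∧ edge H a b c))))

Extremal : ℚ → ∀ {n} → Hypergraph3 n → Set
Extremal β {n} H =
  Σ (Subset n) λ B → (∣ B ∣ ≡ (3 * n) / 4) × ((+ edgesIn H B) /ℚ 1 ≤ℚ β *ℚ ((+ (n ^ 3)) /ℚ 1))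

-- H contains a loose Hamilton cycle: there is a cyclic ordering
-- σ(0), σ(1), …, σ(n-1) of all vertices (σ a bijection, indices mod n) such
-- that each {σ(2i), σ(2i+1), σ(2i+2)} (0 ≤ i < n/2) is an edge of H.
-- These n/2 edges are exactly the edges of a loose cycle; consecutive ones
-- share exactly one vertex when n ≥ 6 (and n must be even).
LooseHamiltonCycle : ∀ {n} → Hypergraph3 n → Set
LooseHamiltonCycle {zero} H = ⊥
LooseHamiltonCycle {suc m} H =
  (6 ≤ suc m) × (2 ∣ suc m) ×
  Σ (Fin (suc m) → Fin (suc m)) λ σ →
    Injective _≡_ _≡_ σ ×
    (∀ i → 2 * i < suc m →
      edge H (σ ((2 * i) mod suc m)) (σ ((2 * i + 1) mod suc m)) (σ ((2 * i + 2) mod suc m)) ≡ true)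

{-# OPTIONS --safe #-}
module Submission where

-- An absorbing argument in which greedy choices against a potential replace both random selection and the
-- hypergraph regularity lemma.
--
-- A short path is composed of disjoint absorbers such that every pair of vertices can be taken up by linearly
-- many of them, and a reservoir of triples is set aside such that any two vertices can be joined by linearly many
-- of them.  Absorbers exist because every vertex x can be exchanged for many other vertices: by the
-- Kruskal–Katona bound the edges without a pair from the link of x number at most (9/16)^{3/2} n³/6 = 27/64 n³/6,
-- which is less than 7/16 n³/6.
--
-- All but a small fraction of the other vertices are covered by complete tripartite blocks of bounded size with
-- parts in the ratio 1 : 1 : 2.  By linear programming duality the obstruction would be a weighting y of average
-- below 1 with y a + y b + 2 y c ≥ 4 on almost all edges.  In the link of a vertex of least weight the excess of
-- y over this weight is, suitably scaled, a fractional vertex cover of weight at most n/4.  As the link has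
-- density almost 7/16, the cover is concentrated on n/4 vertices, and the other 3n/4 vertices span few edges, so
-- that H is extremal.  A tiling is obtained from this in rounds: new blocks are chosen one by one so as to be
-- light for the load they put on the old blocks.  The old blocks are then used up evenly, can be cut again into
-- smaller blocks, and every round gains a fixed fraction of the vertices.
--
-- Long paths through the blocks are joined by the reservoir to a cycle containing the absorbers, which take up
-- the vertices left over.

open import Defs

-- The constant 7/16 = 1 - (3/4)² is the link density when every edge meets a fixed set of n/4
-- vertices. It is also the largest value of p² + 2q(n - p), in units of n², for half-integral
-- covers with q ≤ p and p + q = n/2, attained only at p = q = n/4. So a link of almost this density
-- leaves a light cover no other shape, and stability comes from elementary inequalities. The tiling
-- has another obstacle: a round must not ruin the old blocks. A block that loses unequal numbers of
-- vertices from its four lists can be recut only down to the poorest of them. Hence evenness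
-- matters more than the number of vertices taken, and a second moment is controlled. Evenness needs
-- old parts much larger than the new blocks, so block sizes fall by a constant factor per round and
-- the number of rounds is fixed in advance. Densities appear as inequalities between natural
-- numbers with cleared denominators, mostly over ordered tuples. Their verification is then a
-- comparison of polynomial coefficients.

module Prelude where
  open import Data.Nat using (ℕ; zero; suc; _+_; _*_; _∸_; _^_; _≤_; _<_; z≤n; s≤s; _≤?_; _<?_; _≤ᵇ_; _≡ᵇ_;
      >-nonZero; nonZero; NonZero; s≤s⁻¹; ∣_-_∣) renaming (_≟_ to _≟ℕ_) public
  open import Data.Nat.Properties hiding (_≟_; _≤?_; _<?_) public
  open import Data.Nat.DivMod using (_/_; _%_; m≡m%n+[m/n]*n; m%n<n; m/n*n≤m) public
  open import Data.Nat.ListAction using (sum) public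
  open import Data.Bool using (Bool; true; false; _∧_; not; T; if_then_else_) public
  open import Data.Fin using (Fin; zero; suc; toℕ) public
  open import Data.Fin.Properties using (_≟_; toℕ-injective) public
  open import Data.List using (List; []; _∷_; _++_; length; map; allFin; tabulate; concat; cartesianProductWith;
      take; drop) public
  open import Data.List.Properties using (length-++; length-tabulate; map-tabulate) public
  open import Data.List.Membership.Propositional using (_∈_) public
  open import Data.List.Membership.Propositional.Properties using (∈-allFin) public
  open import Data.List.Relation.Unary.Any using (here; there) public
  open import Data.Maybe using (Maybe; just; nothing) public
  open import Data.Vec using (Vec; []; _∷_; lookup) renaming (tabulate to tabulateV) public
  open import Data.Vec.Relation.Unary.All using ([]; _∷_) renaming (All to AllV) public
  open import Data.Vec.N-ary using (N-ary; _$ⁿ_) public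
  open import Data.Product using (Σ; _×_; _,_; proj₁; proj₂) public
  open import Data.Sum using (_⊎_; inj₁; inj₂) public
  open import Data.Unit using (⊤; tt) public
  open import Data.Empty using (⊥; ⊥-elim) public
  open import Function using (id; _∘_) public
  open import Relation.Nullary using (¬_; Dec; yes; no; does) public
  open import Relation.Binary.PropositionalEquality using
      (_≡_; _≢_; refl; sym; trans; cong; cong₂; subst; subst₂; module ≡-Reasoning) public
  open import Data.Bool.ListAction using (all) public
  open import Algebra.Properties.CommutativeSemigroup *-commutativeSemigroup using () renaming
      (x∙yz≈y∙xz to *-swap) public
  open import Algebra.Properties.CommutativeSemigroup +-commutativeSemigroup using () renaming
      (x∙yz≈y∙xz to +-swap) public

-- Polynomial inequalities over the natural numbers, checked by computation

module Certificates where
  open Prelude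
  open import Data.Bool.Properties using (T-∧)
  open import Function.Bundles using (Equivalence)

  infixl 9 _:*_
  infixl 8 _:+_
  infix 7 _:≤_ _:≡_
  infix 6 _⊠_
  infix 3 _⊢_

  data Expr (n : ℕ) : Set where
    var  : Fin n → Expr n
    con  : ℕ → Expr n
    _:+_ _:*_ : Expr n → Expr n → Expr n

  ⟦_⟧ : ∀ {n} → Expr n → Vec ℕ n → ℕ
  ⟦ var i ⟧ ρ  = lookup ρ i
  ⟦ con c ⟧ ρ  = c
  ⟦ e :+ f ⟧ ρ = ⟦ e ⟧ ρ + ⟦ f ⟧ ρ
  ⟦ e :* f ⟧ ρ = ⟦ e ⟧ ρ * ⟦ f ⟧ ρ

  Mono : ℕ → Set
  Mono n = List (Fin n)

  Poly : ℕ → Set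
  Poly n = List (ℕ × Mono n)

  module _ {n : ℕ} where

    -- Sorted monomials make equality up to commutativity plain equality of lists.
    insertM : Fin n → Mono n → Mono n
    insertM i []      = i ∷ []
    insertM i (j ∷ m) = if toℕ i ≤ᵇ toℕ j then i ∷ j ∷ m else j ∷ insertM i m

    mulM : Mono n → Mono n → Mono n
    mulM []      m = m
    mulM (i ∷ l) m = insertM i (mulM l m)

    _==_ : Mono n → Mono n → Bool
    []      == []      = true
    (i ∷ l) == (j ∷ m) = (toℕ i ≡ᵇ toℕ j) ∧ (l == m)
    _       == _       = false

    insertP : ℕ → Mono n → Poly n → Poly n
    insertP c m []            = (c , m) ∷ []
    insertP c m ((d , l) ∷ p) = if m == l then (c + d , l) ∷ p else (d , l) ∷ insertP c m p

    addP : Poly n → Poly n → Poly n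
    addP []            q = q
    addP ((c , m) ∷ p) q = insertP c m (addP p q)

    scaleP : ℕ → Mono n → Poly n → Poly n → Poly n
    scaleP c m []            r = r
    scaleP c m ((d , l) ∷ p) r = insertP (c * d) (mulM m l) (scaleP c m p r)

    mulP : Poly n → Poly n → Poly n
    mulP []            q = []
    mulP ((c , m) ∷ p) q = scaleP c m q (mulP p q)

    norm : Expr n → Poly n
    norm (var i)  = (1 , i ∷ []) ∷ []
    norm (con c)  = (c , []) ∷ []
    norm (e :+ f) = addP (norm e) (norm f)
    norm (e :* f) = mulP (norm e) (norm f)

    -- A partial subtraction, failing when the coefficient is too small. What remains therefore has
    -- natural coefficients and is nonnegative under every valuation.
    remove : ℕ → Mono n → Poly n → Maybe (Poly n)
    remove zero    m p = just p
    remove (suc c) m [] = nothing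
    remove (suc c) m ((d , l) ∷ p) with m == l
    ... | true  = if suc c ≤ᵇ d then just ((d ∸ suc c , l) ∷ p) else nothing
    ... | false with remove (suc c) m p
    ...   | just q  = just ((d , l) ∷ q)
    ...   | nothing = nothing

    _≼_ : Poly n → Poly n → Bool
    []            ≼ q = true
    ((c , m) ∷ p) ≼ q with remove c m q
    ... | just r  = p ≼ r
    ... | nothing = false

    module _ (ρ : Vec ℕ n) where

      ⟦_⟧M : Mono n → ℕ
      ⟦ [] ⟧M    = 1
      ⟦ i ∷ m ⟧M = lookup ρ i * ⟦ m ⟧M

      ⟦_⟧P : Poly n → ℕ
      ⟦ [] ⟧P          = 0
      ⟦ (c , m) ∷ p ⟧P = c * ⟦ m ⟧M + ⟦ p ⟧P

      insertM-sound : ∀ i m → ⟦ insertM i m ⟧M ≡ lookup ρ i * ⟦ m ⟧M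
      insertM-sound i [] = refl
      insertM-sound i (j ∷ m) with toℕ i ≤ᵇ toℕ j
      ... | true  = refl
      ... | false = trans (cong (lookup ρ j *_) (insertM-sound i m)) (*-swap (lookup ρ j) (lookup ρ i) ⟦ m ⟧M)

      mulM-sound : ∀ l m → ⟦ mulM l m ⟧M ≡ ⟦ l ⟧M * ⟦ m ⟧M
      mulM-sound []      m = sym (+-identityʳ _)
      mulM-sound (i ∷ l) m = trans (insertM-sound i (mulM l m))
        (trans (cong (lookup ρ i *_) (mulM-sound l m)) (sym (*-assoc (lookup ρ i) ⟦ l ⟧M ⟦ m ⟧M)))

      ==-sound : ∀ l m → (l == m) ≡ true → ⟦ l ⟧M ≡ ⟦ m ⟧M
      ==-sound [] [] eq = refl
      ==-sound (i ∷ l) (j ∷ m) eq with toℕ i ≡ᵇ toℕ j in e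
      ... | true = cong₂ _*_ (cong (lookup ρ) (toℕ-injective (≡ᵇ⇒≡ _ _ (subst T (sym e) tt)))) (==-sound l m eq)

      insertP-sound : ∀ c m p → ⟦ insertP c m p ⟧P ≡ c * ⟦ m ⟧M + ⟦ p ⟧P
      insertP-sound c m [] = refl
      insertP-sound c m ((d , l) ∷ p) with m == l in e
      ... | true  rewrite ==-sound m l e =
        trans (cong (_+ ⟦ p ⟧P) (*-distribʳ-+ ⟦ l ⟧M c d)) (+-assoc (c * ⟦ l ⟧M) _ _)
      ... | false = trans (cong (d * ⟦ l ⟧M +_) (insertP-sound c m p)) (+-swap (d * ⟦ l ⟧M) (c * ⟦ m ⟧M) ⟦ p ⟧P)

      addP-sound : ∀ p q → ⟦ addP p q ⟧P ≡ ⟦ p ⟧P + ⟦ q ⟧P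
      addP-sound [] q = refl
      addP-sound ((c , m) ∷ p) q = trans (insertP-sound c m (addP p q))
        (trans (cong (c * ⟦ m ⟧M +_) (addP-sound p q)) (sym (+-assoc (c * ⟦ m ⟧M) _ _)))

      scaleP-sound : ∀ c m p r → ⟦ scaleP c m p r ⟧P ≡ c * ⟦ m ⟧M * ⟦ p ⟧P + ⟦ r ⟧P
      scaleP-sound c m [] r rewrite *-zeroʳ (c * ⟦ m ⟧M) = refl
      scaleP-sound c m ((d , l) ∷ p) r = begin
        ⟦ insertP (c * d) (mulM m l) (scaleP c m p r) ⟧P
          ≡⟨ insertP-sound (c * d) (mulM m l) (scaleP c m p r) ⟩
        c * d * ⟦ mulM m l ⟧M + ⟦ scaleP c m p r ⟧P
          ≡⟨ cong₂ _+_ (trans (cong (c * d *_) (mulM-sound m l)) ([m*n]*[o*p]≡[m*o]*[n*p] c d ⟦ m ⟧M ⟦ l ⟧M))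
              (scaleP-sound c m p r) ⟩
        c * ⟦ m ⟧M * (d * ⟦ l ⟧M) + (c * ⟦ m ⟧M * ⟦ p ⟧P + ⟦ r ⟧P)
          ≡⟨ +-assoc (c * ⟦ m ⟧M * (d * ⟦ l ⟧M)) _ _ ⟨
        c * ⟦ m ⟧M * (d * ⟦ l ⟧M) + c * ⟦ m ⟧M * ⟦ p ⟧P + ⟦ r ⟧P
          ≡⟨ cong (_+ ⟦ r ⟧P) (*-distribˡ-+ (c * ⟦ m ⟧M) _ _) ⟨
        c * ⟦ m ⟧M * (d * ⟦ l ⟧M + ⟦ p ⟧P) + ⟦ r ⟧P ∎
        where open ≡-Reasoning

      mulP-sound : ∀ p q → ⟦ mulP p q ⟧P ≡ ⟦ p ⟧P * ⟦ q ⟧P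
      mulP-sound [] q = refl
      mulP-sound ((c , m) ∷ p) q = trans (scaleP-sound c m q (mulP p q))
        (trans (cong (c * ⟦ m ⟧M * ⟦ q ⟧P +_) (mulP-sound p q)) (sym (*-distribʳ-+ ⟦ q ⟧P (c * ⟦ m ⟧M) ⟦ p ⟧P)))

      norm-sound : ∀ e → ⟦ norm e ⟧P ≡ ⟦ e ⟧ ρ
      norm-sound (var i) = trans (+-identityʳ _) (trans (+-identityʳ _) (*-identityʳ _))
      norm-sound (con c) = trans (+-identityʳ _) (*-identityʳ c)
      norm-sound (e :+ f) = trans (addP-sound (norm e) (norm f)) (cong₂ _+_ (norm-sound e) (norm-sound f))
      norm-sound (e :* f) = trans (mulP-sound (norm e) (norm f)) (cong₂ _*_ (norm-sound e) (norm-sound f))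

      remove-sound : ∀ c m p {q} → remove c m p ≡ just q → ⟦ p ⟧P ≡ c * ⟦ m ⟧M + ⟦ q ⟧P
      remove-sound zero m p refl = refl
      remove-sound (suc c) m ((d , l) ∷ p) eq with m == l in e
      remove-sound (suc c) m ((d , l) ∷ p) eq | true with suc c ≤ᵇ d in le
      remove-sound (suc c) m ((d , l) ∷ p) refl | true | true
        rewrite ==-sound m l e = begin
          d * ⟦ l ⟧M + ⟦ p ⟧P
            ≡⟨ cong (λ t → t * ⟦ l ⟧M + ⟦ p ⟧P) (m+[n∸m]≡n (≤ᵇ⇒≤ (suc c) d (subst T (sym le) tt))) ⟨
          (suc c + (d ∸ suc c)) * ⟦ l ⟧M + ⟦ p ⟧P
            ≡⟨ cong (_+ ⟦ p ⟧P) (*-distribʳ-+ ⟦ l ⟧M (suc c) (d ∸ suc c)) ⟩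
          suc c * ⟦ l ⟧M + (d ∸ suc c) * ⟦ l ⟧M + ⟦ p ⟧P
            ≡⟨ +-assoc (suc c * ⟦ l ⟧M) _ _ ⟩
          suc c * ⟦ l ⟧M + ((d ∸ suc c) * ⟦ l ⟧M + ⟦ p ⟧P) ∎
        where open ≡-Reasoning
      remove-sound (suc c) m ((d , l) ∷ p) eq | false with remove (suc c) m p in r
      remove-sound (suc c) m ((d , l) ∷ p) refl | false | just q =
        trans (cong (d * ⟦ l ⟧M +_) (remove-sound (suc c) m p r)) (+-swap (d * ⟦ l ⟧M) (suc c * ⟦ m ⟧M) ⟦ q ⟧P)

      ≼-sound : ∀ p q → T (p ≼ q) → ⟦ p ⟧P ≤ ⟦ q ⟧P
      ≼-sound [] q _ = z≤n
      ≼-sound ((c , m) ∷ p) q t with remove c m q in e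
      ... | just r rewrite remove-sound c m q e = +-monoʳ-≤ (c * ⟦ m ⟧M) (≼-sound p r t)

  -- A certificate: every hypothesis is an inequality together with the polynomial
  -- it is multiplied by.  The conclusion follows if
  -- goalˡ + ∑ kᵢ Rᵢ is coefficientwise at most goalʳ + ∑ kᵢ Lᵢ.

  data Ineq (n : ℕ) : Set where
    _:≤_ : Expr n → Expr n → Ineq n

  data Scaled (n : ℕ) : Set where
    _⊠_ : Expr n → Ineq n → Scaled n

  data Claim (n : ℕ) : Set where
    _⊢_ : List (Scaled n) → Ineq n → Claim n

  Holds : ∀ {n} → Vec ℕ n → Ineq n → Set
  Holds ρ (e :≤ f) = ⟦ e ⟧ ρ ≤ ⟦ f ⟧ ρ

  sumˡ sumʳ : ∀ {n} → List (Scaled n) → Expr n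
  sumˡ [] = con 0
  sumˡ (k ⊠ e :≤ f ∷ hs) = k :* e :+ sumˡ hs
  sumʳ [] = con 0
  sumʳ (k ⊠ e :≤ f ∷ hs) = k :* f :+ sumʳ hs

  check : ∀ {n} → Claim n → Bool
  check (hs ⊢ e :≤ f) = norm (e :+ sumʳ hs) ≼ norm (f :+ sumˡ hs)

  Proves : ∀ {n} → Vec ℕ n → List (Scaled n) → Ineq n → Set
  Proves ρ [] g = Holds ρ g
  Proves ρ (k ⊠ h ∷ hs) g = Holds ρ h → Proves ρ hs g

  private
    proves : ∀ {n} (ρ : Vec ℕ n) hs e f → (⟦ sumˡ hs ⟧ ρ ≤ ⟦ sumʳ hs ⟧ ρ → ⟦ e ⟧ ρ ≤ ⟦ f ⟧ ρ) → Proves ρ hs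
        (e :≤ f)
    proves ρ [] e f k = k z≤n
    proves ρ (c ⊠ a :≤ b ∷ hs) e f k = λ h → proves ρ hs e f (λ s → k (+-mono-≤ (*-monoʳ-≤ (⟦ c ⟧ ρ) h) s))

  Conclusion : ∀ {n} → Vec ℕ n → Claim n → Set
  Conclusion ρ (hs ⊢ g) = Proves ρ hs g

  private
    sound : ∀ {n} (ρ : Vec ℕ n) (c : Claim n) → T (check c) → Conclusion ρ c
    sound ρ (hs ⊢ e :≤ f) t = proves ρ hs e f λ s → +-cancelʳ-≤ (⟦ sumˡ hs ⟧ ρ) _ _
      (≤-trans (+-monoʳ-≤ (⟦ e ⟧ ρ) s)
        (subst₂ _≤_ (norm-sound ρ (e :+ sumʳ hs)) (norm-sound ρ (f :+ sumˡ hs))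
          (≼-sound ρ (norm (e :+ sumʳ hs)) (norm (f :+ sumˡ hs)) t)))

  -- The hidden argument depends on the shape of the claim only, not on the values `ρ`. It computes
  -- to the unit type for a valid certificate and is then filled in silently.
  certify : ∀ {n} (ρ : Vec ℕ n) (f : N-ary n (Expr n) (Claim n)) →
    {_ : T (check (f $ⁿ tabulateV var))} → Conclusion ρ (f $ⁿ tabulateV var)
  certify ρ f {t} = sound ρ (f $ⁿ tabulateV var) t

  data Equation (n : ℕ) : Set where
    _:≡_ : Expr n → Expr n → Equation n

  Equal : ∀ {n} → Vec ℕ n → Equation n → Set
  Equal ρ (e :≡ f) = ⟦ e ⟧ ρ ≡ ⟦ f ⟧ ρ

  balanced : ∀ {n} → Equation n → Bool
  balanced (e :≡ f) = check ([] ⊢ e :≤ f) ∧ check ([] ⊢ f :≤ e)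

  private
    equal : ∀ {n} (ρ : Vec ℕ n) (q : Equation n) → T (balanced q) → Equal ρ q
    equal ρ (e :≡ f) t = let l , r = Equivalence.to T-∧ t in ≤-antisym (sound ρ ([] ⊢ e :≤ f) l) (sound ρ ([] ⊢ f :≤ e) r)

  equate : ∀ {n} (ρ : Vec ℕ n) (f : N-ary n (Expr n) (Equation n)) →
    {_ : T (balanced (f $ⁿ tabulateV var))} → Equal ρ (f $ⁿ tabulateV var)
  equate ρ f {t} = equal ρ (f $ⁿ tabulateV var) t

-- Finite sums over lists, averaging and indicators

module Sums where
  open Prelude
  open Certificates

  private variable
    A B : Set

  ∑ : List A → (A → ℕ) → ℕ
  ∑ []       f = 0
  ∑ (x ∷ xs) f = f x + ∑ xs f

  syntax ∑ xs (λ x → e) = ∑[ x ∈ xs ] e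
  infix 5 ∑

  ∑-sum : ∀ (xs : List A) (f : A → ℕ) → sum (map f xs) ≡ ∑ xs f
  ∑-sum []       f = refl
  ∑-sum (x ∷ xs) f = cong (f x +_) (∑-sum xs f)

  ∑-cong : ∀ (xs : List A) {f g : A → ℕ} → (∀ x → f x ≡ g x) → ∑ xs f ≡ ∑ xs g
  ∑-cong []       h = refl
  ∑-cong (x ∷ xs) h = cong₂ _+_ (h x) (∑-cong xs h)

  ∑-mono∈ : ∀ (xs : List A) {f g : A → ℕ} → (∀ x → x ∈ xs → f x ≤ g x) → ∑ xs f ≤ ∑ xs g
  ∑-mono∈ []       h = z≤n
  ∑-mono∈ (x ∷ xs) h = +-mono-≤ (h x (here refl)) (∑-mono∈ xs (λ y m → h y (there m)))

  ∑-mono : ∀ (xs : List A) {f g : A → ℕ} → (∀ x → f x ≤ g x) → ∑ xs f ≤ ∑ xs g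
  ∑-mono xs h = ∑-mono∈ xs (λ x _ → h x)

  ∑-+ : ∀ (xs : List A) (f g : A → ℕ) → ∑ xs (λ x → f x + g x) ≡ ∑ xs f + ∑ xs g
  ∑-+ []       f g = refl
  ∑-+ (x ∷ xs) f g rewrite ∑-+ xs f g =
    equate (f x ∷ g x ∷ ∑ xs f ∷ ∑ xs g ∷ []) λ a b c d → a :+ b :+ (c :+ d) :≡ a :+ c :+ (b :+ d)

  ∑-*ˡ : ∀ (xs : List A) (c : ℕ) (f : A → ℕ) → ∑ xs (λ x → c * f x) ≡ c * ∑ xs f
  ∑-*ˡ []       c f = sym (*-zeroʳ c)
  ∑-*ˡ (x ∷ xs) c f rewrite ∑-*ˡ xs c f = sym (*-distribˡ-+ c (f x) (∑ xs f))

  ∑-*ʳ : ∀ (xs : List A) (f : A → ℕ) (c : ℕ) → ∑ xs (λ x → f x * c) ≡ ∑ xs f * c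
  ∑-*ʳ []       f c = refl
  ∑-*ʳ (x ∷ xs) f c rewrite ∑-*ʳ xs f c = sym (*-distribʳ-+ c (f x) (∑ xs f))

  ∑-const : ∀ (xs : List A) (c : ℕ) → ∑ xs (λ _ → c) ≡ length xs * c
  ∑-const []       c = refl
  ∑-const (x ∷ xs) c = cong (c +_) (∑-const xs c)

  ∑-zero : ∀ (xs : List A) → ∑ xs (λ _ → 0) ≡ 0
  ∑-zero xs = trans (∑-const xs 0) (*-zeroʳ (length xs))

  ∑-++ : ∀ (xs ys : List A) (f : A → ℕ) → ∑ (xs ++ ys) f ≡ ∑ xs f + ∑ ys f
  ∑-++ []       ys f = refl
  ∑-++ (x ∷ xs) ys f rewrite ∑-++ xs ys f = sym (+-assoc (f x) _ _)

  ∑-map : ∀ (xs : List A) (g : A → B) (f : B → ℕ) → ∑ (map g xs) f ≡ ∑ xs (f ∘ g)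
  ∑-map []       g f = refl
  ∑-map (x ∷ xs) g f = cong (f (g x) +_) (∑-map xs g f)

  ∑-concat : ∀ (xss : List (List A)) (f : A → ℕ) → ∑ (concat xss) f ≡ ∑ xss (λ xs → ∑ xs f)
  ∑-concat []         f = refl
  ∑-concat (xs ∷ xss) f = trans (∑-++ xs (concat xss) f) (cong (∑ xs f +_) (∑-concat xss f))

  ∑-swap : ∀ (xs : List A) (ys : List B) (f : A → B → ℕ) →
    ∑ xs (λ x → ∑ ys (f x)) ≡ ∑ ys (λ y → ∑ xs (λ x → f x y))
  ∑-swap []       ys f = sym (∑-zero ys)
  ∑-swap (x ∷ xs) ys f = trans (cong (∑ ys (f x) +_) (∑-swap xs ys f)) (sym (∑-+ ys (f x) _))

  ∑-product : ∀ {C : Set} (g : A → B → C) (xs : List A) (ys : List B) (f : C → ℕ) →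
    ∑ (cartesianProductWith g xs ys) f ≡ ∑ xs (λ x → ∑ ys (λ y → f (g x y)))
  ∑-product g []       ys f = refl
  ∑-product g (x ∷ xs) ys f = trans (∑-++ (map (g x) ys) _ f)
      (cong₂ _+_ (∑-map ys (g x) f) (∑-product g xs ys f))

  ∑-length : ∀ (xs : List A) (c : ℕ) {f : A → ℕ} → (∀ x → f x ≤ c) → ∑ xs f ≤ length xs * c
  ∑-length xs c h = ≤-trans (∑-mono xs h) (≤-reflexive (∑-const xs c))

  ∈-≤-∑ : ∀ (xs : List A) (f : A → ℕ) {x} → x ∈ xs → f x ≤ ∑ xs f
  ∈-≤-∑ (x ∷ xs) f (here refl) = m≤m+n (f x) _
  ∈-≤-∑ (x ∷ xs) f (there m)   = ≤-trans (∈-≤-∑ xs f m) (m≤n+m _ (f x))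

  -- Averaging: this and its weak form turn counts into objects wherever a random choice would be
  -- customary.
  ∑-witness-< : ∀ (xs : List A) (f g : A → ℕ) → ∑ xs f < ∑ xs g → Σ A λ x → x ∈ xs × f x < g x
  ∑-witness-< (x ∷ xs) f g lt with f x <? g x
  ... | yes p = x , here refl , p
  ... | no ¬p with ∑-witness-< xs f g (+-cancelˡ-< (f x) _ _ (<-≤-trans lt (+-monoˡ-≤ (∑ xs g) (≮⇒≥ ¬p))))
  ...   | y , m , q = y , there m , q

  ∑-witness-≤ : ∀ (xs : List A) (f g : A → ℕ) → 0 < length xs → ∑ xs f ≤ ∑ xs g → Σ A λ x → x ∈ xs × f x ≤ g x
  ∑-witness-≤ (x ∷ xs) f g _ le with f x ≤? g x
  ... | yes p = x , here refl , p
  ... | no ¬p with ∑-witness-< xs f g (+-cancelˡ-< (f x) _ _ (≤-<-trans le (+-monoˡ-< (∑ xs g) (≰⇒> ¬p))))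
  ...   | y , m , q = y , there m , <⇒≤ q

  ∑-nonempty : ∀ (xs : List A) (f : A → ℕ) → 0 < ∑ xs f → Σ A λ x → x ∈ xs × 0 < f x
  ∑-nonempty xs f h = ∑-witness-< xs (λ _ → 0) f (subst (_< ∑ xs f) (sym (∑-zero xs)) h)

  true≢false : true ≡ false → ⊥
  true≢false ()

  argmin : ∀ (xs : List A) (p : A → Bool) (f : A → ℕ) {z} → z ∈ xs → p z ≡ true →
    Σ A λ x → p x ≡ true × (∀ y → y ∈ xs → p y ≡ true → f x ≤ f y)
  argmin {A = A} xs p f {z} m pz = go xs z pz .proj₁ , go xs z pz .proj₂ .proj₁ , λ y k q → go xs z pz .proj₂
      .proj₂ .proj₂ y k q
    where
    go : (ys : List A) (w : A) → p w ≡ true →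
      Σ A λ x → p x ≡ true × f x ≤ f w × (∀ y → y ∈ ys → p y ≡ true → f x ≤ f y)
    go [] w pw = w , pw , ≤-refl , λ _ ()
    go (y ∷ ys) w pw with go ys w pw
    ... | x , px , le , h with p y in e
    ...   | false = x , px , le , λ
        { _ (here refl) q → ⊥-elim (true≢false (trans (sym q) e)) ; v (there k) q → h v k q }
    ...   | true with f y ≤? f x
    ...     | yes a = y , e , ≤-trans a le , λ
        { _ (here refl) q → ≤-refl ; v (there k) q → ≤-trans a (h v k q) }
    ...     | no  a = x , px , le , λ { _ (here refl) q → <⇒≤ (≰⇒> a) ; v (there k) q → h v k q }

  𝟙≤1 : ∀ b → 𝟙 b ≤ 1
  𝟙≤1 true  = ≤-refl
  𝟙≤1 false = z≤n

  𝟙-∧ : ∀ a b → 𝟙 (a ∧ b) ≡ 𝟙 a * 𝟙 b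
  𝟙-∧ true  b = sym (+-identityʳ (𝟙 b))
  𝟙-∧ false b = refl

  𝟙-not : ∀ b → 𝟙 (not b) + 𝟙 b ≡ 1
  𝟙-not true  = refl
  𝟙-not false = refl

  𝟙-true : ∀ {b} → 0 < 𝟙 b → b ≡ true
  𝟙-true {true} _ = refl

  ∧-true : ∀ {a b} → a ∧ b ≡ true → a ≡ true × b ≡ true
  ∧-true {true} {true} _ = refl , refl

  does-true : ∀ {P : Set} (d : Dec P) → does d ≡ true → P
  does-true (yes p) _ = p

  true-does : ∀ {P : Set} (d : Dec P) → P → does d ≡ true
  true-does (yes p) _ = refl
  true-does (no ¬p) p = ⊥-elim (¬p p)

  𝟙-cases : ∀ {P : Set} (d : Dec P) → (P × 𝟙 (does d) ≡ 1) ⊎ ((¬ P) × 𝟙 (does d) ≡ 0)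
  𝟙-cases (yes p) = inj₁ (p , refl)
  𝟙-cases (no ¬p) = inj₂ (¬p , refl)

  does-false : ∀ {P : Set} (d : Dec P) → does d ≡ false → ¬ P
  does-false (no ¬p) _ = ¬p

  *-positiveʳ : ∀ a {b} → 0 < a * b → 0 < b
  *-positiveʳ a {zero}  h = ⊥-elim (<⇒≱ h (≤-reflexive (*-zeroʳ a)))
  *-positiveʳ a {suc b} h = s≤s z≤n

-- Vertex lists as multisets

module Multiplicities where
  open Prelude
  open Sums

  module _ {n : ℕ} where

    δ : Fin n → Fin n → ℕ
    δ v w = 𝟙 (does (v ≟ w))

    -- Disjointness of lists without repetition reads `occ v l + occ v m ≤ 1`, and spanning reads
    -- `occ v l ≡ 1`. Set conditions thus become linear (in)equalities that certificates can
    -- combine.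
    occ : Fin n → List (Fin n) → ℕ
    occ v l = ∑ l (δ v)

    Uniq : List (Fin n) → Set
    Uniq l = ∀ v → occ v l ≤ 1

    δ-refl : ∀ v → δ v v ≡ 1
    δ-refl v rewrite true-does (v ≟ v) refl = refl

    δ≤1 : ∀ v w → δ v w ≤ 1
    δ≤1 v w = 𝟙≤1 _

    δ-pos : ∀ {v w} → 0 < δ v w → v ≡ w
    δ-pos {v} {w} h = does-true (v ≟ w) (𝟙-true h)

    δ-sym : ∀ v w → δ v w ≡ δ w v
    δ-sym v w with v ≟ w
    ... | yes refl = sym (δ-refl v)
    ... | no ¬p with w ≟ v
    ...   | yes refl = ⊥-elim (¬p refl)
    ...   | no _ = refl

    occ-++ : ∀ v l m → occ v (l ++ m) ≡ occ v l + occ v m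
    occ-++ v l m = ∑-++ l m (δ v)

    occ-∈ : ∀ {v l} → v ∈ l → 0 < occ v l
    occ-∈ {v} {l} m = ≤-trans (≤-reflexive (sym (δ-refl v))) (∈-≤-∑ l (δ v) m)

    ∈-occ : ∀ {v} l → 0 < occ v l → v ∈ l
    ∈-occ {v} l h with ∑-nonempty l (δ v) h
    ... | w , m , p = subst (_∈ l) (sym (δ-pos p)) m

  ∑-tabulate : ∀ {A : Set} {n} (g : Fin n → A) (f : A → ℕ) → ∑ (tabulate g) f ≡ ∑ (allFin n) (f ∘ g)
  ∑-tabulate {n = n} g f = trans (cong (λ l → ∑ l f) (sym (map-tabulate id g))) (∑-map (allFin n) g f)

  ∑-suc : ∀ {n} (f : Fin (suc n) → ℕ) → ∑ (allFin (suc n)) f ≡ f zero + ∑ (allFin n) (f ∘ suc)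
  ∑-suc f = cong (f zero +_) (∑-tabulate suc f)

  ∑-Fin-const : ∀ n c → ∑ (allFin n) (λ _ → c) ≡ n * c
  ∑-Fin-const n c = trans (∑-const (allFin n) c) (cong (_* c) (length-tabulate {n = n} id))

  ∑-δ : ∀ {n} (w : Fin n) (f : Fin n → ℕ) → ∑ (allFin n) (λ v → δ v w * f v) ≡ f w
  ∑-δ {suc n} zero f = trans (∑-suc {n} (λ v → δ v zero * f v))
    (trans (cong₂ _+_ (+-identityʳ (f zero)) (∑-zero (allFin n))) (+-identityʳ _))
  ∑-δ {suc n} (suc w) f = trans (∑-suc {n} (λ v → δ v (suc w) * f v))
    (trans (∑-cong (allFin n) (λ v → cong (_* f (suc v)) (δ-suc v w))) (∑-δ w (f ∘ suc)))
    where
    δ-suc : ∀ {n} (v w : Fin n) → δ (suc v) (suc w) ≡ δ v w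
    δ-suc v w with v ≟ w
    ... | yes refl = refl
    ... | no _     = refl

  ∑-occ : ∀ {n} (l : List (Fin n)) (f : Fin n → ℕ) → ∑ l f ≡ ∑ (allFin n) (λ v → occ v l * f v)
  ∑-occ {n} l f = begin
    ∑ l f                                                   ≡⟨ ∑-cong l (λ w → sym (∑-δ w f)) ⟩
    ∑ l (λ w → ∑ (allFin n) (λ v → δ v w * f v))            ≡⟨ ∑-swap l (allFin n) (λ w v → δ v w * f v) ⟩
    ∑ (allFin n) (λ v → ∑ l (λ w → δ v w * f v))            ≡⟨ ∑-cong (allFin n) (λ v → ∑-*ʳ l (δ v) (f v)) ⟩
    ∑ (allFin n) (λ v → occ v l * f v)                      ∎
    where open ≡-Reasoning

  length-occ : ∀ {n} (l : List (Fin n)) → ∑ (allFin n) (λ v → occ v l) ≡ length l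
  length-occ {n} l = trans (∑-cong (allFin n) (λ v → sym (*-identityʳ (occ v l))))
    (trans (sym (∑-occ l (λ _ → 1))) (trans (∑-const l 1) (*-identityʳ _)))

  length-allFin : ∀ n → length (allFin n) ≡ n
  length-allFin n = length-tabulate {n = n} id

  occ-allFin : ∀ {n} (v : Fin n) → occ v (allFin n) ≡ 1
  occ-allFin {n} v = trans (∑-cong (allFin n) (λ w → trans (δ-sym v w) (sym (*-identityʳ (δ w v)))))
      (∑-δ v (λ _ → 1))

-- Complete multipartite subhypergraphs in dense weighted relations

module BlowUp where
  open Prelude
  open Certificates
  open Sums
  open Multiplicities

  abstract
    -- Each coordinate replaces C by 2C·(4C)^t: a factor 2 for discarding suffixes of low degree,
    -- then for each of the t rows the degree bound 2C and another factor 2 for avoiding used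
    -- vertices. The values are far too large to be unfolded.
    blowDensity blowSize : ℕ → ℕ → ℕ → ℕ
    blowDensity t zero    C = C
    blowDensity t (suc k) C = blowDensity t k (C * 2 * (C * 2 * 2) ^ t)
    blowSize t zero    C = 1
    blowSize t (suc k) C = C * 2 * 2 + blowSize t k (C * 2 * (C * 2 * 2) ^ t)

  module _ {n : ℕ} where

    vs : List (Fin n)
    vs = allFin n

    allVec : ∀ k → List (Vec (Fin n) k)
    allVec zero    = [] ∷ []
    allVec (suc k) = cartesianProductWith _∷_ vs (allVec k)

    ∑-allVec : ∀ k (f : Vec (Fin n) (suc k) → ℕ) → ∑ (allVec (suc k)) f ≡ ∑ vs
        (λ r → ∑ (allVec k) (λ v → f (r ∷ v)))
    ∑-allVec k f = ∑-product _∷_ vs (allVec k) f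

    ∑-allVec-const : ∀ k c → ∑ (allVec k) (λ _ → c) ≡ n ^ k * c
    ∑-allVec-const zero c = refl
    ∑-allVec-const (suc k) c = begin
      ∑ (allVec (suc k)) (λ _ → c)          ≡⟨ ∑-allVec k (λ _ → c) ⟩
      ∑ vs (λ _ → ∑ (allVec k) (λ _ → c))   ≡⟨ ∑-Fin-const n _ ⟩
      n * ∑ (allVec k) (λ _ → c)            ≡⟨ cong (n *_) (∑-allVec-const k c) ⟩
      n * (n ^ k * c)                       ≡⟨ *-assoc n (n ^ k) c ⟨
      n ^ suc k * c ∎
      where open ≡-Reasoning

    -- The density hypothesis carries the factor `ω x` on both sides and so says nothing about
    -- points of weight 0; it survives when the weight is thinned. As `F` has at most n/(2D)
    -- elements, at least half of each degree lies outside it, whence `D * 2`.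
    pick : ∀ {A : Set} (X : List A) (ω : A → ℕ) (f : Fin n → A → Bool) D F → 0 < n →
      (∀ x → n * ω x ≤ D * (ω x * ∑ vs (λ r → 𝟙 (f r x)))) → length F * (D * 2) ≤ n → 0 < ∑ X ω →
      Σ (Fin n) λ r → occ r F ≡ 0 × ∑ X ω ≤ D * 2 * ∑ X (λ x → ω x * 𝟙 (f r x))
    pick {A} X ω f D F 0<n dense small pos = finish (∑-witness-≤ vs (λ _ → ∑ X ω) val nonempty total)
      where
      av : Fin n → ℕ
      av r = 𝟙 (does (occ r F ≟ℕ 0))

      hit : Fin n → ℕ
      hit r = ∑ X (λ x → ω x * 𝟙 (f r x))

      val : Fin n → ℕ
      val r = D * 2 * (av r * hit r)

      nonempty : 0 < length vs
      nonempty = subst (0 <_) (sym (length-allFin n)) 0<n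

      split : ∀ r x → 𝟙 (f r x) ≤ av r * 𝟙 (f r x) + occ r F
      split r x with occ r F
      ... | zero  = ≤-trans (≤-reflexive (sym (+-identityʳ _))) (m≤m+n _ 0)
      ... | suc k = ≤-trans (𝟙≤1 _) (s≤s z≤n)

      free : A → ℕ
      free x = ∑ vs (λ r → av r * 𝟙 (f r x))

      deg≤ : ∀ x → ∑ vs (λ r → 𝟙 (f r x)) ≤ free x + length F
      deg≤ x = ≤-trans (∑-mono vs (λ r → split r x))
        (≤-reflexive (trans (∑-+ vs _ _) (cong (free x +_) (length-occ F))))

      pointwise : ∀ x → n * ω x ≤ D * 2 * (ω x * free x)
      pointwise x = certify (n ∷ ω x ∷ D ∷ free x ∷ length F ∷ ∑ vs (λ r → 𝟙 (f r x)) ∷ []) (λ n w D s l d →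
          con 2 ⊠ n :* w :≤ D :* (w :* d) ∷ con 2 :* D :* w ⊠ d :≤ s :+ l ∷ w ⊠ l :* (D :* con 2) :≤ n ∷ []
          ⊢ n :* w :≤ D :* con 2 :* (w :* s)) (dense x) (deg≤ x) small

      swapped : ∑ X (λ x → D * 2 * (ω x * free x)) ≡ ∑ vs val
      swapped = begin
        ∑ X (λ x → D * 2 * (ω x * free x))                          ≡⟨ ∑-*ˡ X (D * 2) _ ⟩
        D * 2 * ∑ X (λ x → ω x * free x)                            ≡⟨ cong (D * 2 *_)
            (∑-cong X (λ x → sym (∑-*ˡ vs (ω x) _))) ⟩
        D * 2 * ∑ X (λ x → ∑ vs (λ r → ω x * (av r * 𝟙 (f r x))))   ≡⟨ cong (D * 2 *_) (∑-swap X vs _) ⟩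
        D * 2 * ∑ vs (λ r → ∑ X (λ x → ω x * (av r * 𝟙 (f r x))))   ≡⟨ cong (D * 2 *_)
            (∑-cong vs (λ r → trans (∑-cong X (λ x → *-swap (ω x) (av r) _)) (∑-*ˡ X (av r) _))) ⟩
        D * 2 * ∑ vs (λ r → av r * hit r)                           ≡⟨ ∑-*ˡ vs (D * 2) _ ⟨
        ∑ vs val ∎
        where
        open ≡-Reasoning

      total : ∑ vs (λ _ → ∑ X ω) ≤ ∑ vs val
      total = begin
        ∑ vs (λ _ → ∑ X ω)                  ≡⟨ ∑-Fin-const n _ ⟩
        n * ∑ X ω                           ≡⟨ ∑-*ˡ X n ω ⟨
        ∑ X (λ x → n * ω x)                 ≤⟨ ∑-mono X pointwise ⟩
        ∑ X (λ x → D * 2 * (ω x * free x))  ≡⟨ swapped ⟩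
        ∑ vs val ∎
        where open ≤-Reasoning

      finish : (Σ (Fin n) λ r → r ∈ vs × ∑ X ω ≤ val r) → Σ (Fin n) λ r → occ r F ≡ 0 × ∑ X ω ≤ D * 2 * hit r
      finish (r , _ , le) with occ r F in e
      ... | zero  = r , e , subst (∑ X ω ≤_) (cong (D * 2 *_) (+-identityʳ (hit r))) le
      ... | suc _ = ⊥-elim (<⇒≱ pos (≤-trans le (≤-reflexive (*-zeroʳ (D * 2)))))

    pickMany : ∀ {A : Set} (X : List A) (ω : A → ℕ) (f : Fin n → A → Bool) D t F → 0 < n →
      (∀ x → n * ω x ≤ D * (ω x * ∑ vs (λ r → 𝟙 (f r x)))) → (length F + t) * (D * 2) ≤ n → 0 < ∑ X ω → Uniq F →
      Σ (List (Fin n)) λ l → length l ≡ t × (∀ v → occ v l + occ v F ≤ 1) ×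
        ∑ X ω ≤ (D * 2) ^ t * ∑ X (λ x → ω x * 𝟙 (all (λ r → f r x) l))
    pickMany X ω f D zero F 0<n dense small pos u =
      [] , refl , u , ≤-reflexive (trans (∑-cong X (λ x → sym (*-identityʳ (ω x)))) (sym (+-identityʳ _)))
    pickMany X ω f D (suc t) F 0<n dense small pos u
      with pick X ω f D F 0<n dense (≤-trans (*-monoˡ-≤ (D * 2) (m≤m+n (length F) (suc t))) small) pos
    ... | r , fresh , le
      with pickMany X (λ x → ω x * 𝟙 (f r x)) f D t (r ∷ F) 0<n
             (λ x → certify (n ∷ ω x ∷ 𝟙 (f r x) ∷ D ∷ ∑ vs (λ r → 𝟙 (f r x)) ∷ []) (λ n w b D d →
               b ⊠ n :* w :≤ D :* (w :* d) ∷ [] ⊢ n :* (w :* b) :≤ D :* (w :* b :* d)) (dense x))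
             (subst (λ z → z * (D * 2) ≤ n) (+-suc (length F) t) small)
             (*-positiveʳ (D * 2) (≤-trans pos le))
             uniq
      where
      uniq : Uniq (r ∷ F)
      uniq v with v ≟ r
      ... | yes refl rewrite fresh = ≤-refl
      ... | no _ = u v
    ... | l , len , un , bound = r ∷ l , cong suc len
        , (λ v → ≤-trans (≤-reflexive (rearr (δ v r) (occ v l) (occ v F))) (un v))
        , ≤-trans le (≤-trans (*-monoʳ-≤ (D * 2) bound)
            (≤-reflexive (trans (sym (*-assoc (D * 2) ((D * 2) ^ t) _)) (cong ((D * 2) ^ suc t *_)
              (∑-cong X (λ x → trans (*-assoc (ω x) _ _) (cong (ω x *_) (sym (𝟙-∧ (f r x) _)))))))))
      where
      rearr : ∀ a b c → a + b + c ≡ b + (a + c)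
      rearr a b c = trans (cong (_+ c) (+-comm a b)) (+-assoc b a c)

    good : ∀ k → (Vec (Fin n) k → Bool) → Vec (List (Fin n)) k → Bool
    good zero    ρ []      = ρ []
    good (suc k) ρ (l ∷ K) = good k (λ v → all (λ r → ρ (r ∷ v)) l) K

    flat : ∀ {k} → Vec (List (Fin n)) k → List (Fin n)
    flat []      = []
    flat (l ∷ K) = l ++ flat K

    abstract
      -- Weighted form of Erdős's theorem on complete k-partite subhypergraphs: one coordinate
      -- after the other, t rows are chosen that keep a constant fraction of the weight.
      blow : ∀ {A : Set} k t C (I : List A) (ω : A → ℕ) (ρ : A → Vec (Fin n) k → Bool) F → 0 < n → Uniq F →
        (length F + k * t) * blowSize t k C ≤ n → 0 < ∑ I ω →
        n ^ k * ∑ I ω ≤ C * ∑ I (λ i → ω i * ∑ (allVec k) (λ v → 𝟙 (ρ i v))) →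
        Σ (Vec (List (Fin n)) k) λ K → AllV (λ l → length l ≡ t) K × (∀ v → occ v (flat K) + occ v F ≤ 1) ×
          ∑ I ω ≤ blowDensity t k C * ∑ I (λ i → ω i * 𝟙 (good k (ρ i) K))
      blow zero t C I ω ρ F 0<n u size pos dense = [] , [] , u ,
        ≤-trans (≤-reflexive (sym (+-identityʳ _))) (≤-trans dense (≤-reflexive (cong (C *_)
          (∑-cong I (λ i → cong (ω i *_) (+-identityʳ _))))))
      blow {A} (suc k) t C I ω ρ F 0<n u size pos dense =
        let l , len , un , bound = pickMany X ω₁ f (C * 2) t F 0<n dense₁ size₁ pos₁ u
            K , lens , un′ , bound′ = blow k t C′ I ω (ρ′ l) (l ++ F) 0<n
                (λ v → subst (_≤ 1) (sym (occ-++ v l F)) (un v))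
              (size₂ l len) pos (dense₂ l bound)
        in l ∷ K , len ∷ lens
         , (λ v → ≤-trans (≤-reflexive (rearr v l (flat K))) (un′ v))
         , bound′
        where
        X : List (A × Vec (Fin n) k)
        X = cartesianProductWith _,_ I (allVec k)
        deg : A → Vec (Fin n) k → ℕ
        deg i v = ∑ vs (λ r → 𝟙 (ρ i (r ∷ v)))
        -- Suffixes with fewer than n/(2C) completions account for at most half of the weighted
        -- count. Discarding them costs a factor 2 and leaves a minimum degree, which is what
        -- `pickMany` needs.
        big : A → Vec (Fin n) k → Bool
        big i v = does (n ≤? C * 2 * deg i v)
        ω₁ : A × Vec (Fin n) k → ℕ
        ω₁ (i , v) = ω i * 𝟙 (big i v)
        f : Fin n → A × Vec (Fin n) k → Bool
        f r (i , v) = ρ i (r ∷ v)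
        C′ : ℕ
        C′ = C * 2 * (C * 2 * 2) ^ t
        ρ′ : List (Fin n) → A → Vec (Fin n) k → Bool
        ρ′ l i v = all (λ r → ρ i (r ∷ v)) l

        rearr : ∀ v l m → occ v (l ++ m) + occ v F ≡ occ v m + occ v (l ++ F)
        rearr v l m rewrite occ-++ v l m | occ-++ v l F =
          trans (cong (_+ occ v F) (+-comm (occ v l) (occ v m))) (+-assoc (occ v m) _ _)

        dense₁ : ∀ x → n * ω₁ x ≤ C * 2 * (ω₁ x * ∑ vs (λ r → 𝟙 (f r x)))
        dense₁ (i , v) with 𝟙-cases (n ≤? C * 2 * deg i v)
        ... | inj₁ (p , e) rewrite e = certify (n ∷ ω i ∷ C ∷ deg i v ∷ []) (λ n w C d →
                w ⊠ n :≤ C :* con 2 :* d ∷ [] ⊢ n :* (w :* con 1) :≤ C :* con 2 :* (w :* con 1 :* d)) p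
        ... | inj₂ (_ , e) rewrite e | *-zeroʳ (ω i) | *-zeroʳ n = z≤n

        size₁ : (length F + t) * (C * 2 * 2) ≤ n
        size₁ = ≤-trans (*-mono-≤ (+-monoʳ-≤ (length F) (m≤m+n t (k * t))) (m≤m+n (C * 2 * 2) _)) size

        size₂ : ∀ l → length l ≡ t → (length (l ++ F) + k * t) * blowSize t k C′ ≤ n
        size₂ l refl = ≤-trans (*-mono-≤ (≤-reflexive eq) (m≤n+m (blowSize t k C′) (C * 2 * 2))) size
          where
          eq : length (l ++ F) + k * length l ≡ length F + (length l + k * length l)
          eq rewrite length-++ l {F} = trans (cong (_+ k * length l) (+-comm (length l) (length F)))
              (+-assoc (length F) _ _)

        W : ℕ
        W = ∑ I ω
        S₁ : ℕ
        S₁ = ∑ X ω₁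

        markov : ∀ i v → C * 2 * (ω i * deg i v) ≤ C * 2 * n * ω₁ (i , v) + n * ω i
        markov i v with 𝟙-cases (n ≤? C * 2 * deg i v)
        ... | inj₁ (_ , e) rewrite e = certify (n ∷ ω i ∷ C ∷ deg i v ∷ []) (λ n w C d →
                C :* con 2 :* w ⊠ d :≤ n ∷ [] ⊢ C :* con 2 :* (w :* d) :≤ C :* con 2 :* n :* (w :* con 1) :+ n
                    :* w)
                (≤-trans (∑-length vs 1 (λ r → 𝟙≤1 (ρ i (r ∷ v))))
                    (≤-reflexive (trans (*-identityʳ _) (length-allFin n))))
        ... | inj₂ (¬p , e) rewrite e = certify (n ∷ ω i ∷ C ∷ deg i v ∷ []) (λ n w C d →
                w ⊠ C :* con 2 :* d :≤ n ∷ [] ⊢ C :* con 2 :* (w :* d) :≤ C :* con 2 :* n :* (w :* con 0) :+ n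
                    :* w) (<⇒≤ (≰⇒> ¬p))

        edges : ∑ I (λ i → ω i * ∑ (allVec (suc k)) (λ v → 𝟙 (ρ i v))) ≡ ∑ I
            (λ i → ∑ (allVec k) (λ v → ω i * deg i v))
        edges = ∑-cong I (λ i → trans (cong (ω i *_) (trans (∑-allVec k _) (∑-swap vs (allVec k) _)))
            (sym (∑-*ˡ (allVec k) (ω i) _)))

        summed : C * 2 * ∑ I (λ i → ∑ (allVec k) (λ v → ω i * deg i v)) ≤ C * 2 * n * S₁ + n * (n ^ k * W)
        summed = begin
          C * 2 * ∑ I (λ i → ∑ (allVec k) (λ v → ω i * deg i v))    ≡⟨ ∑-*ˡ I (C * 2) _ ⟨
          ∑ I (λ i → C * 2 * ∑ (allVec k) (λ v → ω i * deg i v))    ≡⟨ ∑-cong I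
              (λ i → sym (∑-*ˡ (allVec k) (C * 2) _)) ⟩
          ∑ I (λ i → ∑ (allVec k) (λ v → C * 2 * (ω i * deg i v)))  ≤⟨ ∑-mono I
              (λ i → ∑-mono (allVec k) (markov i)) ⟩
          ∑ I (λ i → ∑ (allVec k) (λ v → C * 2 * n * ω₁ (i , v) + n * ω i))
            ≡⟨ ∑-cong I (λ i → trans (∑-+ (allVec k) _ _)
                (cong₂ _+_ (∑-*ˡ (allVec k) (C * 2 * n) _) (∑-allVec-const k (n * ω i)))) ⟩
          ∑ I (λ i → C * 2 * n * ∑ (allVec k) (λ v → ω₁ (i , v)) + n ^ k * (n * ω i))
            ≡⟨ ∑-+ I _ _ ⟩
          ∑ I (λ i → C * 2 * n * ∑ (allVec k) (λ v → ω₁ (i , v))) + ∑ I (λ i → n ^ k * (n * ω i))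
            ≡⟨ cong₂ _+_ (trans (∑-*ˡ I (C * 2 * n) _)
                (cong (C * 2 * n *_) (sym (∑-product _,_ I (allVec k) ω₁))))
                         (trans (∑-*ˡ I (n ^ k) _) (trans (cong (n ^ k *_) (∑-*ˡ I n ω)) (*-swap (n ^ k) n W)))
                             ⟩
          C * 2 * n * S₁ + n * (n ^ k * W) ∎
          where
          open ≤-Reasoning

        kept : n ^ k * W ≤ C * 2 * S₁
        kept = *-cancelˡ-≤ n {{>-nonZero 0<n}}
            (certify (n ∷ n ^ k ∷ W ∷ C ∷ S₁ ∷ ∑ I (λ i → ∑ (allVec k) (λ v → ω i * deg i v)) ∷ [])
          (λ n p W C S E → con 2 ⊠ n :* p :* W :≤ C :* E ∷ con 1 ⊠ C :* con 2 :* E :≤ C :* con 2 :* n :* S :+ n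
              :* (p :* W) ∷ []
            ⊢ n :* (p :* W) :≤ n :* (C :* con 2 :* S)) (subst (λ z → n ^ suc k * W ≤ C * z) edges dense) summed)

        pos₁ : 0 < S₁
        pos₁ with S₁ in e
        ... | suc _ = s≤s z≤n
        ... | zero = ⊥-elim (<⇒≱ (*-mono-≤ (m^n>0 n {{>-nonZero 0<n}} k) pos)
                      (subst (n ^ k * W ≤_) (trans (cong (C * 2 *_) e) (*-zeroʳ (C * 2))) kept))

        dense₂ : ∀ l → S₁ ≤ (C * 2 * 2) ^ t * ∑ X (λ x → ω₁ x * 𝟙 (all (λ r → f r x) l)) →
          n ^ k * W ≤ C′ * ∑ I (λ i → ω i * ∑ (allVec k) (λ v → 𝟙 (ρ′ l i v)))
        dense₂ l h = begin
          n ^ k * W           ≤⟨ kept ⟩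
          C * 2 * S₁          ≤⟨ *-monoʳ-≤ (C * 2) h ⟩
          C * 2 * ((C * 2 * 2) ^ t * ∑ X (λ x → ω₁ x * 𝟙 (all (λ r → f r x) l)))
            ≡⟨ *-assoc (C * 2) _ _ ⟨
          C′ * ∑ X (λ x → ω₁ x * 𝟙 (all (λ r → f r x) l))
            ≡⟨ cong (C′ *_) (∑-product _,_ I (allVec k) _) ⟩
          C′ * ∑ I (λ i → ∑ (allVec k) (λ v → ω i * 𝟙 (big i v) * 𝟙 (ρ′ l i v)))
            ≤⟨ *-monoʳ-≤ C′ (∑-mono I (λ i → ∑-mono (allVec k)
                (λ v → *-monoˡ-≤ (𝟙 (ρ′ l i v))
                (≤-trans (*-monoʳ-≤ (ω i) (𝟙≤1 (big i v))) (≤-reflexive (*-identityʳ (ω i))))))) ⟩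
          C′ * ∑ I (λ i → ∑ (allVec k) (λ v → ω i * 𝟙 (ρ′ l i v)))
            ≡⟨ cong (C′ *_) (∑-cong I (λ i → ∑-*ˡ (allVec k) (ω i) _)) ⟩
          C′ * ∑ I (λ i → ω i * ∑ (allVec k) (λ v → 𝟙 (ρ′ l i v))) ∎
          where open ≤-Reasoning

    all-∈ : ∀ {A : Set} (p : A → Bool) {l x} → all p l ≡ true → x ∈ l → p x ≡ true
    all-∈ p {y ∷ l} h (here refl) = proj₁ (∧-true h)
    all-∈ p {y ∷ l} h (there m)   = all-∈ p (proj₂ (∧-true {p y} h)) m

    data _∈∈_ : ∀ {k} → Vec (Fin n) k → Vec (List (Fin n)) k → Set where
      []  : [] ∈∈ []
      _∷_ : ∀ {k r l} {v : Vec (Fin n) k} {K} → r ∈ l → v ∈∈ K → (r ∷ v) ∈∈ (l ∷ K)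

    good-∈ : ∀ k (ρ : Vec (Fin n) k → Bool) {K v} → good k ρ K ≡ true → v ∈∈ K → ρ v ≡ true
    good-∈ zero    ρ h []       = h
    good-∈ (suc k) ρ {l ∷ K} {r ∷ v} h (m ∷ ms) = all-∈ (λ r → ρ (r ∷ v)) (good-∈ k _ h ms) m

-- Fractional vertex covers of graphs of density 7/16

module FractionalCover where
  open Prelude
  open Certificates
  open Sums
  open Multiplicities

  module _ {n : ℕ} where

    V : List (Fin n)
    V = allFin n

    count : (Fin n → Bool) → ℕ
    count p = ∑ V (λ v → 𝟙 (p v))

    ∑² : (Fin n → Fin n → ℕ) → ℕ
    ∑² f = ∑ V (λ a → ∑ V (f a))

    ∑³ : (Fin n → Fin n → Fin n → ℕ) → ℕ
    ∑³ f = ∑ V (λ a → ∑² (f a))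

    ∑²-mono : ∀ {f g} → (∀ a b → f a b ≤ g a b) → ∑² f ≤ ∑² g
    ∑²-mono h = ∑-mono V (λ a → ∑-mono V (h a))

    ∑³-mono : ∀ {f g} → (∀ a b c → f a b c ≤ g a b c) → ∑³ f ≤ ∑³ g
    ∑³-mono h = ∑-mono V (λ a → ∑²-mono (h a))

    ∑²-+ : ∀ f g → ∑² (λ a b → f a b + g a b) ≡ ∑² f + ∑² g
    ∑²-+ f g = trans (∑-cong V (λ a → ∑-+ V (f a) (g a))) (∑-+ V _ _)

    ∑³-+ : ∀ f g → ∑³ (λ a b c → f a b c + g a b c) ≡ ∑³ f + ∑³ g
    ∑³-+ f g = trans (∑-cong V (λ a → ∑²-+ (f a) (g a))) (∑-+ V _ _)

    ∑²-fst : ∀ f → ∑² (λ a b → f a) ≡ n * ∑ V f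
    ∑²-fst f = trans (∑-cong V (λ a → ∑-Fin-const n (f a))) (∑-*ˡ V n f)

    ∑²-snd : ∀ f → ∑² (λ a b → f b) ≡ n * ∑ V f
    ∑²-snd f = ∑-Fin-const n _

    ∑²-* : ∀ f g → ∑² (λ a b → f a * g b) ≡ ∑ V f * ∑ V g
    ∑²-* f g = trans (∑-cong V (λ a → ∑-*ˡ V (f a) g)) (∑-*ʳ V f (∑ V g))

    ∑-one : ∑ V (λ _ → 1) ≡ n
    ∑-one = trans (∑-Fin-const n 1) (*-identityʳ n)

    count-not : ∀ p → count (λ v → not (p v)) + count p ≡ n
    count-not p = trans (sym (∑-+ V (λ v → 𝟙 (not (p v))) (λ v → 𝟙 (p v))))
        (trans (∑-cong V (λ v → 𝟙-not (p v))) ∑-one)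

  range : ℕ → List ℕ
  range zero    = []
  range (suc m) = suc m ∷ range m

  ∈-range : ∀ {m θ} → θ ∈ range m → 1 ≤ θ × θ ≤ m
  ∈-range {suc m} (here refl) = s≤s z≤n , ≤-refl
  ∈-range {suc m} (there k)   = proj₁ (∈-range k) , m≤n⇒m≤1+n (proj₂ (∈-range k))

  length-range : ∀ m → length (range m) ≡ m
  length-range zero    = refl
  length-range (suc m) = cong suc (length-range m)

  -- z/4ρ is a fractional vertex cover of the graph { ab : z a + z b ≥ 4ρ }.  Rounding at a threshold θ turns it
  -- into a half-integral one, equal to 1 where z ≥ 4ρ + 1 − θ and to 1/2 elsewhere on { z ≥ θ }.
  module _ {n : ℕ} (z : Fin n → ℕ) (ρ : ℕ) where

    above : ℕ → ℕ
    above θ = count {n} (λ v → does (θ ≤? z v))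

    above′ : ℕ → ℕ
    above′ θ = count {n} (λ v → does (ρ * 4 + 1 ≤? z v + θ))

    heavy : ℕ
    heavy = ∑² {n} (λ a b → 𝟙 (does (ρ * 4 ≤? z a + z b)))

    above′≤above : ∀ θ → θ ≤ ρ * 2 → above′ θ ≤ above θ
    above′≤above θ le = ∑-mono V pt
      where
      pt : ∀ v → 𝟙 (does (ρ * 4 + 1 ≤? z v + θ)) ≤ 𝟙 (does (θ ≤? z v))
      pt v with 𝟙-cases (ρ * 4 + 1 ≤? z v + θ) | 𝟙-cases (θ ≤? z v)
      ... | inj₂ (_ , e) | _ rewrite e = z≤n
      ... | inj₁ (_ , e) | inj₁ (_ , e′) rewrite e | e′ = ≤-refl
      ... | inj₁ (p , _) | inj₂ (q , _) = ⊥-elim (q (certify (ρ ∷ z v ∷ θ ∷ []) (λ ρ z θ →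
              con 1 ⊠ ρ :* con 4 :+ con 1 :≤ z :+ θ ∷ con 2 ⊠ θ :≤ ρ :* con 2 ∷ [] ⊢ θ :≤ z) p le))

    -- Let P and Q be the sets counted by `above` and `above′`, so that Q lies in P. If neither end
    -- of a heavy pair is in Q, each has value at most 4ρ - θ, so both lie in P. Hence heavy pairs
    -- lie in P × P or join Q to the complement of P: at most p² + 2q(n - p).
    heavy-bound : ∀ θ → θ ≤ ρ * 2 →
      heavy + 2 * (above θ * above′ θ) ≤ above θ * above θ + 2 * (above′ θ * n)
    heavy-bound θ le = begin
        heavy + 2 * (p * q)
          ≡⟨ lhs ⟩
        ∑² (λ a b → g a b + (P a * Q b + Q a * P b))
          ≤⟨ ∑²-mono pt ⟩
        ∑² (λ a b → P a * P b + (Q a + Q b))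
          ≡⟨ rhs ⟩
        p * p + 2 * (q * n) ∎
      where
      open ≤-Reasoning
      P Q : Fin n → ℕ
      P v = 𝟙 (does (θ ≤? z v))
      Q v = 𝟙 (does (ρ * 4 + 1 ≤? z v + θ))
      p = above θ
      q = above′ θ
      g : Fin n → Fin n → ℕ
      g a b = 𝟙 (does (ρ * 4 ≤? z a + z b))
      lhs : heavy + 2 * (p * q) ≡ ∑² (λ a b → g a b + (P a * Q b + Q a * P b))
      lhs rewrite ∑²-+ g (λ a b → P a * Q b + Q a * P b) | ∑²-+ (λ a b → P a * Q b) (λ a b → Q a * P b)
                | ∑²-* P Q | ∑²-* Q P = cong (heavy +_)
                    (cong (p * q +_) (trans (+-identityʳ (p * q)) (*-comm p q)))
      rhs : ∑² (λ a b → P a * P b + (Q a + Q b)) ≡ p * p + 2 * (q * n)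
      rhs rewrite ∑²-+ (λ a b → P a * P b) (λ a b → Q a + Q b) | ∑²-+ (λ a b → Q a) (λ a b → Q b)
                | ∑²-* P P | ∑²-fst Q | ∑²-snd Q | +-identityʳ (q * n) | *-comm n q = refl
      bool : ∀ g p q p′ q′ → (q ≡ true → p ≡ true) → (q′ ≡ true → p′ ≡ true) →
        (g ≡ true → q ≡ false → q′ ≡ false → p ≡ true × p′ ≡ true) →
        𝟙 g + (𝟙 p * 𝟙 q′ + 𝟙 q * 𝟙 p′) ≤ 𝟙 p * 𝟙 p′ + (𝟙 q + 𝟙 q′)
      bool g p true p′ q′ h _ _ rewrite h refl = certify (𝟙 g ∷ 𝟙 p′ ∷ 𝟙 q′ ∷ [])
          (λ g p q → con 1 ⊠ g :≤ con 1 ∷ []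
        ⊢ g :+ (con 1 :* q :+ con 1 :* p) :≤ con 1 :* p :+ (con 1 :+ q)) (𝟙≤1 g)
      bool g p false p′ true _ h _ rewrite h refl = certify (𝟙 g ∷ 𝟙 p ∷ []) (λ g p → con 1 ⊠ g :≤ con 1 ∷ []
        ⊢ g :+ (p :* con 1 :+ con 0) :≤ p :* con 1 :+ con 1) (𝟙≤1 g)
      bool true p false p′ false _ _ h rewrite proj₁ (h refl refl refl) | proj₂ (h refl refl refl) = ≤-refl
      bool false p false p′ false _ _ _ rewrite *-zeroʳ (𝟙 p) = z≤n
      small : ∀ v → does (ρ * 4 + 1 ≤? z v + θ) ≡ true → does (θ ≤? z v) ≡ true
      small v h = true-does (θ ≤? z v) (certify (ρ ∷ z v ∷ θ ∷ []) (λ ρ z θ →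
        con 1 ⊠ ρ :* con 4 :+ con 1 :≤ z :+ θ ∷ con 2 ⊠ θ :≤ ρ :* con 2 ∷ [] ⊢ θ :≤ z)
            (does-true (ρ * 4 + 1 ≤? z v + θ) h) le)
      large : ∀ a b → ρ * 4 ≤ z a + z b → does (ρ * 4 + 1 ≤? z b + θ) ≡ false → does (θ ≤? z a) ≡ true
      large a b h e = true-does (θ ≤? z a)
          (≮⇒≥ λ lt → does-false (ρ * 4 + 1 ≤? z b + θ) e (certify (ρ ∷ z a ∷ z b ∷ θ ∷ []) (λ ρ x y θ →
        con 1 ⊠ ρ :* con 4 :≤ x :+ y ∷ con 1 ⊠ con 1 :+ x :≤ θ ∷ [] ⊢ ρ :* con 4 :+ con 1 :≤ y :+ θ) h lt))
      pt : ∀ a b → g a b + (P a * Q b + Q a * P b) ≤ P a * P b + (Q a + Q b)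
      pt a b = bool (does (ρ * 4 ≤? z a + z b)) (does (θ ≤? z a)) (does (ρ * 4 + 1 ≤? z a + θ))
          (does (θ ≤? z b)) (does (ρ * 4 + 1 ≤? z b + θ))
        (small a) (small b) λ h e e′ → let le′ = does-true (ρ * 4 ≤? z a + z b) h in
          large a b le′ e′ , large b a (≤-trans le′ (≤-reflexive (+-comm (z a) (z b)))) e

    low-levels : ∀ v m → ∑ (range m) (λ θ → 𝟙 (does (θ ≤? z v))) ≤ z v × ∑ (range m) (λ θ → 𝟙 (does (θ ≤? z v)))
        ≤ m
    low-levels v zero = z≤n , z≤n
    low-levels v (suc m) with low-levels v m | 𝟙-cases (suc m ≤? z v)
    ... | a , b | inj₁ (p , e) rewrite e = ≤-trans (s≤s b) p , s≤s b
    ... | a , b | inj₂ (_ , e) rewrite e = a , m≤n⇒m≤1+n b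

    high-levels : ∀ v s m → let S = ∑ (range m) (λ θ → 𝟙 (does (s + 1 ≤? z v + θ))) in S ≡ 0 ⊎ S + s ≤ z v + m
    high-levels v s zero = inj₁ refl
    high-levels v s (suc m) with high-levels v s m | 𝟙-cases (s + 1 ≤? z v + suc m)
    ... | ih | inj₁ (p , e) rewrite e = inj₂ (≤-trans (s≤s (step ih)) (≤-reflexive (sym (+-suc (z v) m))))
      where
      step : ∀ {S} → S ≡ 0 ⊎ S + s ≤ z v + m → S + s ≤ z v + m
      step (inj₁ refl) = s≤s⁻¹ (subst₂ _≤_ (+-comm s 1) (+-suc (z v) m) p)
      step (inj₂ h) = h
    ... | inj₁ h | inj₂ (_ , e) rewrite e = inj₁ h
    ... | inj₂ h | inj₂ (_ , e) rewrite e = inj₂ (≤-trans h (+-monoʳ-≤ (z v) (n≤1+n m)))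

    -- For 1 ≤ θ ≤ 2ρ the thresholds θ and 4ρ + 1 - θ run through 1, ..., 4ρ exactly once, so the
    -- left side is the layer-cake sum of min(z, 4ρ). This is the reason for the `+ 1` in `above′`.
    levels : ∑ (range (ρ * 2)) (λ θ → above θ + above′ θ) ≤ ∑ V z
    levels = begin
      ∑ (range (ρ * 2)) (λ θ → above θ + above′ θ)
        ≡⟨ ∑-cong (range (ρ * 2)) (λ θ → sym (∑-+ V (P θ) (Q θ))) ⟩
      ∑ (range (ρ * 2)) (λ θ → ∑ V (λ v → P θ v + Q θ v))
        ≡⟨ ∑-swap (range (ρ * 2)) (V {n}) (λ θ v → P θ v + Q θ v) ⟩
      ∑ V (λ v → ∑ (range (ρ * 2)) (λ θ → P θ v + Q θ v))
        ≤⟨ ∑-mono V pt ⟩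
      ∑ V z ∎
      where
      open ≤-Reasoning
      P Q : ℕ → Fin n → ℕ
      P θ v = 𝟙 (does (θ ≤? z v))
      Q θ v = 𝟙 (does (ρ * 4 + 1 ≤? z v + θ))
      pt : ∀ v → ∑ (range (ρ * 2)) (λ θ → P θ v + Q θ v) ≤ z v
      pt v rewrite ∑-+ (range (ρ * 2)) (λ θ → P θ v) (λ θ → Q θ v)
        with low-levels v (ρ * 2) | high-levels v (ρ * 4) (ρ * 2)
      ... | a , b | inj₁ h rewrite h = ≤-trans (≤-reflexive (+-identityʳ _)) a
      ... | a , b | inj₂ h = certify (ρ ∷ z v ∷ ∑ (range (ρ * 2)) (λ θ → P θ v) ∷ ∑ (range (ρ * 2))
          (λ θ → Q θ v) ∷ [])
              (λ ρ z a b → con 1 ⊠ a :≤ ρ :* con 2 ∷ con 1 ⊠ b :+ ρ :* con 4 :≤ z :+ ρ :* con 2 ∷ [] ⊢ a :+ b :≤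
                  z) b h

  -- n is written as 4q + 2r + t with p = q + r, so that the certificates need no subtraction.
  cover-size : ∀ n p q G K → q ≤ p → 0 < n → G + 2 * (p * q) ≤ p * p + 2 * (q * n) →
    K * 7 * (n * n) ≤ K * 16 * G + n * n * 81 → K * n ≤ K * 2 * (p + q) + n * 14
  cover-size n p q G K q≤p 0<n h₁ h₂ with 2 * (p + q) ≤? n
  ... | no ¬le = certify (n ∷ p ∷ q ∷ K ∷ []) (λ n p q K → K ⊠ n :≤ con 2 :* (p :+ q) ∷ []
          ⊢ K :* n :≤ K :* con 2 :* (p :+ q) :+ n :* con 14) (<⇒≤ (≰⇒> ¬le))
  ... | yes le with m≤n⇒∃[o]m+o≡n le | m≤n⇒∃[o]m+o≡n q≤p
  ...   | t , refl | r , refl = certify (q ∷ r ∷ t ∷ K ∷ []) (λ q r t K →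
            -- Here t = n - 2(p + q) is what the cover lacks; 14 is 81/6 rounded up.
            con 1 ⊠ K :* con 6 :* t :≤ (con 2 :* (q :+ r :+ q) :+ t) :* con 81 ∷ []
            ⊢ con 6 :* (K :* (con 2 :* (q :+ r :+ q) :+ t)) :≤ con 6 :*
                (K :* con 2 :* (q :+ r :+ q) :+ (con 2 :* (q :+ r :+ q) :+ t) :* con 14))
          excess |> *-cancelˡ-≤ 6
    where
    open import Function using (_|>_)
    N = 2 * (q + r + q) + t
    excess : K * 6 * t ≤ N * 81
    excess = *-cancelʳ-≤ _ _ N {{>-nonZero 0<n}} (certify (q ∷ r ∷ t ∷ K ∷ G ∷ []) (λ q r t K G →
      let n = con 2 :* (q :+ r :+ q) :+ t in
      con 1 ⊠ K :* con 7 :* (n :* n) :≤ K :* con 16 :* G :+ n :* n :* con 81 ∷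
      K :* con 16 ⊠ G :+ con 2 :* ((q :+ r) :* q) :≤ (q :+ r) :* (q :+ r) :+ con 2 :* (q :* n) ∷ []
      ⊢ K :* con 6 :* t :* n :≤ n :* con 81 :* n) h₂ h₁)

  private
    -- In the application X = Kn, P = 4Kp and Q = 4Kq. With Q = X - a and P = X + b the last
    -- hypothesis becomes (6a - 81n)X ≤ 2ab + b², which fails because X is at least 302n and at
    -- least a. The slacks `j` and `i` replace subtractions.
    contradictory : ∀ X P Q n j i → X ≡ Q + n * 132 + j + i → P ≡ X + n * 160 + j → n * 302 ≤ X →
      7 * (X * X) + 2 * (P * Q) ≤ P * P + 8 * (X * Q) + 81 * (n * X) → n * n ≤ 0
    contradictory X P Q n j i refl refl h₁ h₂ = certify (Q ∷ n ∷ j ∷ i ∷ []) (λ Q n j i →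
      let X = Q :+ n :* con 132 :+ j :+ i
          P = X :+ n :* con 160 :+ j in
      con 1 ⊠ con 7 :* (X :* X) :+ con 2 :* (P :* Q) :≤ P :* P :+ con 8 :* (X :* Q) :+ con 81 :* (n :* X) ∷
      n :* con 711 :+ con 3 :* j :+ con 6 :* i ⊠ n :* con 302 :≤ X ∷ []
      ⊢ n :* n :≤ con 0) h₂ h₁

    rescaled : ∀ n p q G K → G + 2 * (p * q) ≤ p * p + 2 * (q * n) → K * 7 * (n * n) ≤ K * 16 * G + n * n * 81 →
      7 * ((K * n) * (K * n)) + 2 * ((K * 4 * p) * (K * 4 * q)) ≤
      (K * 4 * p) * (K * 4 * p) + 8 * ((K * n) * (K * 4 * q)) + 81 * (n * (K * n))
    rescaled n p q G K h₂ h₃ = certify (n ∷ p ∷ q ∷ K ∷ G ∷ []) (λ n p q K G →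
      K ⊠ K :* con 7 :* (n :* n) :≤ K :* con 16 :* G :+ n :* n :* con 81 ∷
      K :* K :* con 16 ⊠ G :+ con 2 :* (p :* q) :≤ p :* p :+ con 2 :* (q :* n) ∷ []
      ⊢ con 7 :* ((K :* n) :* (K :* n)) :+ con 2 :* ((K :* con 4 :* p) :* (K :* con 4 :* q)) :≤
        (K :* con 4 :* p) :* (K :* con 4 :* p) :+ con 8 :* ((K :* n) :* (K :* con 4 :* q)) :+ con 81 :*
            (n :* (K :* n))) h₃ h₂

    room : ∀ n p q K j → K * 2 * (p + q) ≤ K * n + n * 14 → K * n + n * 160 + j ≤ K * 4 * p → K * 4 * q + n *
        132 + j ≤ K * n
    room n p q K j h₁ h₂ = certify (n ∷ p ∷ q ∷ K ∷ j ∷ []) (λ n p q K j →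
      con 2 ⊠ K :* con 2 :* (p :+ q) :≤ K :* n :+ n :* con 14 ∷ con 1 ⊠ K :* n :+ n :* con 160 :+ j :≤ K :* con
          4 :* p ∷ []
      ⊢ K :* con 4 :* q :+ n :* con 132 :+ j :≤ K :* n) h₁ h₂

  -- On p + q = n/2 the bound p² + 2q(n - p) equals 3p² - 3pn + n², which falls from 7n²/16 at p =
  -- n/4 to n²/4 at p = n/2. Near equality with 7n²/16 therefore keeps p from exceeding n/4 by more
  -- than an error of order n/K.
  cover-concentrated : ∀ n p q G K → 0 < n → 302 ≤ K → K * 2 * (p + q) ≤ K * n + n * 14 →
    G + 2 * (p * q) ≤ p * p + 2 * (q * n) → K * 7 * (n * n) ≤ K * 16 * G + n * n * 81 →
    K * 4 * p ≤ K * n + n * 160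
  cover-concentrated n p q G K 0<n big h₁ h₂ h₃ = ≮⇒≥ λ lt →
    let j , eq  = m≤n⇒∃[o]m+o≡n (<⇒≤ lt)
        i , eq′ = m≤n⇒∃[o]m+o≡n (room n p q K j h₁ (≤-reflexive eq))
    in <⇒≱ (*-mono-≤ 0<n 0<n) (contradictory (K * n) (K * 4 * p) (K * 4 * q) n j i (sym eq′) (sym eq)
         (≤-trans (*-monoʳ-≤ n big) (≤-reflexive (*-comm n K))) (rescaled n p q G K h₂ h₃))

  module _ {n : ℕ} (z : Fin n → ℕ) (ρ K : ℕ) where

    private
      h : ℕ → ℕ
      h θ = K * 2 * (above z ρ θ + above′ z ρ θ) + n * 14

      upper : ∀ c m → (∀ θ → θ ≤ c + m → K * n ≤ h θ) → c * (K * n) + ∑ (range m) h ≤ ∑ (range (c + m)) h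
      upper zero    m _ = ≤-refl
      upper (suc c) m a = ≤-trans (≤-reflexive (+-assoc (K * n) (c * (K * n)) _))
        (+-mono-≤ (a (suc (c + m)) ≤-refl) (upper c m (λ θ le → a θ (m≤n⇒m≤1+n le))))

    -- By cover-size the half-integral cover at every threshold weighs almost n/4, while the average over all
    -- thresholds is at most n/4; hence some threshold θ ≤ ρ is almost tight.
    cover : 0 < n → 0 < ρ → 302 ≤ K → ∑ V z ≤ n * ρ →
      K * 7 * (n * n) ≤ K * 16 * heavy z ρ + n * n * 81 → K * 4 * above z ρ ρ ≤ K * n + n * 160
    cover 0<n 0<ρ big weight dense = conclude (∑-witness-≤ (range ρ) h (λ _ → K * n + n * 28) nonempty sums)
      where
      size : ∀ θ → θ ≤ ρ + ρ → K * n ≤ h θ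
      size θ le = cover-size n (above z ρ θ) (above′ z ρ θ) (heavy z ρ) K (above′≤above z ρ θ le′) 0<n
          (heavy-bound z ρ θ le′) dense
        where le′ = ≤-trans le (≤-reflexive (trans (cong (ρ +_) (sym (+-identityʳ ρ))) (*-comm 2 ρ)))
      double : ρ * 2 ≡ ρ + ρ
      double = trans (*-comm ρ 2) (cong (ρ +_) (+-identityʳ ρ))
      nonempty : 0 < length (range ρ)
      nonempty = subst (0 <_) (sym (length-range ρ)) 0<ρ
      S = ∑ (range (ρ + ρ)) (λ θ → above z ρ θ + above′ z ρ θ)
      all-levels : ∑ (range (ρ + ρ)) h ≤ K * 2 * S + (ρ + ρ) * (n * 14)
      all-levels = ≤-reflexive (trans (∑-+ (range (ρ + ρ)) _ _) (cong₂ _+_ (∑-*ˡ (range (ρ + ρ)) (K * 2) _)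
        (trans (∑-const (range (ρ + ρ)) (n * 14)) (cong (_* (n * 14)) (length-range (ρ + ρ))))))
      sums : ∑ (range ρ) h ≤ ∑ (range ρ) (λ _ → K * n + n * 28)
      -- The total is at most ρ(2Kn + 28n), and by `size` the thresholds above ρ take at least ρKn
      -- of it; the other ρ average at most Kn + 28n. A threshold θ ≤ ρ is wanted because only then
      -- is { z ≥ ρ } contained in { z ≥ θ }.
      sums = ≤-trans (certify (n ∷ ρ ∷ K ∷ S ∷ ∑ (range ρ) h ∷ ∑ (range (ρ + ρ)) h ∷ []) (λ n ρ K S a b →
          con 1 ⊠ ρ :* (K :* n) :+ a :≤ b ∷ con 1 ⊠ b :≤ K :* con 2 :* S :+ (ρ :+ ρ) :* (n :* con 14) ∷ K :* con
              2 ⊠ S :≤ n :* ρ ∷ []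
          ⊢ a :≤ ρ :* (K :* n :+ n :* con 28)) (upper ρ ρ size) all-levels
          (≤-trans (subst (λ m → ∑ (range m) (λ θ → above z ρ θ + above′ z ρ θ) ≤ ∑ V z) double (levels z ρ))
              weight))
        (≤-reflexive (sym (trans (∑-const (range ρ) _) (cong (_* (K * n + n * 28)) (length-range ρ)))))
      conclude : (Σ ℕ λ θ → θ ∈ range ρ × h θ ≤ K * n + n * 28) → K * 4 * above z ρ ρ ≤ K * n + n * 160
      conclude (θ , m , le) = ≤-trans (*-monoʳ-≤ (K * 4) mono)
          (cover-concentrated n (above z ρ θ) (above′ z ρ θ) (heavy z ρ) K 0<n big
            (certify (n ∷ K ∷ above z ρ θ + above′ z ρ θ ∷ []) (λ n K s →
              con 1 ⊠ K :* con 2 :* s :+ n :* con 14 :≤ K :* n :+ n :* con 28 ∷ [] ⊢ K :* con 2 :* s :≤ K :* n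
                  :+ n :* con 14) le)
            (heavy-bound z ρ θ (≤-trans θ≤ρ (m≤m*n ρ 2))) dense)
        where
        θ≤ρ = proj₂ (∈-range m)
        mono : above z ρ ρ ≤ above z ρ θ
        mono = ∑-mono V pt
          where
          pt : ∀ v → 𝟙 (does (ρ ≤? z v)) ≤ 𝟙 (does (θ ≤? z v))
          pt v with 𝟙-cases (ρ ≤? z v) | 𝟙-cases (θ ≤? z v)
          ... | inj₂ (_ , e) | _ rewrite e = z≤n
          ... | inj₁ (_ , e) | inj₁ (_ , e′) rewrite e | e′ = ≤-refl
          ... | inj₁ (p , _) | inj₂ (q , _) = ⊥-elim (q (≤-trans θ≤ρ p))

-- Low edges for every weighting of small average

module Duality where
  open Prelude
  open Certificates
  open Sums
  open Multiplicities
  open FractionalCover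

  module _ {n : ℕ} (H : Hypergraph3 n) where

    E : Fin n → Fin n → Fin n → ℕ
    E a b c = 𝟙 (edge H a b c)

    D : Fin n → ℕ
    D v = ∑² (E v)

    inside : (Fin n → Bool) → ℕ
    inside B = ∑³ (λ a b c → 𝟙 (B a) * 𝟙 (B b) * 𝟙 (B c) * E a b c)

    -- The density of each link, over ordered pairs, is at least 7/16 - 1/(16K).
    MinDegree : ℕ → Set
    MinDegree K = ∀ v → K * 7 * (n * n) ≤ K * 16 * D v + n * n

    NonExtremal : ℕ → Set
    NonExtremal k = ∀ B → count B ≡ (3 * n) / 4 → n * n * n ≤ k * inside B

  module _ {n : ℕ} where

    private
      shrink : ∀ t (B : Fin n → Bool) s → t + s ≡ count B →
        Σ (Fin n → Bool) λ B′ → count B′ ≡ s × (∀ v → 𝟙 (B′ v) ≤ 𝟙 (B v))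
      shrink zero    B s eq = B , sym eq , λ _ → ≤-refl
      shrink (suc t) B s eq =
        let w , _ , pos = ∑-nonempty V (λ v → 𝟙 (B v)) (subst (0 <_) eq (s≤s z≤n))
            B₁ : Fin n → Bool
            B₁ v = B v ∧ not (does (v ≟ w))
            pt : ∀ v → 𝟙 (B v) ≡ δ v w + 𝟙 (B₁ v)
            pt v = step (B v) (v ≟ w) (λ { refl → 𝟙-true pos })
            drop : count B ≡ 1 + count B₁
            drop = trans (∑-cong V pt) (trans (∑-+ V (λ v → δ v w) _)
              (cong (_+ count B₁) (trans (∑-cong V (λ v → δ-sym v w)) (occ-allFin w))))
            B′ , size , sub = shrink t B₁ s (suc-injective (trans eq drop))
        in B′ , size , λ v → ≤-trans (sub v) (≤-trans (m≤n+m (𝟙 (B₁ v)) (δ v w)) (≤-reflexive (sym (pt v))))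
        where
        step : ∀ {P : Set} b (d : Dec P) → (P → b ≡ true) → 𝟙 b ≡ 𝟙 (does d) + 𝟙 (b ∧ not (does d))
        step true  (yes p) h = refl
        step true  (no _)  h = refl
        step false (yes p) h = ⊥-elim (true≢false (sym (h p)))
        step false (no _)  h = refl

      grow : ∀ t (B : Fin n → Bool) s → s ≤ n → s ≡ t + count B →
        Σ (Fin n → Bool) λ B′ → count B′ ≡ s × Σ (Fin n → ℕ) λ Δ → (∀ v → 𝟙 (B′ v) ≤ 𝟙 (B v) + Δ v) × ∑ V Δ ≤ t
      grow zero    B s le eq = B , sym eq , (λ _ → 0) , (λ v → m≤m+n _ 0) , ≤-reflexive (∑-zero (V {n}))
      grow (suc t) B s le eq =
        let w , _ , out = ∑-witness-< V (λ v → 𝟙 (B v)) (λ _ → 1)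
              (subst (count B <_) (sym ∑-one)
                (≤-trans (s≤s (m≤n+m (count B) t)) (≤-trans (≤-reflexive (sym eq)) le)))
            B₁ : Fin n → Bool
            B₁ v = if does (v ≟ w) then true else B v
            pt : ∀ v → 𝟙 (B₁ v) ≡ 𝟙 (B v) + δ v w
            pt v = step (B v) (v ≟ w) (λ { refl → n<1⇒n≡0 out })
            add : count B₁ ≡ count B + 1
            add = trans (∑-cong V pt) (trans (∑-+ V (λ v → 𝟙 (B v)) _)
              (cong (count B +_) (trans (∑-cong V (λ v → δ-sym v w)) (occ-allFin w))))
            B′ , size , Δ , sub , small = grow t B₁ s le
                (trans eq (trans (sym (+-suc t (count B)))
                (cong (t +_) (trans (+-comm 1 (count B)) (sym add)))))
        in B′ , size , (λ v → δ v w + Δ v)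
         , (λ v → ≤-trans (sub v) (≤-reflexive (trans (cong (_+ Δ v) (pt v)) (+-assoc (𝟙 (B v)) _ _))))
         , ≤-trans (≤-reflexive (trans (∑-+ V (λ v → δ v w) Δ)
             (cong (_+ ∑ V Δ) (trans (∑-cong V (λ v → δ-sym v w)) (occ-allFin w))))) (s≤s small)
        where
        step : ∀ {P : Set} b (d : Dec P) → (P → 𝟙 b ≡ 0) → 𝟙 (if does d then true else b) ≡ 𝟙 b + 𝟙 (does d)
        step b (yes p) h rewrite h p = refl
        step b (no _)  h = sym (+-identityʳ _)

    -- Extremality speaks of sets of one exact size. `Δ` marks the vertices added, and only they can
    -- create new edges.
    resize : ∀ (B : Fin n → Bool) s → s ≤ n →
      Σ (Fin n → Bool) λ B′ → count B′ ≡ s × Σ (Fin n → ℕ) λ Δ → (∀ v → 𝟙 (B′ v) ≤ 𝟙 (B v) + Δ v) × ∑ V Δ ≤ s ∸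
          count B
    resize B s s≤n = go (≤-total (count B) s)
      where
      go : count B ≤ s ⊎ s ≤ count B → _
      go (inj₁ le) = grow (s ∸ count B) B s s≤n (sym (m∸n+n≡m le))
      go (inj₂ le) = let B′ , size , sub = shrink (count B ∸ s) B s (m∸n+n≡m le) in
        B′ , size , (λ _ → 0) , (λ v → ≤-trans (sub v) (m≤m+n _ 0)) , ≤-trans (≤-reflexive (∑-zero (V {n}))) z≤n

  -- If some δ is positive the right side is at least 1; if all vanish, monotonicity suffices.
  product-bound : ∀ {x y z b₁ b₂ b₃ δ₁ δ₂ δ₃ e} → x ≤ 1 → y ≤ 1 → z ≤ 1 → e ≤ 1 →
    x ≤ b₁ + δ₁ → y ≤ b₂ + δ₂ → z ≤ b₃ + δ₃ → x * y * z * e ≤ b₁ * b₂ * b₃ * e + (δ₁ + (δ₂ + δ₃))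
  product-bound {b₁ = b₁} {b₂} {b₃} {suc d} px py pz pe h₁ h₂ h₃ =
    ≤-trans (*-mono-≤ (*-mono-≤ (*-mono-≤ px py) pz) pe) (≤-trans (s≤s z≤n) (m≤n+m _ (b₁ * b₂ * b₃ * _)))
  product-bound {b₁ = b₁} {b₂} {b₃} {zero} {suc d} px py pz pe h₁ h₂ h₃ =
    ≤-trans (*-mono-≤ (*-mono-≤ (*-mono-≤ px py) pz) pe) (≤-trans (s≤s z≤n) (m≤n+m _ (b₁ * b₂ * b₃ * _)))
  product-bound {b₁ = b₁} {b₂} {b₃} {zero} {zero} {suc d} px py pz pe h₁ h₂ h₃ =
    ≤-trans (*-mono-≤ (*-mono-≤ (*-mono-≤ px py) pz) pe) (≤-trans (s≤s z≤n) (m≤n+m _ (b₁ * b₂ * b₃ * _)))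
  product-bound {δ₁ = zero} {zero} {zero} {e} px py pz pe h₁ h₂ h₃ =
    ≤-trans (*-monoˡ-≤ e (*-mono-≤ (*-mono-≤ (≤-trans h₁ (≤-reflexive (+-identityʳ _)))
        (≤-trans h₂ (≤-reflexive (+-identityʳ _)))) (≤-trans h₃ (≤-reflexive (+-identityʳ _)))))
        (≤-reflexive (sym (+-identityʳ _)))

  module _ {n : ℕ} (H : Hypergraph3 n) (F : Fin n → Bool) (Y : Fin n → ℕ) (σ : ℕ) where

    outside : ℕ
    outside = count (λ v → not (F v))

    -- The weight of c counts twice because the third part of a block is twice as large as the
    -- others.
    low : Fin n → Fin n → Fin n → Bool
    low a b c = edge H a b c ∧ (not (F a) ∧ (not (F b) ∧ (not (F c) ∧ does (Y a + Y b + 2 * Y c ≤? σ * 4))))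

    low-intro : ∀ a b c → edge H a b c ≡ true → F a ≡ false → F b ≡ false → F c ≡ false → Y a + Y b + 2 * Y c ≤
        σ * 4 → low a b c ≡ true
    low-intro a b c e fa fb fc y rewrite e | fa | fb | fc = true-does (Y a + Y b + 2 * Y c ≤? σ * 4) y

    low-elim : ∀ a b c → low a b c ≡ true →
      edge H a b c ≡ true × F a ≡ false × F b ≡ false × F c ≡ false × Y a + Y b + 2 * Y c ≤ σ * 4
    low-elim a b c h with edge H a b c | F a | F b | F c
    ... | true | false | false | false = refl , refl , refl , refl , does-true (Y a + Y b + 2 * Y c ≤? σ * 4) h

    -- Duality: no weight function of small average is a fractional cover.  Otherwise, for the vertex u
    -- of minimum weight, the excess Y − Y u is a light fractional vertex cover of the link of u, so it is
    -- concentrated on a quarter of the vertices and the others span no edges.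
    module _ (k d K : ℕ) (big : 302 ≤ K) (big′ : k * 252 ≤ K) (n>0 : 0 < n) (σ>0 : 0 < σ)
      (few : K * count F ≤ n) (light : suc d * ∑ V (λ v → 𝟙 (not (F v)) * Y v) ≤ d * (outside * σ))
      (deg : MinDegree H K) (nonext : NonExtremal H k) where

      private
        Kx : ℕ
        Kx = K * suc d

        #low : ℕ
        #low = ∑³ (λ a b c → 𝟙 (low a b c))

        lowAt : Fin n → ℕ
        lowAt u = ∑² (λ a b → 𝟙 (low a b u))

        #low-last : #low ≡ ∑ V lowAt
        #low-last = trans (∑-cong (V {n}) (λ a → ∑-swap (V {n}) (V {n}) (λ b c → 𝟙 (low a b c))))
            (∑-swap (V {n}) (V {n}) (λ a c → ∑ V (λ b → 𝟙 (low a b c))))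

        -- Vertices in the doubled place of too many low triples. They must be excluded before the
        -- minimum of `Y` is taken, since the argument needs few low triples at the minimiser.
        x : Fin n → Bool
        x u = does (n * n ≤? Kx * lowAt u)

        ex : Fin n → Bool
        ex u = if F u then true else x u

        module _ (sparse : Kx * Kx * #low < n * n * n) where

          x-few : Kx * count x ≤ n
          x-few = *-cancelʳ-≤ _ _ (n * n) {{>-nonZero (*-mono-≤ n>0 n>0)}} (begin
            Kx * count x * (n * n)                    ≡⟨ *-assoc Kx (count x) (n * n) ⟩
            Kx * (count x * (n * n))                  ≡⟨ cong (Kx *_) (∑-*ʳ (V {n}) (λ u → 𝟙 (x u)) (n * n)) ⟨
            Kx * ∑ V (λ u → 𝟙 (x u) * (n * n))        ≤⟨ *-monoʳ-≤ Kx (∑-mono V pt) ⟩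
            Kx * ∑ V (λ u → Kx * lowAt u)             ≡⟨ cong (Kx *_) (∑-*ˡ V Kx lowAt) ⟩
            Kx * (Kx * ∑ V lowAt)                     ≡⟨ *-assoc Kx Kx _ ⟨
            Kx * Kx * ∑ V lowAt                       ≡⟨ cong (Kx * Kx *_) #low-last ⟨
            Kx * Kx * #low                            ≤⟨ <⇒≤ sparse ⟩
            n * n * n                                 ≡⟨ *-assoc n n n ⟩
            n * (n * n) ∎)
            where
            open ≤-Reasoning
            pt : ∀ u → 𝟙 (x u) * (n * n) ≤ Kx * lowAt u
            pt u with 𝟙-cases (n * n ≤? Kx * lowAt u)
            ... | inj₁ (p , e) rewrite e = ≤-trans (≤-reflexive (+-identityʳ _)) p
            ... | inj₂ (_ , e) rewrite e = z≤n

          ex-sum : count ex ≤ count F + count x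
          ex-sum = ≤-trans (∑-mono V pt) (≤-reflexive (∑-+ (V {n}) (λ u → 𝟙 (F u)) (λ u → 𝟙 (x u))))
            where
            pt : ∀ u → 𝟙 (ex u) ≤ 𝟙 (F u) + 𝟙 (x u)
            pt u = bool (F u) (x u)
              where
              bool : ∀ f x → 𝟙 (if f then true else x) ≤ 𝟙 f + 𝟙 x
              bool true  x = s≤s z≤n
              bool false x = ≤-refl

          n-split : outside + count F ≡ n
          n-split = count-not F

          out-half : n ≤ outside * 2
          out-half = certify (n ∷ outside ∷ count F ∷ K ∷ []) (λ n o f K →
              con 1 ⊠ K :* f :≤ n ∷ f ⊠ con 302 :≤ K ∷ con 2 ⊠ n :≤ o :+ f ∷ [] ⊢ n :≤ o :* con 2) few big
                  (≤-reflexive (sym n-split))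

          x-out : suc d * count x ≤ outside
          x-out = *-cancelˡ-≤ 302 (certify (n ∷ outside ∷ count x ∷ K ∷ suc d ∷ []) (λ n o x K d →
              con 1 ⊠ K :* d :* x :≤ n ∷ d :* x ⊠ con 302 :≤ K ∷ con 1 ⊠ n :≤ o :* con 2 ∷ [] ⊢ con 302 :*
                  (d :* x) :≤ con 302 :* o) x-few big out-half)

          ex-few : K * count ex ≤ n * 2
          ex-few = certify (n ∷ count F ∷ count x ∷ count ex ∷ K ∷ d ∷ []) (λ n f x e K d →
              con 1 ⊠ K :* f :≤ n ∷ con 1 ⊠ K :* (con 1 :+ d) :* x :≤ n ∷ K ⊠ e :≤ f :+ x ∷ [] ⊢ K :* e :≤ n :*
                  con 2) few x-few ex-sum

          some : Σ (Fin n) λ u → u ∈ V × 𝟙 (ex u) < 1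
          some = ∑-witness-< V (λ u → 𝟙 (ex u)) (λ _ → 1) (subst (count ex <_) (sym ∑-one)
              (≰⇒> λ n≤ → <⇒≱ n>0 (*-cancelˡ-≤ 300 (certify (n ∷ count ex ∷ K ∷ []) (λ n e K →
                con 1 ⊠ K :* e :≤ n :* con 2 ∷ K ⊠ n :≤ e ∷ n ⊠ con 302 :≤ K ∷ [] ⊢ con 300 :* n :≤ con 300 :*
                    con 0) ex-few n≤ big))))

          abstract
            minimal : Σ (Fin n) λ u → not (ex u) ≡ true × (∀ v → v ∈ V → not (ex v) ≡ true → Y u ≤ Y v)
            minimal = let w , m , p = some in argmin V (λ u → not (ex u)) Y m (lemma (ex w) p)
              where
              lemma : ∀ b → 𝟙 b < 1 → not b ≡ true
              lemma false _ = refl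
              lemma true (s≤s ())

          u : Fin n
          u = proj₁ minimal

          ex-u : ex u ≡ false
          ex-u = not-true (proj₁ (proj₂ minimal))
            where
            not-true : ∀ {b} → not b ≡ true → b ≡ false
            not-true {false} _ = refl

          u-min : ∀ v → ex v ≡ false → Y u ≤ Y v
          u-min v e = proj₂ (proj₂ minimal) v (∈-allFin v) (cong not e)

          ex-false : ∀ v → ex v ≡ false → F v ≡ false × x v ≡ false
          ex-false v e = bool (F v) (x v) e
            where
            bool : ∀ f x → (if f then true else x) ≡ false → f ≡ false × x ≡ false
            bool false x h = refl , h

          z : Fin n → ℕ
          z v = 𝟙 (not (ex v)) * (Y v ∸ Y u)

          regular : ℕ
          regular = count (λ v → not (ex v))

          regular-large : outside ≤ regular + count x
          regular-large = ≤-trans (∑-mono V pt)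
              (≤-reflexive (∑-+ (V {n}) (λ v → 𝟙 (not (ex v))) (λ v → 𝟙 (x v))))
            where
            pt : ∀ v → 𝟙 (not (F v)) ≤ 𝟙 (not (ex v)) + 𝟙 (x v)
            pt v = bool (F v) (x v)
              where
              bool : ∀ f x → 𝟙 (not f) ≤ 𝟙 (not (if f then true else x)) + 𝟙 x
              bool true  x = z≤n
              bool false x = ≤-reflexive (sym (𝟙-not x))

          z-sum : ∑ V z + regular * Y u ≤ ∑ V (λ v → 𝟙 (not (F v)) * Y v)
          z-sum = ≤-trans (≤-reflexive (trans
              (cong (∑ V z +_) (sym (∑-*ʳ (V {n}) (λ v → 𝟙 (not (ex v))) (Y u))))
              (sym (∑-+ (V {n}) z (λ v → 𝟙 (not (ex v)) * Y u))))) (∑-mono V pt)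
            where
            pt : ∀ v → z v + 𝟙 (not (ex v)) * Y u ≤ 𝟙 (not (F v)) * Y v
            pt v = bool (ex v) (F v) (Y v) (Y u) λ e → proj₁ (ex-false v e) , u-min v e
              where
              bool : ∀ e f y y₀ → (e ≡ false → f ≡ false × y₀ ≤ y) → 𝟙 (not e) * (y ∸ y₀) + 𝟙 (not e) * y₀ ≤ 𝟙
                  (not f) * y
              bool true  f y y₀ h = z≤n
              bool false f y y₀ h rewrite proj₁ (h refl) | +-identityʳ (y ∸ y₀) | +-identityʳ y₀ | +-identityʳ y
                  =
                ≤-reflexive (m∸n+n≡m (proj₂ (h refl)))

          outside>0 : 0 < outside
          outside>0 = *-cancelʳ-< 2 0 outside (≤-trans n>0 out-half)

          -- Otherwise every vertex outside `ex` weighs at least σ, and these are too many for an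
          -- average below σ·d/(d + 1).
          below : Y u < σ
          below = ≰⇒> λ σ≤ → <⇒≱ (*-mono-≤ outside>0 σ>0) (*-cancelˡ-≤ 300 (tight σ≤))
            where
            x-tiny : 302 * (suc d * count x) ≤ outside * 2
            x-tiny = certify (n ∷ outside ∷ count x ∷ K ∷ suc d ∷ []) (λ n o x K d →
              con 1 ⊠ K :* d :* x :≤ n ∷ d :* x ⊠ con 302 :≤ K ∷ con 1 ⊠ n :≤ o :* con 2 ∷ [] ⊢ con 302 :*
                  (d :* x) :≤ o :* con 2) x-few big out-half
            tight : σ ≤ Y u → 300 * (outside * σ) ≤ 300 * 0
            tight σ≤ = certify (outside ∷ count x ∷ regular ∷ d ∷ σ ∷ Y u ∷ ∑ V z ∷ ∑ V
                (λ v → 𝟙 (not (F v)) * Y v) ∷ []) (λ o x r d σ y z s →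
                con 302 ⊠ (con 1 :+ d) :* s :≤ d :* (o :* σ) ∷ con 302 :* (con 1 :+ d) ⊠ z :+ r :* y :≤ s ∷
                con 302 :* (con 1 :+ d) :* σ ⊠ o :≤ r :+ x ∷ con 302 :* (con 1 :+ d) :* r ⊠ σ :≤ y ∷ σ ⊠ con 302
                    :* ((con 1 :+ d) :* x) :≤ o :* con 2 ∷ []
                ⊢ con 300 :* (o :* σ) :≤ con 300 :* con 0) light z-sum regular-large σ≤ x-tiny

          ρ : ℕ
          ρ = σ ∸ Y u

          σ-split : ρ + Y u ≡ σ
          σ-split = m∸n+n≡m (<⇒≤ below)

          -- Subtracting `Y u` from the regular vertices alone misses the vertices of `x`, at most a
          -- fraction 1/(d + 1) of the outside. The factor d/(d + 1) in `light` pays exactly for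
          -- them.
          z-light : ∑ V z ≤ n * ρ
          z-light = *-cancelˡ-≤ (suc d) (certify
            (n ∷ outside ∷ count x ∷ count F ∷ regular ∷ d ∷ ρ ∷ Y u ∷ ∑ V z ∷ ∑ V (λ v → 𝟙 (not (F v)) * Y v) ∷
                []) (λ n o x f r d ρ y z s →
              con 1 ⊠ (con 1 :+ d) :* s :≤ d :* (o :* (ρ :+ y)) ∷ con 1 :+ d ⊠ z :+ r :* y :≤ s ∷ (con 1 :+ d)
                  :* y ⊠ o :≤ r :+ x ∷
              y ⊠ (con 1 :+ d) :* x :≤ o ∷ (con 1 :+ d) :* ρ ⊠ o :+ f :≤ n ∷ []
              ⊢ (con 1 :+ d) :* z :≤ (con 1 :+ d) :* (n :* ρ))
            (subst (λ t → suc d * ∑ V (λ v → 𝟙 (not (F v)) * Y v) ≤ d * (outside * t)) (sym σ-split) light)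
            z-sum regular-large x-out (≤-reflexive n-split))

          z-value : ∀ v → ex v ≡ false → z v + Y u ≡ Y v
          z-value v e rewrite e = trans (cong (_+ Y u) (+-identityʳ _)) (m∸n+n≡m (u-min v e))

          -- A link edge ab of u that the cover misses gives a low triple with u in the doubled
          -- place, where the excess is 0. Hence up to few exceptions `z` covers the whole link.
          cheap₂ : ∀ a b → ex a ≡ false → ex b ≡ false → ¬ (ρ * 4 ≤ z a + z b) → Y a + Y b + 2 * Y u ≤ σ * 4
          cheap₂ a b ea eb ¬p = subst (λ t → Y a + Y b + 2 * Y u ≤ t * 4) σ-split
              (subst₂ (λ s t → s + t + 2 * Y u ≤ (ρ + Y u) * 4) (z-value a ea) (z-value b eb)
            (certify (z a ∷ z b ∷ Y u ∷ ρ ∷ [])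
                (λ a b y ρ → con 1 ⊠ a :+ b :≤ ρ :* con 4 ∷ [] ⊢ a :+ y :+ (b :+ y) :+ con 2 :* y :≤ (ρ :+ y) :*
                con 4)
              (<⇒≤ (≰⇒> ¬p))))

          cheap₃ : ∀ a b c → ex a ≡ false → ex b ≡ false → ex c ≡ false → ¬ (ρ ≤ z a) → ¬ (ρ ≤ z b) → ¬
              (ρ ≤ z c) → Y a + Y b + 2 * Y c ≤ σ * 4
          cheap₃ a b c ea eb ec p q r = subst (λ t → Y a + Y b + 2 * Y c ≤ t * 4) σ-split
              (subst₂ (λ s t → s + t + 2 * Y c ≤ (ρ + Y u) * 4) (z-value a ea) (z-value b eb)
            (subst (λ t → z a + Y u + (z b + Y u) + 2 * t ≤ (ρ + Y u) * 4) (z-value c ec)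
              (certify (z a ∷ z b ∷ z c ∷ Y u ∷ ρ ∷ [])
                  (λ a b c y ρ → con 1 ⊠ a :≤ ρ ∷ con 1 ⊠ b :≤ ρ ∷ con 2 ⊠ c :≤ ρ ∷ []
                ⊢ a :+ y :+ (b :+ y) :+ con 2 :* (c :+ y) :≤ (ρ :+ y) :* con 4) (<⇒≤ (≰⇒> p)) (<⇒≤ (≰⇒> q))
                    (<⇒≤ (≰⇒> r)))))

          link : D H u ≤ heavy z ρ + lowAt u + (n * count ex + n * count ex)
          link = begin
            D H u ≤⟨ ∑²-mono pt ⟩
            ∑² (λ a b → 𝟙 (does (ρ * 4 ≤? z a + z b)) + 𝟙 (low a b u) + (𝟙 (ex a) + 𝟙 (ex b)))
              ≡⟨ trans (∑²-+ (λ a b → g a b + 𝟙 (low a b u)) (λ a b → 𝟙 (ex a) + 𝟙 (ex b)))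
                  (cong₂ _+_ (∑²-+ g (λ a b → 𝟙 (low a b u)))
                  (trans (∑²-+ (λ a b → 𝟙 (ex a)) (λ a b → 𝟙 (ex b)))
                  (cong₂ _+_ (∑²-fst (λ a → 𝟙 (ex a))) (∑²-snd (λ b → 𝟙 (ex b)))))) ⟩
            heavy z ρ + lowAt u + (n * count ex + n * count ex) ∎
            where
            open ≤-Reasoning
            g : Fin n → Fin n → ℕ
            g a b = 𝟙 (does (ρ * 4 ≤? z a + z b))
            bool : ∀ ea eb e g l → (ea ≡ false → eb ≡ false → e ≡ true → g ≡ false → l ≡ true) → 𝟙 e ≤ 𝟙 g + 𝟙 l
                + (𝟙 ea + 𝟙 eb)
            bool ea    eb    false g     l h = z≤n
            bool true  eb    true  g     l h = ≤-trans (s≤s z≤n) (m≤n+m _ (𝟙 g + 𝟙 l))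
            bool false true  true  g     l h = ≤-trans (s≤s z≤n) (m≤n+m _ (𝟙 g + 𝟙 l))
            bool false false true  true  l h = s≤s z≤n
            bool false false true  false l h rewrite h refl refl refl refl = s≤s z≤n
            pt : ∀ a b → E H u a b ≤ 𝟙 (does (ρ * 4 ≤? z a + z b)) + 𝟙 (low a b u) + (𝟙 (ex a) + 𝟙 (ex b))
            pt a b = bool (ex a) (ex b) (edge H u a b) (does (ρ * 4 ≤? z a + z b)) (low a b u) λ ea eb e ¬p →
              low-intro a b u (trans (trans (sym₂₃ H a b u) (sym₁₂ H a u b)) e)
                (proj₁ (ex-false a ea)) (proj₁ (ex-false b eb)) (proj₁ (ex-false u ex-u))
                    (cheap₂ a b ea eb (does-false (ρ * 4 ≤? z a + z b) ¬p))

          lowAt-u : Kx * lowAt u ≤ n * n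
          lowAt-u = <⇒≤ (≰⇒> λ p → true≢false
              (trans (sym (true-does (n * n ≤? Kx * lowAt u) p)) (proj₂ (ex-false u ex-u))))

          -- 81 = 1 + 16 + 64: the degree condition, the low triples at u, and the pairs meeting
          -- `ex`.
          heavy-many : K * 7 * (n * n) ≤ K * 16 * heavy z ρ + n * n * 81
          heavy-many = certify (n ∷ heavy z ρ ∷ lowAt u ∷ count ex ∷ K ∷ d ∷ D H u ∷ []) (λ n h l e K d D →
            con 1 ⊠ K :* con 7 :* (n :* n) :≤ K :* con 16 :* D :+ n :* n ∷ K :* con 16 ⊠ D :≤ h :+ l :+
                (n :* e :+ n :* e) ∷
            con 16 ⊠ K :* (con 1 :+ d) :* l :≤ n :* n ∷ n :* con 32 ⊠ K :* e :≤ n :* con 2 ∷ []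
            ⊢ K :* con 7 :* (n :* n) :≤ K :* con 16 :* h :+ n :* n :* con 81) (deg u) link lowAt-u ex-few

          concentrated : K * 4 * above z ρ ρ ≤ K * n + n * 160
          concentrated = cover z ρ K n>0 (m<n⇒0<n∸m below) big z-light heavy-many

          B : Fin n → Bool
          B v = not (ex v) ∧ not (does (ρ ≤? z v))

          B-large : n ≤ count B + (count ex + above z ρ ρ)
          B-large = ≤-trans (≤-reflexive (sym ∑-one)) (≤-trans (∑-mono V pt)
            (≤-reflexive (trans (∑-+ (V {n}) (λ v → 𝟙 (B v)) (λ v → 𝟙 (ex v) + 𝟙 (does (ρ ≤? z v))))
                (cong (count B +_) (∑-+ (V {n}) (λ v → 𝟙 (ex v)) (λ v → 𝟙 (does (ρ ≤? z v))))))))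
            where
            pt : ∀ v → 1 ≤ 𝟙 (B v) + (𝟙 (ex v) + 𝟙 (does (ρ ≤? z v)))
            pt v with ex v | does (ρ ≤? z v)
            ... | true  | _     = s≤s z≤n
            ... | false | true  = s≤s z≤n
            ... | false | false = s≤s z≤n

          B-low : ∀ a b c → 𝟙 (B a) * 𝟙 (B b) * 𝟙 (B c) * E H a b c ≤ 𝟙 (low a b c)
          B-low a b c = bool (ex a) (ex b) (ex c) (does (ρ ≤? z a)) (does (ρ ≤? z b)) (does (ρ ≤? z c))
              (edge H a b c) (low a b c)
            λ ea eb ec p q r e → low-intro a b c e (proj₁ (ex-false a ea)) (proj₁ (ex-false b eb))
                (proj₁ (ex-false c ec))
              (cheap₃ a b c ea eb ec (does-false (ρ ≤? z a) p) (does-false (ρ ≤? z b) q)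
                  (does-false (ρ ≤? z c) r))
            where
            bool : ∀ ea eb ec ga gb gc e l →
              (ea ≡ false → eb ≡ false → ec ≡ false → ga ≡ false → gb ≡ false → gc ≡ false → e ≡ true → l ≡
                  true) →
              𝟙 (not ea ∧ not ga) * 𝟙 (not eb ∧ not gb) * 𝟙 (not ec ∧ not gc) * 𝟙 e ≤ 𝟙 l
            bool true  _ _ _ _ _ _ _ h = z≤n
            bool false _ _ true _ _ _ _ h = z≤n
            bool false true _ false _ _ _ _ h = z≤n
            bool false false _ false true _ _ _ h = z≤n
            bool false false true false false _ _ _ h = z≤n
            bool false false false false false true _ _ h = z≤n
            bool false false false false false false false _ h = z≤n
            bool false false false false false false true l h rewrite h refl refl refl refl refl refl refl =
                ≤-refl

          target : ℕ
          target = (3 * n) / 4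

          target-4 : target * 4 ≤ 3 * n
          target-4 = m/n*n≤m (3 * n) 4

          target≤n : target ≤ n
          target≤n = *-cancelʳ-≤ _ _ 4 (≤-trans target-4
              (certify (n ∷ []) (λ n → [] ⊢ con 3 :* n :≤ n :* con 4)))

          -- 42 = 40 + 2: at most n/4 + 40n/K vertices have excess at least ρ, and at most 2n/K lie
          -- in `ex`.
          deficit : K * (target ∸ count B) ≤ n * 42
          deficit = go (≤-total target (count B))
            where
            go : target ≤ count B ⊎ count B ≤ target → K * (target ∸ count B) ≤ n * 42
            go (inj₁ le) rewrite m≤n⇒m∸n≡0 le | *-zeroʳ K = z≤n
            go (inj₂ le) = *-cancelˡ-≤ 4 (certify
                (n ∷ K ∷ target ∸ count B ∷ count B ∷ count ex ∷ above z ρ ρ ∷ target ∷ []) (λ n K d B e a t →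
                K ⊠ t :* con 4 :≤ con 3 :* n ∷ con 4 :* K ⊠ d :+ B :≤ t ∷ con 4 :* K ⊠ n :≤ B :+ (e :+ a) ∷ con
                    4 ⊠ K :* e :≤ n :* con 2 ∷ con 1 ⊠ K :* con 4 :* a :≤ K :* n :+ n :* con 160 ∷ []
                ⊢ con 4 :* (K :* d) :≤ con 4 :* (n :* con 42)) target-4 (≤-reflexive (m∸n+n≡m le)) B-large
                    ex-few concentrated)

          edges-low : Σ (Fin n → Bool) λ B″ → count B″ ≡ target × K * inside H B″ ≤ K * #low + 126 * (n * n * n)
          edges-low =
            let B″ , size , Δ , sub , small = resize B target target≤n
                bound : inside H B″ ≤ #low + (n * (n * ∑ V Δ) + (n * (n * ∑ V Δ) + n * (n * ∑ V Δ)))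
                bound = ≤-trans (∑³-mono (λ a b c → ≤-trans
                          (product-bound {b₁ = 𝟙 (B a)} {𝟙 (B b)} {𝟙 (B c)} {Δ a} {Δ b} {Δ c} (𝟙≤1 (B″ a))
                              (𝟙≤1 (B″ b)) (𝟙≤1 (B″ c)) (𝟙≤1 (edge H a b c)) (sub a) (sub b) (sub c))
                          (+-monoˡ-≤ (Δ a + (Δ b + Δ c)) (B-low a b c))))
                        (≤-reflexive (trans (∑³-+ (λ a b c → 𝟙 (low a b c)) (λ a b c → Δ a + (Δ b + Δ c)))
                            (cong (#low +_) (trans (∑³-+ (λ a b c → Δ a) (λ a b c → Δ b + Δ c))
                          (cong₂ _+_ (trans (∑-cong (V {n}) (λ a → ∑²-fst {n} (λ _ → Δ a)))
                              (trans (∑-*ˡ (V {n}) n (λ a → ∑ (V {n}) (λ _ → Δ a)))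
                              (cong (n *_) (trans (∑-cong (V {n}) (λ a → ∑-Fin-const n (Δ a)))
                              (∑-*ˡ (V {n}) n Δ)))))
                            (trans (∑³-+ (λ a b c → Δ b) (λ a b c → Δ c))
                                (cong₂ _+_ (trans (∑-Fin-const n _) (cong (n *_) (∑²-fst Δ)))
                                (trans (∑-Fin-const n _) (cong (n *_) (∑²-snd Δ))))))))))
            in B″ , size , certify (n ∷ K ∷ inside H B″ ∷ #low ∷ ∑ V Δ ∷ target ∸ count B ∷ []) (λ n K i l Δ t →
                 K ⊠ i :≤ l :+ (n :* (n :* Δ) :+ (n :* (n :* Δ) :+ n :* (n :* Δ))) ∷ con 3 :* (n :* n) :* K ⊠ Δ
                     :≤ t ∷ con 3 :* (n :* n) ⊠ K :* t :≤ n :* con 42 ∷ []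
                 ⊢ K :* i :≤ K :* l :+ con 126 :* (n :* n :* n)) bound small deficit

          -- Each coordinate of a triple may be one of the added vertices, hence 126 = 3·42. As K ≥
          -- 252k, these triples are at most half of the n³/k that `nonext` provides; the other half
          -- must be low.
          absurd : ⊥
          absurd =
            let B″ , size , few″ = edges-low
                many = nonext B″ size
            in <⇒≱ sparse (≤-trans (*-cancelˡ-≤ K {{>-nonZero (≤-trans (s≤s z≤n) big)}}
                (certify (n * n * n ∷ K ∷ k ∷ inside H B″ ∷ #low ∷ []) (λ N K k i l →
                 K :* con 2 ⊠ N :≤ k :* i ∷ con 2 :* k ⊠ K :* i :≤ K :* l :+ con 126 :* N ∷ N ⊠ k :* con 252 :≤
                     K ∷ []
                 ⊢ K :* N :≤ K :* (con 2 :* k :* l)) many few″ big′))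
               (*-monoˡ-≤ #low (certify (K ∷ k ∷ d ∷ [])
                   (λ K k d → con 1 ⊠ k :* con 252 :≤ K ∷ K ⊠ con 302 :≤ K ∷ []
                 ⊢ con 2 :* k :≤ K :* (con 1 :+ d) :* (K :* (con 1 :+ d))) big′ big)))

      dual : n * n * n ≤ Kx * Kx * #low
      dual = ≮⇒≥ absurd

-- Tripartite blocks and the load potential

module Blocks where
  open Prelude
  open Certificates
  open Sums
  open Multiplicities
  open FractionalCover
  open import Data.List.Properties using (take++drop≡id; length-take; length-drop)
  open import Data.List.Membership.Propositional.Properties using (∈-++⁺ˡ; ∈-++⁺ʳ)

  module _ {n : ℕ} where

    keep : (Fin n → Bool) → List (Fin n) → List (Fin n)
    keep p []      = []
    keep p (v ∷ l) = if p v then v ∷ keep p l else keep p l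

    keep-length : ∀ p l → length (keep p l) + ∑ l (λ v → 𝟙 (not (p v))) ≡ length l
    keep-length p [] = refl
    keep-length p (v ∷ l) with p v
    ... | true  = cong suc (keep-length p l)
    ... | false = trans (+-suc _ _) (cong suc (keep-length p l))

    occ-keep : ∀ p v l → occ v (keep p l) ≡ 𝟙 (p v) * occ v l
    occ-keep p v [] = sym (*-zeroʳ (𝟙 (p v)))
    occ-keep p v (w ∷ l) with p w in e
    ... | true  rewrite occ-keep p v l | *-distribˡ-+ (𝟙 (p v)) (δ v w) (occ v l) = cong (_+ 𝟙 (p v) * occ v l)
        (lemma (v ≟ w))
      where
      lemma : (d : Dec (v ≡ w)) → 𝟙 (does d) ≡ 𝟙 (p v) * 𝟙 (does d)
      lemma (yes refl) rewrite e = refl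
      lemma (no _) = sym (*-zeroʳ (𝟙 (p v)))
    ... | false rewrite occ-keep p v l | *-distribˡ-+ (𝟙 (p v)) (δ v w) (occ v l) = cong (_+ 𝟙 (p v) * occ v l)
        (lemma (v ≟ w))
      where
      lemma : (d : Dec (v ≡ w)) → 0 ≡ 𝟙 (p v) * 𝟙 (does d)
      lemma (yes refl) rewrite e = refl
      lemma (no _) = sym (*-zeroʳ (𝟙 (p v)))

    ∈-keep : ∀ p {v} l → v ∈ keep p l → v ∈ l × p v ≡ true
    ∈-keep p (w ∷ l) m with p w in e
    ... | false = there (proj₁ (∈-keep p l m)) , proj₂ (∈-keep p l m)
    ∈-keep p (w ∷ l) (here refl) | true = here refl , e
    ∈-keep p (w ∷ l) (there m)   | true = there (proj₁ (∈-keep p l m)) , proj₂ (∈-keep p l m)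

    ∈-take : ∀ m {v : Fin n} l → v ∈ take m l → v ∈ l
    ∈-take m l h = subst (_ ∈_) (take++drop≡id m l) (∈-++⁺ˡ h)

    ∈-drop : ∀ m {v : Fin n} l → v ∈ drop m l → v ∈ l
    ∈-drop m l h = subst (_ ∈_) (take++drop≡id m l) (∈-++⁺ʳ (take m l) h)

    occ-take-drop : ∀ m v (l : List (Fin n)) → occ v (take m l) + occ v (drop m l) ≡ occ v l
    occ-take-drop m v l = trans (sym (occ-++ v (take m l) (drop m l))) (cong (occ v) (take++drop≡id m l))

    occ-take : ∀ m v (l : List (Fin n)) → occ v (take m l) ≤ occ v l
    occ-take m v l = ≤-trans (m≤m+n _ _) (≤-reflexive (occ-take-drop m v l))

    length-take-exact : ∀ m (l : List (Fin n)) → m ≤ length l → length (take m l) ≡ m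
    length-take-exact m l h = trans (length-take m l) (m≤n⇒m⊓n≡m h)

    chunks : ℕ → ℕ → List (Fin n) → List (List (Fin n))
    chunks zero    m l = []
    chunks (suc f) m l = take m l ∷ chunks f m (drop m l)

    concat-chunks : ∀ f m l → length l ≤ f * m → concat (chunks f m l) ≡ l
    concat-chunks zero    m []      _ = refl
    concat-chunks (suc f) m l h = trans (cong (take m l ++_) (concat-chunks f m (drop m l)
      (≤-trans (≤-reflexive (length-drop m l)) (m≤n+o⇒m∸n≤o (length l) m h)))) (take++drop≡id m l)

    length-chunks : ∀ f m l → length (chunks f m l) ≡ f
    length-chunks zero    m l = refl
    length-chunks (suc f) m l = cong suc (length-chunks f m (drop m l))

    ∈-chunks : ∀ f m l {c} → c ∈ chunks f m l → length c ≤ m × (∀ v → occ v c ≤ occ v l)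
    ∈-chunks (suc f) m l (here refl) = ≤-trans (≤-reflexive (length-take m l)) (m⊓n≤m m (length l)) , λ v →
        occ-take m v l
    ∈-chunks (suc f) m l (there k) = proj₁ ih , λ v → ≤-trans (proj₂ ih v)
        (≤-trans (m≤n+m _ (occ v (take m l))) (≤-reflexive (occ-take-drop m v l)))
      where ih = ∈-chunks f m (drop m l) k

  module _ {n : ℕ} (H : Hypergraph3 n) where

    -- A complete tripartite piece with parts A, B and C ∪ C′ in the ratio 1 : 1 : 2,
    -- the proportions in which a long loose path visits them.
    record Block (m : ℕ) : Set where
      constructor block
      field
        A B C C′ : List (Fin n)
        lenA : length A ≡ m
        lenB : length B ≡ m
        lenC : length C ≡ m
        lenC′ : length C′ ≡ m
        complete : ∀ {a b c} → a ∈ A → b ∈ B → c ∈ C ⊎ c ∈ C′ → edge H a b c ≡ true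
    open Block

    verts : ∀ {m} → Block m → List (Fin n)
    verts K = A K ++ (B K ++ (C K ++ C′ K))

    vertsAll : ∀ {m} → List (Block m) → List (Fin n)
    vertsAll []       = []
    vertsAll (K ∷ Ks) = verts K ++ vertsAll Ks

    vertsAll-++ : ∀ {m} (Ks Ls : List (Block m)) v → occ v (vertsAll (Ks ++ Ls)) ≡ occ v (vertsAll Ks) + occ v
        (vertsAll Ls)
    vertsAll-++ []       Ls v = refl
    vertsAll-++ (K ∷ Ks) Ls v rewrite occ-++ v (verts K) (vertsAll (Ks ++ Ls)) | occ-++ v (verts K)
        (vertsAll Ks) | vertsAll-++ Ks Ls v =
      sym (+-assoc (occ v (verts K)) _ _)

    occ-verts : ∀ {m} (K : Block m) v → occ v (verts K) ≡ occ v (A K) +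
        (occ v (B K) + (occ v (C K) + occ v (C′ K)))
    occ-verts K v rewrite occ-++ v (A K) (B K ++ (C K ++ C′ K)) | occ-++ v (B K) (C K ++ C′ K) | occ-++ v (C K)
        (C′ K) = refl

    length-verts : ∀ {m} (K : Block m) → length (verts K) ≡ m * 4
    length-verts {m} K rewrite length-++ (A K) {B K ++ (C K ++ C′ K)} | length-++ (B K) {C K ++ C′ K} |
        length-++ (C K) {C′ K}
      | lenA K | lenB K | lenC K | lenC′ K =
      equate (m ∷ []) λ m → m :+ (m :+ (m :+ m)) :≡ m :* con 4

    length-vertsAll : ∀ {m} (Ks : List (Block m)) → length (vertsAll Ks) ≡ length Ks * (m * 4)
    length-vertsAll []       = refl
    length-vertsAll (K ∷ Ks) = trans (length-++ (verts K)) (cong₂ _+_ (length-verts K) (length-vertsAll Ks))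

    cut : ∀ m k (A B C C′ : List (Fin n)) → k * m ≤ length A → k * m ≤ length B → k * m ≤ length C → k * m ≤
        length C′ →
      (∀ {a b c} → a ∈ A → b ∈ B → c ∈ C ⊎ c ∈ C′ → edge H a b c ≡ true) →
      Σ (List (Block m)) λ Ks → length Ks ≡ k ×
          (∀ v → occ v (vertsAll Ks) ≤ occ v A + (occ v B + (occ v C + occ v C′)))
    cut m zero    A B C C′ _ _ _ _ _ = [] , refl , λ v → z≤n
    cut m (suc k) A B C C′ hA hB hC hC′ com =
      let Ks , len , sub = cut m k (drop m A) (drop m B) (drop m C) (drop m C′) (rest A hA) (rest B hB)
              (rest C hC) (rest C′ hC′)
            (λ a b → λ { (inj₁ c) → com (∈-drop m A a) (∈-drop m B b) (inj₁ (∈-drop m C c))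
                       ; (inj₂ c) → com (∈-drop m A a) (∈-drop m B b) (inj₂ (∈-drop m C′ c)) })
          K = block (take m A) (take m B) (take m C) (take m C′) (first A hA) (first B hB) (first C hC)
              (first C′ hC′)
            (λ a b → λ { (inj₁ c) → com (∈-take m A a) (∈-take m B b) (inj₁ (∈-take m C c))
                       ; (inj₂ c) → com (∈-take m A a) (∈-take m B b) (inj₂ (∈-take m C′ c)) })
      in K ∷ Ks , cong suc len , λ v → begin
        occ v (verts K ++ vertsAll Ks)                    ≡⟨ occ-++ v (verts K) (vertsAll Ks) ⟩
        occ v (verts K) + occ v (vertsAll Ks)             ≤⟨ +-mono-≤ (≤-reflexive (occ-verts K v)) (sub v) ⟩
        occ v (take m A) + (occ v (take m B) + (occ v (take m C) + occ v (take m C′))) +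
          (occ v (drop m A) + (occ v (drop m B) + (occ v (drop m C) + occ v (drop m C′))))
          ≤⟨ certify (occ v (take m A) ∷ occ v (take m B) ∷ occ v (take m C) ∷ occ v (take m C′) ∷
                      occ v (drop m A) ∷ occ v (drop m B) ∷ occ v (drop m C) ∷ occ v (drop m C′) ∷ [])
              (λ a b c d a′ b′ c′ d′ → [] ⊢ a :+ (b :+ (c :+ d)) :+ (a′ :+ (b′ :+ (c′ :+ d′))) :≤ a :+ a′ :+
                  (b :+ b′ :+ (c :+ c′ :+ (d :+ d′)))) ⟩
        occ v (take m A) + occ v (drop m A) +
            (occ v (take m B) + occ v (drop m B) +
            (occ v (take m C) + occ v (drop m C) + (occ v (take m C′) + occ v (drop m C′))))
          ≡⟨ cong₂ _+_ (occ-take-drop m v A)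
              (cong₂ _+_ (occ-take-drop m v B) (cong₂ _+_ (occ-take-drop m v C) (occ-take-drop m v C′))) ⟩
        occ v A + (occ v B + (occ v C + occ v C′)) ∎
      where
      open ≤-Reasoning
      rest : ∀ l → suc k * m ≤ length l → k * m ≤ length (drop m l)
      rest l h = ≤-trans (m+n≤o⇒m≤o∸n (k * m) (≤-trans (≤-reflexive (+-comm (k * m) m)) h))
          (≤-reflexive (sym (length-drop m l)))
      first : ∀ l → suc k * m ≤ length l → length (take m l) ≡ m
      first l h = length-take-exact m l (≤-trans (m≤m+n m (k * m)) h)

    vertsAll-fit : ∀ {m} (F : Fin n → Bool) (Ks : List (Block m)) → (∀ v → occ v (vertsAll Ks) + 𝟙 (F v) ≤ 1) →
        length Ks * (m * 4) ≤ n
    vertsAll-fit {m} F Ks avoid = begin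
      length Ks * (m * 4)                ≡⟨ length-vertsAll Ks ⟨
      length (vertsAll Ks)               ≡⟨ length-occ (vertsAll Ks) ⟨
      ∑ V (λ v → occ v (vertsAll Ks))    ≤⟨ ∑-mono (V {n}) (λ v → ≤-trans (m≤m+n _ (𝟙 (F v))) (avoid v)) ⟩
      ∑ (V {n}) (λ _ → 1)                ≡⟨ ∑-one ⟩
      n ∎
      where open ≤-Reasoning

  -- Sum over the transversals formed by the i-th vertices of the three lists.
  zip-bound : ∀ {n} (Y : Fin n → ℕ) s (A B C : List (Fin n)) → length A ≡ length B → length B ≡ length C →
    (∀ {a b c} → a ∈ A → b ∈ B → c ∈ C → Y a + Y b + 2 * Y c ≤ s) → ∑ A Y + ∑ B Y + 2 * ∑ C Y ≤ length A * s
  zip-bound Y s [] [] [] _ _ _ = z≤n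
  zip-bound Y s (a ∷ A) (b ∷ B) (c ∷ C) e e′ h = certify
      (Y a ∷ Y b ∷ Y c ∷ ∑ A Y ∷ ∑ B Y ∷ ∑ C Y ∷ s ∷ length A * s ∷ [])
    (λ a b c A B C s l → con 1 ⊠ a :+ b :+ con 2 :* c :≤ s ∷ con 1 ⊠ A :+ B :+ con 2 :* C :≤ l ∷ []
      ⊢ a :+ A :+ (b :+ B) :+ con 2 :* (c :+ C) :≤ s :+ l)
    (h (here refl) (here refl) (here refl))
    (zip-bound Y s A B C (suc-injective e) (suc-injective e′) (λ x y z → h (there x) (there y) (there z)))

  module _ {n : ℕ} where

    load : List (Fin n) → List (Fin n) → ℕ
    load X c = ∑ X (λ w → occ w c)

    load-sym : ∀ X c → load X c ≡ ∑ c (λ v → occ v X)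
    load-sym X c = trans (∑-swap X c δ) (∑-cong c (λ v → ∑-cong X (λ w → δ-sym w v)))

    load-++ : ∀ X X′ c → load (X ++ X′) c ≡ load X c + load X′ c
    load-++ X X′ c = ∑-++ X X′ _

  -- Φ is the second moment of the loads and y half its derivative: adding sets that are light for y keeps
  -- almost all classes equally loaded.
  module Potential {n : ℕ} (F : Fin n → Bool) (M : ℕ) (cls : List (List (Fin n)))
    (short : ∀ c → c ∈ cls → length c ≤ M) (uniq : ∀ c → c ∈ cls → Uniq c)
    (partition : ∀ v → occ v (concat cls) + 𝟙 (F v) ≡ 1) where

    y : List (Fin n) → Fin n → ℕ
    y X v = ∑ cls (λ c → occ v c * load X c)

    Φ : List (Fin n) → ℕ
    Φ X = ∑ cls (λ c → load X c * load X c)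

    loads : ∀ X → ∑ cls (load X) ≡ ∑ X (λ w → occ w (concat cls))
    loads X = trans (∑-swap cls X (λ c w → occ w c)) (∑-cong X (λ w → sym (∑-concat cls (δ w))))

    loads≤ : ∀ X → ∑ cls (load X) ≤ length X
    loads≤ X = ≤-trans (≤-reflexive (loads X))
        (≤-trans (∑-length X 1 (λ w → ≤-trans (m≤m+n _ (𝟙 (F w))) (≤-reflexive (partition w))))
        (≤-reflexive (*-identityʳ _)))

    loads≡ : ∀ X → (∀ v → occ v X + 𝟙 (F v) ≤ 1) → ∑ cls (load X) ≡ length X
    loads≡ X h = ≤-antisym (loads≤ X) (≤-trans (≤-reflexive (trans (sym (*-identityʳ _)) (sym (∑-const X 1))))
      (≤-trans (∑-mono∈ X pt) (≤-reflexive (sym (loads X)))))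
      where
      pt : ∀ w → w ∈ X → 1 ≤ occ w (concat cls)
      pt w m = +-cancelʳ-≤ (𝟙 (F w)) 1 _
          (≤-trans (≤-trans (+-monoˡ-≤ (𝟙 (F w)) (occ-∈ m)) (h w)) (≤-reflexive (sym (partition w))))

    y-total : ∀ X → ∑ V (λ v → 𝟙 (not (F v)) * y X v) ≤ M * length X
    y-total X = begin
      ∑ V (λ v → 𝟙 (not (F v)) * y X v)               ≤⟨ ∑-mono V
          (λ v → ≤-trans (*-monoˡ-≤ (y X v) (𝟙≤1 (not (F v)))) (≤-reflexive (+-identityʳ (y X v)))) ⟩
      ∑ V (y X)                                       ≡⟨ ∑-swap (V {n}) cls (λ v c → occ v c * load X c) ⟩
      ∑ cls (λ c → ∑ V (λ v → occ v c * load X c))    ≡⟨ ∑-cong cls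
          (λ c → trans (∑-*ʳ (V {n}) (λ v → occ v c) (load X c)) (cong (_* load X c) (length-occ c))) ⟩
      ∑ cls (λ c → length c * load X c)               ≤⟨ ∑-mono∈ cls (λ c m → *-monoˡ-≤ (load X c) (short c m))
          ⟩
      ∑ cls (λ c → M * load X c)                      ≡⟨ ∑-*ˡ cls M (load X) ⟩
      M * ∑ cls (load X)                              ≤⟨ *-monoʳ-≤ M (loads≤ X) ⟩
      M * length X ∎
      where open ≤-Reasoning

    load≤ : ∀ X c → c ∈ cls → load X c ≤ length X
    load≤ X c m = ≤-trans (∑-length X 1 (λ w → uniq c m w)) (≤-reflexive (*-identityʳ _))

    -- After expansion of the squares the cross terms give 2 ∑ y. The squares of the new loads are
    -- bounded through `load τ c ≤ length τ`, which holds as classes have no repetitions.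
    Φ-++ : ∀ τ X → Φ (τ ++ X) ≤ Φ X + 2 * ∑ τ (y X) + length τ * length τ
    Φ-++ τ X = begin
      Φ (τ ++ X) ≤⟨ ∑-mono∈ cls pt ⟩
      ∑ cls (λ c → load X c * load X c + 2 * (load τ c * load X c) + length τ * load τ c)
        ≡⟨ trans (∑-+ cls (λ c → load X c * load X c + 2 * (load τ c * load X c)) (λ c → length τ * load τ c))
            (cong₂ _+_ (∑-+ cls (λ c → load X c * load X c) (λ c → 2 * (load τ c * load X c)))
            (∑-*ˡ cls (length τ) (load τ))) ⟩
      Φ X + ∑ cls (λ c → 2 * (load τ c * load X c)) + length τ * ∑ cls (load τ)
        ≤⟨ +-mono-≤ (+-monoʳ-≤ (Φ X) (≤-reflexive
            (trans (∑-*ˡ cls 2 (λ c → load τ c * load X c)) (cong (2 *_) cross))))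
            (*-monoʳ-≤ (length τ) (loads≤ τ)) ⟩
      Φ X + 2 * ∑ τ (y X) + length τ * length τ ∎
      where
      open ≤-Reasoning
      cross : ∑ cls (λ c → load τ c * load X c) ≡ ∑ τ (y X)
      cross = trans (∑-cong cls (λ c → sym (∑-*ʳ τ (λ w → occ w c) (load X c))))
          (∑-swap cls τ (λ c w → occ w c * load X c))
      pt : ∀ c → c ∈ cls → load (τ ++ X) c * load (τ ++ X) c ≤ load X c * load X c + 2 * (load τ c * load X c) +
          length τ * load τ c
      pt c m rewrite load-++ τ X c = certify (load τ c ∷ load X c ∷ length τ ∷ []) (λ t x l → t ⊠ t :≤ l ∷ []
        ⊢ (t :+ x) :* (t :+ x) :≤ x :* x :+ con 2 :* (t :* x) :+ l :* t) (load≤ τ c m)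

    dev : ℕ → List (Fin n) → List (Fin n) → ℕ
    dev Q X c = ∣ load X c - Q ∣

    variance : ∀ Q X → ∑ cls (λ c → dev Q X c * dev Q X c) + 2 * Q * ∑ cls (load X) ≡ Φ X + length cls * (Q * Q)
    variance Q X = begin
      ∑ cls (λ c → dev Q X c * dev Q X c) + 2 * Q * ∑ cls (load X)
        ≡⟨ cong (∑ cls (λ c → dev Q X c * dev Q X c) +_) (∑-*ˡ cls (2 * Q) (load X)) ⟨
      ∑ cls (λ c → dev Q X c * dev Q X c) + ∑ cls (λ c → 2 * Q * load X c)
        ≡⟨ ∑-+ cls (λ c → dev Q X c * dev Q X c) (λ c → 2 * Q * load X c) ⟨
      ∑ cls (λ c → dev Q X c * dev Q X c + 2 * Q * load X c)
        ≡⟨ ∑-cong cls (λ c → square (load X c) Q) ⟩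
      ∑ cls (λ c → load X c * load X c + Q * Q)
        ≡⟨ trans (∑-+ cls (λ c → load X c * load X c) (λ _ → Q * Q)) (cong (Φ X +_) (∑-const cls (Q * Q))) ⟩
      Φ X + length cls * (Q * Q) ∎
      where
      open ≡-Reasoning
      square : ∀ a b → ∣ a - b ∣ * ∣ a - b ∣ + 2 * b * a ≡ a * a + b * b
      square a b with ≤-total a b
      ... | inj₁ le with m≤n⇒∃[o]m+o≡n le
      ...   | t , refl rewrite ∣m-m+n∣≡n a t = equate (a ∷ t ∷ []) λ a t → t :* t :+ con 2 :* (a :+ t) :* a :≡ a
          :* a :+ (a :+ t) :* (a :+ t)
      square a b | inj₂ le with m≤n⇒∃[o]m+o≡n le
      ...   | t , refl rewrite ∣-∣-comm (b + t) b | ∣m-m+n∣≡n b t = equate (b ∷ t ∷ []) λ a t → t :* t :+ con 2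
          :* a :* (a :+ t) :≡ (a :+ t) :* (a :+ t) :+ a :* a

    -- From (v·dev - Q)² ≥ 0. It passes from the variance to the total deviation as the
    -- Cauchy-Schwarz inequality would, but without a square root; `v` is free.
    amgm : ∀ v Q X → 2 * Q * v * ∑ cls (dev Q X) ≤ v * v * ∑ cls (λ c → dev Q X c * dev Q X c) + length cls *
        (Q * Q)
    amgm v Q X = begin
      2 * Q * v * ∑ cls (dev Q X)           ≡⟨ ∑-*ˡ cls (2 * Q * v) (dev Q X) ⟨
      ∑ cls (λ c → 2 * Q * v * dev Q X c)   ≤⟨ ∑-mono cls (λ c → pt (dev Q X c)) ⟩
      ∑ cls (λ c → v * v * (dev Q X c * dev Q X c) + Q * Q)
        ≡⟨ trans (∑-+ cls (λ c → v * v * (dev Q X c * dev Q X c)) (λ _ → Q * Q))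
            (cong₂ _+_ (∑-*ˡ cls (v * v) (λ c → dev Q X c * dev Q X c)) (∑-const cls (Q * Q))) ⟩
      v * v * ∑ cls (λ c → dev Q X c * dev Q X c) + length cls * (Q * Q) ∎
      where
      open ≤-Reasoning
      pt : ∀ t → 2 * Q * v * t ≤ v * v * (t * t) + Q * Q
      pt t with ≤-total Q (v * t)
      ... | inj₁ le with m≤n⇒∃[o]m+o≡n le
      ...   | o , eq = subst (λ z → 2 * Q * z ≤ z * z + Q * Q) eq
          (certify (Q ∷ o ∷ []) λ Q o → [] ⊢ con 2 :* Q :* (Q :+ o) :≤ (Q :+ o) :* (Q :+ o) :+ Q :* Q)
                |> λ h → ≤-trans (≤-reflexive (*-assoc (2 * Q) v t))
                    (≤-trans h (+-monoˡ-≤ (Q * Q) (≤-reflexive ([m*n]*[o*p]≡[m*o]*[n*p] v t v t))))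
        where open import Function using (_|>_)
      pt t | inj₂ le with m≤n⇒∃[o]m+o≡n le
      ...   | o , refl = certify (v ∷ t ∷ o ∷ []) λ v t o → [] ⊢ con 2 :* (v :* t :+ o) :* v :* t :≤ v :* v :*
          (t :* t) :+ (v :* t :+ o) :* (v :* t :+ o)

-- One round: light new blocks and recutting of the old ones

module TilingRound where
  open Prelude
  open Certificates
  open Sums
  open Multiplicities
  open BlowUp
  open FractionalCover
  open Duality
  open Blocks
  open Block
  open import Data.List.Membership.Propositional.Properties using (∈-++⁻)

  ∈∈₃ : ∀ {n} {a b c : Fin n} {A B C} → a ∈ A → b ∈ B → c ∈ C → (a ∷ b ∷ c ∷ []) ∈∈ (A ∷ B ∷ C ∷ [])
  ∈∈₃ x y z = x ∷ y ∷ z ∷ []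

  ∑-allVec₃ : ∀ {n} (f : Vec (Fin n) 3 → ℕ) → ∑ (allVec 3) f ≡ ∑³ (λ a b c → f (a ∷ b ∷ c ∷ []))
  ∑-allVec₃ {n} f = trans (∑-allVec {n} 2 f) (∑-cong (V {n}) (λ a → trans (∑-allVec {n} 1 (λ v → f (a ∷ v)))
    (∑-cong (V {n}) (λ b → trans (∑-allVec {n} 0 (λ v → f (a ∷ b ∷ v)))
        (∑-cong (V {n}) (λ c → +-identityʳ (f (a ∷ b ∷ c ∷ []))))))))

  -- The main term grows by 2t ≤ (t + 1)² - t². The rest is 24 = 8 + 16: the additive error in the
  -- weight of the new block, and the square of its 4m vertices.
  potential-step : ∀ d n′ m M t φ φ′ s → 1 ≤ m * d → d * n′ * φ ≤ m * m * 16 * (suc d * M) * (t * t) + t *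
      (m * m * 24 * (d * n′)) →
        d * n′ * s ≤ m * 4 * (suc d * (M * (t * (m * 4)))) + m * 4 * n′ → φ′ ≤ φ + 2 * s + m * 4 * (m * 4) →
        d * n′ * φ′ ≤ m * m * 16 * (suc d * M) * (suc t * suc t) + suc t * (m * m * 24 * (d * n′))
  potential-step d n′ m M t φ φ′ s h₀ h₁ h₂ h₃ = certify (d ∷ n′ ∷ φ ∷ φ′ ∷ s ∷ m ∷ M ∷ t ∷ [])
      (λ d n φ φ′ s m M t →
        con 1 ⊠ d :* n :* φ :≤ m :* m :* con 16 :* ((con 1 :+ d) :* M) :* (t :* t) :+ t :*
            (m :* m :* con 24 :* (d :* n)) ∷
        con 2 ⊠ d :* n :* s :≤ m :* con 4 :* ((con 1 :+ d) :* (M :* (t :* (m :* con 4)))) :+ m :* con 4 :* n ∷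
        d :* n ⊠ φ′ :≤ φ :+ con 2 :* s :+ m :* con 4 :* (m :* con 4) ∷
        con 8 :* m :* n ⊠ con 1 :≤ m :* d ∷ []
        ⊢ d :* n :* φ′ :≤ m :* m :* con 16 :* ((con 1 :+ d) :* M) :* ((con 1 :+ t) :* (con 1 :+ t)) :+
            (con 1 :+ t) :* (m :* m :* con 24 :* (d :* n)))
        h₁ h₂ h₃ h₀

  module NewBlock {n : ℕ} (H : Hypergraph3 n) (F : Fin n → Bool) (M : ℕ) (cls : List (List (Fin n)))
    (short : ∀ c → c ∈ cls → length c ≤ M) (uniq : ∀ c → c ∈ cls → Uniq c)
    (partition : ∀ v → occ v (concat cls) + 𝟙 (F v) ≡ 1)
    (k d K : ℕ) (big : 302 ≤ K) (big′ : k * 252 ≤ K) (n>0 : 0 < n)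
    (few : K * count F ≤ n) (deg : MinDegree H K) (nonext : NonExtremal H k)
    (m : ℕ) (m>0 : 0 < m) where

    open Potential F M cls short uniq partition

    n′ C₀ : ℕ
    n′ = count (λ v → not (F v))
    C₀ = K * suc d * (K * suc d)

    module _ (X : List (Fin n)) (room : length X * (C₀ * 6) ≤ n) (avoid : ∀ v → occ v X + 𝟙 (F v) ≤ 1)
      (large : (3 * (m + m)) * blowSize (m + m) 3 (C₀ * 2) ≤ n) (n′>0 : 0 < n′) where

      private
        -- Scaled so that the average of `Y` is at most σ·d/(d + 1). The `+ 1` in `Y` and the `n′`
        -- in `σ` keep σ positive while `X` is still empty.
        σ : ℕ
        σ = suc d * (M * length X + n′)

        Y : Fin n → ℕ
        Y v = d * n′ * (y X v + 1)

        lowB : Fin n → Fin n → Fin n → Bool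
        lowB = low H F Y σ

        light : suc d * ∑ V (λ v → 𝟙 (not (F v)) * Y v) ≤ d * (n′ * σ)
        light = begin
          suc d * ∑ V (λ v → 𝟙 (not (F v)) * Y v)
            ≡⟨ cong (suc d *_) (trans (∑-cong (V {n}) (λ v → *-swap (𝟙 (not (F v))) (d * n′) (y X v + 1)))
                (∑-*ˡ (V {n}) (d * n′) (λ v → 𝟙 (not (F v)) * (y X v + 1)))) ⟩
          suc d * (d * n′ * ∑ V (λ v → 𝟙 (not (F v)) * (y X v + 1)))
            ≡⟨ cong (λ t → suc d * (d * n′ * t))
                (trans (∑-cong (V {n}) (λ v → trans (*-distribˡ-+ (𝟙 (not (F v))) (y X v) 1)
                (cong (𝟙 (not (F v)) * y X v +_) (*-identityʳ _))))
                (∑-+ (V {n}) (λ v → 𝟙 (not (F v)) * y X v) (λ v → 𝟙 (not (F v))))) ⟩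
          suc d * (d * n′ * (∑ V (λ v → 𝟙 (not (F v)) * y X v) + n′))
            ≤⟨ certify (d ∷ n′ ∷ ∑ V (λ v → 𝟙 (not (F v)) * y X v) ∷ M ∷ length X ∷ [])
                (λ d n s M x → (con 1 :+ d) :* d :* n ⊠ s :≤ M :* x ∷ []
                 ⊢ (con 1 :+ d) :* (d :* n :* (s :+ n)) :≤ d :* (n :* ((con 1 :+ d) :* (M :* x :+ n))))
                     (y-total X) ⟩
          d * (n′ * σ) ∎
          where
          open ≤-Reasoning

        lows : n * n * n ≤ C₀ * ∑³ (λ a b c → 𝟙 (lowB a b c))
        lows = dual H F Y σ k d K big big′ n>0
            (≤-trans n′>0 (≤-trans (m≤n+m n′ (M * length X)) (m≤m+n _ (d * (M * length X + n′))))) few light deg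
            nonext

        free : Fin n → Bool
        free v = does (occ v X ≟ℕ 0)

        ρ : ⊤ → Vec (Fin n) 3 → Bool
        ρ _ (a ∷ b ∷ c ∷ []) = lowB a b c ∧ (free a ∧ (free b ∧ free c))

        #ρ : ℕ
        #ρ = ∑³ (λ a b c → 𝟙 (ρ tt (a ∷ b ∷ c ∷ [])))

        triples : ∑ (allVec 3) (λ v → 𝟙 (ρ tt v)) ≡ #ρ
        triples = ∑-allVec₃ (λ v → 𝟙 (ρ tt v))

        discard : ∑³ (λ a b c → 𝟙 (lowB a b c)) ≤ #ρ +
            (n * (n * length X) + (n * (n * length X) + n * (n * length X)))
        discard = ≤-trans (∑³-mono (λ a b c → bool (lowB a b c) (occ a X) (occ b X) (occ c X)))
          (≤-reflexive (trans (∑³-+ (λ a b c → 𝟙 (ρ tt (a ∷ b ∷ c ∷ [])))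
              (λ a b c → occ a X + (occ b X + occ c X))) (cong (#ρ +_)
            (trans (∑³-+ (λ a b c → occ a X) (λ a b c → occ b X + occ c X)) (cong₂ _+_
              (trans (∑-cong (V {n}) (λ a → trans (∑²-fst {n} (λ _ → occ a X))
                  (cong (n *_) (∑-Fin-const n (occ a X)))))
                (trans (∑-*ˡ (V {n}) n (λ a → n * occ a X))
                    (cong (n *_) (trans (∑-*ˡ (V {n}) n (λ a → occ a X)) (cong (n *_) (length-occ X))))))
              (trans (∑³-+ (λ a b c → occ b X) (λ a b c → occ c X)) (cong₂ _+_
                (trans (∑-Fin-const n _) (cong (n *_)
                    (trans (∑²-fst (λ b → occ b X)) (cong (n *_) (length-occ X)))))
                (trans (∑-Fin-const n _) (cong (n *_)
                    (trans (∑²-snd (λ b → occ b X)) (cong (n *_) (length-occ X)))))))))))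
          )
          where
          bool : ∀ l x y z → 𝟙 l ≤ 𝟙 (l ∧ (does (x ≟ℕ 0) ∧ (does (y ≟ℕ 0) ∧ does (z ≟ℕ 0)))) + (x + (y + z))
          bool false x y z = z≤n
          bool true (suc x) y z = s≤s z≤n
          bool true zero (suc y) z = s≤s z≤n
          bool true zero zero (suc z) = s≤s z≤n
          bool true zero zero zero = s≤s z≤n

        dense : n ^ 3 * ∑ (tt ∷ []) (λ _ → 1) ≤ C₀ * 2 * ∑ (tt ∷ []) (λ i → 1 * ∑ (allVec 3) (λ v → 𝟙 (ρ i v)))
        dense = subst (λ t → n ^ 3 * 1 ≤ C₀ * 2 * (1 * t + 0)) (sym triples)
            (certify (n ∷ C₀ ∷ #ρ ∷ ∑³ (λ a b c → 𝟙 (lowB a b c)) ∷ length X ∷ []) (λ n C r l x →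
          con 2 ⊠ n :* n :* n :≤ C :* l ∷ C :* con 2 ⊠ l :≤ r :+
              (n :* (n :* x) :+ (n :* (n :* x) :+ n :* (n :* x))) ∷ n :* n ⊠ x :* (C :* con 6) :≤ n ∷ []
          ⊢ n :* (n :* (n :* con 1)) :* con 1 :≤ C :* con 2 :* (con 1 :* r :+ con 0)) lows discard room)

      abstract
        newBlock : Σ (Block H m) λ τ → (∀ v → occ v (verts H τ) + occ v X + 𝟙 (F v) ≤ 1) ×
          d * n′ * ∑ (verts H τ) (y X) ≤ m * 4 * (suc d * (M * length X)) + m * 4 * n′
        newBlock = finish (blow 3 (m + m) (C₀ * 2) (tt ∷ []) (λ _ → 1) ρ [] n>0 (λ v → z≤n) large (s≤s z≤n)
            dense)
          where
          finish : (Σ (Vec (List (Fin n)) 3) λ L → AllV (λ l → length l ≡ m + m) L ×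
              (∀ v → occ v (flat L) + 0 ≤ 1) ×
            1 ≤ blowDensity (m + m) 3 (C₀ * 2) * ∑ (tt ∷ []) (λ i → 1 * 𝟙 (good 3 (ρ i) L))) →
            Σ (Block H m) λ τ → (∀ v → occ v (verts H τ) + occ v X + 𝟙 (F v) ≤ 1) ×
              d * n′ * ∑ (verts H τ) (y X) ≤ m * 4 * (suc d * (M * length X)) + m * 4 * n′
          finish ((l₁ ∷ l₂ ∷ l₃ ∷ []) , (len₁ ∷ len₂ ∷ len₃ ∷ []) , un , hit) = τ , avoid′ , weight
            where
            isGood : good 3 (ρ tt) (l₁ ∷ l₂ ∷ l₃ ∷ []) ≡ true
            isGood = 𝟙-true (≤-trans (*-positiveʳ (blowDensity (m + m) 3 (C₀ * 2)) hit)
                (≤-reflexive (trans (+-identityʳ _) (+-identityʳ _))))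
            rel : ∀ {a b c} → a ∈ l₁ → b ∈ l₂ → c ∈ l₃ → lowB a b c ≡ true × free a ≡ true × free b ≡ true ×
                free c ≡ true
            rel {a} {b} {c} x y z = let h = good-∈ 3 (ρ tt) isGood (∈∈₃ x y z)
                                        l , r = ∧-true {lowB a b c} h
                                        fa , r′ = ∧-true {free a} r
                                        fb , fc = ∧-true {free b} r′
                                    in l , fa , fb , fc
            τ : Block H m
            -- The blow-up has three rows of length 2m. Half of the first two is dropped and the
            -- third is split, which produces the ratio 1 : 1 : 2.
            τ = block (take m l₁) (take m l₂) (take m l₃) (drop m l₃)
                  (length-take-exact m l₁ (≤-trans (m≤m+n m m) (≤-reflexive (sym len₁))))
                  (length-take-exact m l₂ (≤-trans (m≤m+n m m) (≤-reflexive (sym len₂))))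
                  (length-take-exact m l₃ (≤-trans (m≤m+n m m) (≤-reflexive (sym len₃))))
                  (trans (length-drop m l₃) (trans (cong (_∸ m) len₃) (m+n∸m≡n m m)))
                  (λ {a} {b} {c} x y z → proj₁ (low-elim H F Y σ a b c
                      (proj₁ (rel (∈-take m l₁ x) (∈-take m l₂ y) (third z)))))
              where
              open import Data.List.Properties using (length-drop)
              third : ∀ {c} → c ∈ take m l₃ ⊎ c ∈ drop m l₃ → c ∈ l₃
              third (inj₁ h) = ∈-take m l₃ h
              third (inj₂ h) = ∈-drop m l₃ h
            -- Applied to both halves of the third row and added, this counts every vertex of the
            -- block exactly twice.
            cost : ∀ C″ → (∀ {c} → c ∈ C″ → c ∈ l₃) → length C″ ≡ m → ∑ (A τ) Y + ∑ (B τ) Y + 2 * ∑ C″ Y ≤ m *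
                (σ * 4)
            cost C″ sub len = subst (λ t → ∑ (A τ) Y + ∑ (B τ) Y + 2 * ∑ C″ Y ≤ t * (σ * 4)) (lenA τ)
              (zip-bound Y (σ * 4) (A τ) (B τ) C″ (trans (lenA τ) (sym (lenB τ))) (trans (lenB τ) (sym len))
                (λ {a} {b} {c} x y z → proj₂ (proj₂
                    (proj₂ (proj₂ (low-elim H F Y σ a b c
                    (proj₁ (rel (∈-take m l₁ x) (∈-take m l₂ y) (sub z)))))))))
            total : ∑ (verts H τ) Y ≡ ∑ (A τ) Y + (∑ (B τ) Y + (∑ (C τ) Y + ∑ (C′ τ) Y))
            total = trans (∑-++ (A τ) (B τ ++ (C τ ++ C′ τ)) Y)
                (cong (∑ (A τ) Y +_) (trans (∑-++ (B τ) (C τ ++ C′ τ) Y)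
                (cong (∑ (B τ) Y +_) (∑-++ (C τ) (C′ τ) Y))))
            expand : ∑ (verts H τ) Y ≡ d * n′ * (∑ (verts H τ) (y X) + m * 4)
            expand = trans (∑-*ˡ (verts H τ) (d * n′) (λ v → y X v + 1))
                (cong (d * n′ *_) (trans (∑-+ (verts H τ) (y X) (λ _ → 1))
              (cong (∑ (verts H τ) (y X) +_) (trans (∑-const (verts H τ) 1)
                  (trans (*-identityʳ _) (length-verts H τ))))))
            weight : d * n′ * ∑ (verts H τ) (y X) ≤ m * 4 * (suc d * (M * length X)) + m * 4 * n′
            weight = *-cancelˡ-≤ 2 (certify
                (∑ (A τ) Y ∷ ∑ (B τ) Y ∷ ∑ (C τ) Y ∷ ∑ (C′ τ) Y ∷ d ∷ n′ ∷ m ∷ M * length X ∷ ∑ (verts H τ)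
                (y X) ∷ []) (λ a b c c′ d n m x s →
                let σ = (con 1 :+ d) :* (x :+ n) in
                con 2 ⊠ d :* n :* (s :+ m :* con 4) :≤ a :+ (b :+ (c :+ c′)) ∷ con 1 ⊠ a :+ b :+ con 2 :* c :≤ m
                    :* (σ :* con 4) ∷ con 1 ⊠ a :+ b :+ con 2 :* c′ :≤ m :* (σ :* con 4) ∷ []
                ⊢ con 2 :* (d :* n :* s) :≤ con 2 :* (m :* con 4 :* ((con 1 :+ d) :* x) :+ m :* con 4 :* n))
                    (≤-reflexive (trans (sym expand) total)) (cost (C τ) (∈-take m l₃) (lenC τ))
                    (cost (C′ τ) (∈-drop m l₃) (lenC′ τ)))
            avoid′ : ∀ v → occ v (verts H τ) + occ v X + 𝟙 (F v) ≤ 1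
            avoid′ v = go (occ v (verts H τ)) refl
              where
              fits : occ v (verts H τ) ≤ 1
              fits = ≤-trans (≤-reflexive (occ-verts H τ v))
                  (≤-trans (+-mono-≤ (occ-take m v l₁)
                  (+-mono-≤ (occ-take m v l₂) (≤-reflexive (occ-take-drop m v l₃))))
                (≤-trans (≤-reflexive (sym (trans (+-identityʳ _)
                    (trans (occ-++ v l₁ (l₂ ++ (l₃ ++ [])))
                    (cong (occ v l₁ +_) (trans (occ-++ v l₂ (l₃ ++ []))
                    (cong (occ v l₂ +_) (trans (occ-++ v l₃ []) (+-identityʳ _))))))))) (un v)))
              some : ∀ l → length l ≡ m + m → Σ (Fin n) (_∈ l)
              some []      e = ⊥-elim (<⇒≱ m>0 (≤-trans (m≤m+n m m) (≤-reflexive (sym e))))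
              some (x ∷ l) e = x , here refl
              member : v ∈ verts H τ → v ∈ l₁ ⊎ v ∈ l₂ ⊎ v ∈ l₃
              member p with ∈-++⁻ (A τ) p
              ... | inj₁ q = inj₁ (∈-take m l₁ q)
              ... | inj₂ q with ∈-++⁻ (B τ) q
              ...   | inj₁ r = inj₂ (inj₁ (∈-take m l₂ r))
              ...   | inj₂ r with ∈-++⁻ (C τ) r
              ...     | inj₁ t = inj₂ (inj₂ (∈-take m l₃ t))
              ...     | inj₂ t = inj₂ (inj₂ (∈-drop m l₃ t))
              used : v ∈ verts H τ → free v ≡ true × F v ≡ false
              used p = cases (member p)
                where
                x₁ : Σ (Fin n) (_∈ l₁)
                x₁ = some l₁ len₁
                x₂ : Σ (Fin n) (_∈ l₂)
                x₂ = some l₂ len₂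
                x₃ : Σ (Fin n) (_∈ l₃)
                x₃ = some l₃ len₃
                cases : v ∈ l₁ ⊎ v ∈ l₂ ⊎ v ∈ l₃ → free v ≡ true × F v ≡ false
                cases (inj₁ q) = let l , f , _ = rel q (proj₂ x₂) (proj₂ x₃)
                                     _ , nf , _ = low-elim H F Y σ v (proj₁ x₂) (proj₁ x₃) l in f , nf
                cases (inj₂ (inj₁ q)) = let l , _ , f , _ = rel (proj₂ x₁) q (proj₂ x₃)
                                            _ , _ , nf , _ = low-elim H F Y σ (proj₁ x₁) v (proj₁ x₃) l in f ,
                                                nf
                cases (inj₂ (inj₂ q)) = let l , _ , _ , f = rel (proj₂ x₁) (proj₂ x₂) q
                                            _ , _ , _ , nf , _ = low-elim H F Y σ (proj₁ x₁) (proj₁ x₂) v l in f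
                                                , nf
              go : ∀ o → occ v (verts H τ) ≡ o → occ v (verts H τ) + occ v X + 𝟙 (F v) ≤ 1
              go zero e rewrite e = avoid v
              go (suc o) e = let fr , fF = used (∈-occ (verts H τ) (subst (0 <_) (sym e) (s≤s z≤n))) in
                subst₂ (λ s t → occ v (verts H τ) + s + 𝟙 t ≤ 1) (sym (does-true (occ v X ≟ℕ 0) fr)) (sym fF)
                  (≤-trans (≤-reflexive (trans (+-identityʳ _) (+-identityʳ _))) fits)

    -- A load of 4mt spread evenly over n′/M classes has second moment (4mt)²M/n′. The bound exceeds
    -- this ideal by a factor (d + 1)/d and a term linear in t.
    chain-blocks : 0 < d → (3 * (m + m)) * blowSize (m + m) 3 (C₀ * 2) ≤ n → 0 < n′ → ∀ t → t * (m * 4) *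
        (C₀ * 6) ≤ n →
      Σ (List (Block H m)) λ ts → length ts ≡ t × (∀ v → occ v (vertsAll H ts) + 𝟙 (F v) ≤ 1) ×
        d * n′ * Φ (vertsAll H ts) ≤ m * m * 16 * (suc d * M) * (t * t) + t * (m * m * 24 * (d * n′))
    chain-blocks d>0 large n′>0 zero room = [] , refl , (λ v → 𝟙≤1 (F v)) ,
      ≤-trans (≤-reflexive (trans (cong (d * n′ *_) (∑-zero cls)) (*-zeroʳ (d * n′)))) z≤n
    chain-blocks d>0 large n′>0 (suc t) room =
      let ts , len , avoid , pot = chain-blocks d>0 large n′>0 t
              (≤-trans (*-monoˡ-≤ (C₀ * 6) (*-monoˡ-≤ (m * 4) (n≤1+n t))) room)
          X = vertsAll H ts
          lenX : length X ≡ t * (m * 4)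
          lenX = trans (length-vertsAll H ts) (cong (_* (m * 4)) len)
          room′ : length X * (C₀ * 6) ≤ n
          room′ = ≤-trans (≤-reflexive (cong (_* (C₀ * 6)) lenX))
              (≤-trans (*-monoˡ-≤ (C₀ * 6) (*-monoˡ-≤ (m * 4) (n≤1+n t))) room)
          τ , avoid′ , weight = newBlock X room′ avoid large n′>0
      in τ ∷ ts , cong suc len
       , (λ v → ≤-trans (≤-reflexive (cong (_+ 𝟙 (F v)) (occ-++ v (verts H τ) X))) (avoid′ v))
       , potential-step d n′ m M t (Φ X) (Φ (verts H τ ++ X)) (∑ (verts H τ) (y X)) (*-mono-≤ m>0 d>0) pot
           (subst (λ z → d * n′ * ∑ (verts H τ) (y X) ≤ m * 4 * (suc d * (M * z)) + m * 4 * n′) lenX weight)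
           (subst (λ z → Φ (verts H τ ++ X) ≤ Φ X + 2 * ∑ (verts H τ) (y X) + z * z) (length-verts H τ)
               (Φ-++ (verts H τ) X))

  module Recut {n : ℕ} (H : Hypergraph3 n) (X : List (Fin n)) (M m Q : ℕ) (m>0 : 0 < m) where

    free : Fin n → Bool
    free v = does (occ v X ≟ℕ 0)

    kept : ∀ l → length l ≡ M → M ∸ load X l ≤ length (keep free l)
    kept l refl = m≤n+o⇒m∸n≤o (length l) (load X l) (begin
      length l                                             ≡⟨ keep-length free l ⟨
      length (keep free l) + ∑ l (λ v → 𝟙 (not (free v)))  ≤⟨ +-monoʳ-≤ (length (keep free l))
          (∑-mono l (λ v → bool (occ v X))) ⟩
      length (keep free l) + ∑ l (λ v → occ v X)           ≡⟨ cong (length (keep free l) +_) (load-sym X l) ⟨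
      length (keep free l) + load X l                      ≡⟨ +-comm _ (load X l) ⟩
      load X l + length (keep free l) ∎)
      where
      open ≤-Reasoning
      bool : ∀ k → 𝟙 (not (does (k ≟ℕ 0))) ≤ k
      bool zero    = z≤n
      bool (suc k) = s≤s z≤n

    deviation : Block H M → ℕ
    deviation K = ∣ load X (A K) - Q ∣ + (∣ load X (B K) - Q ∣ + (∣ load X (C K) - Q ∣ + ∣ load X (C′ K) - Q ∣))

    -- Each of the four lists keeps at least M - Q - `deviation K` vertices outside `X`. This common
    -- length is cut into pieces of length m, and rounding loses less than m.
    recut : (K : Block H M) → Σ (List (Block H m)) λ Ls →
      (∀ v → occ v (vertsAll H Ls) ≤ 𝟙 (free v) * occ v (verts H K)) × M ≤ length Ls * m + m + Q + deviation K
    recut K =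
      let Ls , len , sub = cut H m k (keep free (A K)) (keep free (B K)) (keep free (C K)) (keep free (C′ K))
            (enough (A K) (lenA K) (m≤m+n (da) _))
            (enough (B K) (lenB K) (≤-trans (m≤m+n db _) (m≤n+m _ da)))
            (enough (C K) (lenC K) (≤-trans (m≤m+n dc _) (≤-trans (m≤n+m _ db) (m≤n+m _ da))))
            (enough (C′ K) (lenC′ K) (≤-trans (m≤n+m dc′ dc) (≤-trans (m≤n+m _ db) (m≤n+m _ da))))
            (λ a b → λ { (inj₁ c) → complete K (proj₁ (∈-keep free (A K) a)) (proj₁ (∈-keep free (B K) b))
                (inj₁ (proj₁ (∈-keep free (C K) c)))
                       ; (inj₂ c) → complete K (proj₁ (∈-keep free (A K) a)) (proj₁ (∈-keep free (B K) b))
                           (inj₂ (proj₁ (∈-keep free (C′ K) c))) })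
      in Ls
       , (λ v → ≤-trans (sub v) (≤-reflexive (factor v)))
       , subst (λ t → M ≤ t * m + m + Q + deviation K) (sym len) size
      where
      instance _ = >-nonZero m>0
      da = ∣ load X (A K) - Q ∣
      db = ∣ load X (B K) - Q ∣
      dc = ∣ load X (C K) - Q ∣
      dc′ = ∣ load X (C′ K) - Q ∣
      R = M ∸ (Q + deviation K)
      k = R / m
      enough : ∀ l → length l ≡ M → ∣ load X l - Q ∣ ≤ deviation K → k * m ≤ length (keep free l)
      enough l len le = ≤-trans (m/n*n≤m R m)
          (≤-trans (∸-monoʳ-≤ M (≤-trans (m≤n+∣m-n∣ (load X l) Q) (+-monoʳ-≤ Q le))) (kept l len))
      factor : ∀ v → occ v (keep free (A K)) +
          (occ v (keep free (B K)) + (occ v (keep free (C K)) + occ v (keep free (C′ K)))) ≡ 𝟙 (free v) * occ v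
          (verts H K)
      factor v rewrite occ-keep free v (A K) | occ-keep free v (B K) | occ-keep free v (C K) | occ-keep free v
          (C′ K) | occ-verts H K v
        | *-distribˡ-+ (𝟙 (free v)) (occ v (A K)) (occ v (B K) + (occ v (C K) + occ v (C′ K)))
        | *-distribˡ-+ (𝟙 (free v)) (occ v (B K)) (occ v (C K) + occ v (C′ K))
        | *-distribˡ-+ (𝟙 (free v)) (occ v (C K)) (occ v (C′ K)) = refl
      size : M ≤ k * m + m + Q + deviation K
      size = begin
        M                                     ≤⟨ m≤n+m∸n M (Q + deviation K) ⟩
        Q + deviation K + R                   ≡⟨ cong (Q + deviation K +_) (m≡m%n+[m/n]*n R m) ⟩
        Q + deviation K + (R % m + k * m)     ≤⟨ certify (Q ∷ deviation K ∷ R % m ∷ k * m ∷ m ∷ [])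
            (λ Q d r k m → con 1 ⊠ r :≤ m ∷ [] ⊢ Q :+ d :+ (r :+ k) :≤ k :+ m :+ Q :+ d) (<⇒≤ (m%n<n R m)) ⟩
        k * m + m + Q + deviation K ∎
        where open ≤-Reasoning

    recutAll : (Ks : List (Block H M)) → Σ (List (Block H m)) λ Ls →
      (∀ v → occ v (vertsAll H Ls) ≤ 𝟙 (free v) * occ v (vertsAll H Ks)) ×
      length Ks * (M * 4) ≤ length Ls * (m * 4) + length Ks * (m * 4 + Q * 4) + 4 * ∑ Ks deviation
    recutAll [] = [] , (λ v → z≤n) , z≤n
    recutAll (K ∷ Ks) =
      let Ls , sub , size = recut K
          Ls′ , sub′ , size′ = recutAll Ks
      in Ls ++ Ls′
       , (λ v → begin
           occ v (vertsAll H (Ls ++ Ls′))                            ≡⟨ vertsAll-++ H Ls Ls′ v ⟩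
           occ v (vertsAll H Ls) + occ v (vertsAll H Ls′)            ≤⟨ +-mono-≤ (sub v) (sub′ v) ⟩
           𝟙 (free v) * occ v (verts H K) + 𝟙 (free v) * occ v (vertsAll H Ks)  ≡⟨ *-distribˡ-+ (𝟙 (free v)) _ _
               ⟨
           𝟙 (free v) * (occ v (verts H K) + occ v (vertsAll H Ks))  ≡⟨ cong (𝟙 (free v) *_)
               (occ-++ v (verts H K) (vertsAll H Ks)) ⟨
           𝟙 (free v) * occ v (vertsAll H (K ∷ Ks)) ∎)
       , subst (λ z → suc (length Ks) * (M * 4) ≤ z * (m * 4) + suc (length Ks) * (m * 4 + Q * 4) + 4 *
           (deviation K + ∑ Ks deviation)) (sym (length-++ Ls))
           (certify (M ∷ m ∷ Q ∷ length Ks ∷ length Ls ∷ length Ls′ ∷ deviation K ∷ ∑ Ks deviation ∷ [])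
               (λ M m Q b l l′ d s →
             con 4 ⊠ M :≤ l :* m :+ m :+ Q :+ d ∷ con 1 ⊠ b :* (M :* con 4) :≤ l′ :* (m :* con 4) :+ b :*
                 (m :* con 4 :+ Q :* con 4) :+ con 4 :* s ∷ []
             ⊢ (con 1 :+ b) :* (M :* con 4) :≤ (l :+ l′) :* (m :* con 4) :+ (con 1 :+ b) :*
                 (m :* con 4 :+ Q :* con 4) :+ con 4 :* (d :+ s)) size size′)
      where open ≤-Reasoning

  -- Once a tiling is good enough it is carried to the final block size by cutting without loss.
  refine : ∀ {n} (H : Hypergraph3 n) m k (Ks : List (Block H (k * m))) → Σ (List (Block H m)) λ Ls →
    (∀ v → occ v (vertsAll H Ls) ≤ occ v (vertsAll H Ks)) × length Ls ≡ length Ks * k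
  refine H m k [] = [] , (λ v → z≤n) , refl
  refine H m k (K ∷ Ks) =
    let Ls , len , sub = cut H m k (A K) (B K) (C K) (C′ K) (≤-reflexive (sym (lenA K)))
            (≤-reflexive (sym (lenB K)))
                           (≤-reflexive (sym (lenC K))) (≤-reflexive (sym (lenC′ K))) (complete K)
        Ls′ , sub′ , len′ = refine H m k Ks
    in Ls ++ Ls′
     , (λ v → ≤-trans (≤-reflexive (vertsAll-++ H Ls Ls′ v))
         (≤-trans (+-mono-≤ (≤-trans (sub v) (≤-reflexive (sym (occ-verts H K v)))) (sub′ v))
         (≤-reflexive (sym (occ-++ v (verts H K) (vertsAll H Ks))))))
     , trans (length-++ Ls) (cong₂ _+_ len len′)

  module _ {n : ℕ} (H : Hypergraph3 n) (F : Fin n → Bool) (M : ℕ) (M>0 : 0 < M) (Ks : List (Block H M))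
    (avoid : ∀ v → occ v (vertsAll H Ks) + 𝟙 (F v) ≤ 1) where

    private instance M≢0 = >-nonZero M>0

    private
      assoc : ∀ a b c d e → a + (b + (c + (d + e))) ≡ a + (b + (c + d)) + e
      assoc a b c d e = equate (a ∷ b ∷ c ∷ d ∷ e ∷ []) λ a b c d e → a :+ (b :+ (c :+ (d :+ e))) :≡ a :+
          (b :+ (c :+ d)) :+ e

    parts : List (Block H M) → List (List (Fin n))
    parts []       = []
    parts (K ∷ Ks) = A K ∷ B K ∷ C K ∷ C′ K ∷ parts Ks

    occ-parts : ∀ Ks v → occ v (concat (parts Ks)) ≡ occ v (vertsAll H Ks)
    occ-parts [] v = refl
    occ-parts (K ∷ Ks) v rewrite occ-++ v (A K) (B K ++ (C K ++ (C′ K ++ concat (parts Ks)))) | occ-++ v (B K)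
        (C K ++ (C′ K ++ concat (parts Ks)))
      | occ-++ v (C K) (C′ K ++ concat (parts Ks)) | occ-++ v (C′ K) (concat (parts Ks)) | occ-parts Ks v
      | occ-++ v (verts H K) (vertsAll H Ks) | occ-verts H K v =
      assoc (occ v (A K)) (occ v (B K)) (occ v (C K)) (occ v (C′ K)) (occ v (vertsAll H Ks))

    ∈-parts : ∀ Ks {c} → c ∈ parts Ks → length c ≡ M × (∀ v → occ v c ≤ occ v (vertsAll H Ks))
    ∈-parts (K ∷ Ks) m = go m
      where
      whole : ∀ v → occ v (vertsAll H (K ∷ Ks)) ≡ occ v (A K) + (occ v (B K) + (occ v (C K) + occ v (C′ K))) +
          occ v (vertsAll H Ks)
      whole v = trans (occ-++ v (verts H K) (vertsAll H Ks)) (cong (_+ occ v (vertsAll H Ks)) (occ-verts H K v))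
      up : ∀ {c} → (∀ v → occ v c ≤ occ v (A K) + (occ v (B K) + (occ v (C K) + occ v (C′ K)))) → ∀ v → occ v c
          ≤ occ v (vertsAll H (K ∷ Ks))
      up h v = ≤-trans (h v) (≤-trans (m≤m+n _ (occ v (vertsAll H Ks))) (≤-reflexive (sym (whole v))))
      go : ∀ {c} → c ∈ A K ∷ B K ∷ C K ∷ C′ K ∷ parts Ks → length c ≡ M ×
          (∀ v → occ v c ≤ occ v (vertsAll H (K ∷ Ks)))
      go (here refl) = lenA K , up {A K} (λ v → m≤m+n _ _)
      go (there (here refl)) = lenB K , up {B K} (λ v → ≤-trans (m≤m+n _ _) (m≤n+m _ (occ v (A K))))
      go (there (there (here refl))) = lenC K , up {C K}
          (λ v → ≤-trans (m≤m+n _ _) (≤-trans (m≤n+m _ (occ v (B K))) (m≤n+m _ (occ v (A K)))))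
      go (there (there (there (here refl)))) = lenC′ K , up {C′ K}
          (λ v → ≤-trans (m≤n+m _ (occ v (C K))) (≤-trans (m≤n+m _ (occ v (B K))) (m≤n+m _ (occ v (A K)))))
      go (there (there (there (there h)))) = proj₁ (∈-parts Ks h) , λ v → ≤-trans (proj₂ (∈-parts Ks h) v)
          (≤-trans (m≤n+m _ (occ v (A K) + (occ v (B K) + (occ v (C K) + occ v (C′ K)))))
          (≤-reflexive (sym (whole v))))

    length-parts : ∀ Ks → length (parts Ks) ≡ length Ks * 4
    length-parts []       = refl
    length-parts (K ∷ Ks) = cong (4 +_) (length-parts Ks)

    ∑-parts : ∀ Ks (f : List (Fin n) → ℕ) → ∑ (parts Ks) f ≡ ∑ Ks
        (λ K → f (A K) + (f (B K) + (f (C K) + f (C′ K))))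
    ∑-parts []       f = refl
    ∑-parts (K ∷ Ks) f = trans (cong (λ t → f (A K) + (f (B K) + (f (C K) + (f (C′ K) + t)))) (∑-parts Ks f))
      (assoc (f (A K)) (f (B K)) (f (C K)) (f (C′ K)) _)

    rest : List (Fin n)
    rest = keep (λ v → not (F v) ∧ does (occ v (vertsAll H Ks) ≟ℕ 0)) V

    occ-rest : ∀ v → occ v (vertsAll H Ks) + occ v rest + 𝟙 (F v) ≡ 1
    occ-rest v = trans (cong (λ t → occ v (vertsAll H Ks) + t + 𝟙 (F v))
        (trans (occ-keep _ v V) (trans (cong (𝟙 (not (F v) ∧ does (occ v (vertsAll H Ks) ≟ℕ 0)) *_)
        (occ-allFin v)) (*-identityʳ _))))
      (bool (F v) (occ v (vertsAll H Ks)) (avoid v))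
      where
      bool : ∀ f o → o + 𝟙 f ≤ 1 → o + 𝟙 (not f ∧ does (o ≟ℕ 0)) + 𝟙 f ≡ 1
      bool true  zero    h = refl
      bool true  (suc o) h = ⊥-elim (<⇒≱ (s≤s (≤-trans (s≤s z≤n) (≤-reflexive (+-comm 1 o)))) h)
      bool false zero    h = refl
      bool false (suc zero) h = refl
      bool false (suc (suc o)) (s≤s ())

    pieces : ℕ
    pieces = suc (length rest / M)

    -- The uncovered vertices are chopped into classes of the same size, so that evenness is
    -- measured on everything outside `F`. The new blocks then take the right share of the uncovered
    -- vertices too.
    classes : List (List (Fin n))
    classes = parts Ks ++ chunks pieces M rest

    rest-fits : length rest ≤ pieces * M
    rest-fits = ≤-trans (≤-reflexive (m≡m%n+[m/n]*n (length rest) M))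
        (+-monoˡ-≤ _ (<⇒≤ (m%n<n (length rest) M)))

    occ-classes : ∀ v → occ v (concat classes) + 𝟙 (F v) ≡ 1
    occ-classes v = trans (cong (_+ 𝟙 (F v)) (begin
      occ v (concat (parts Ks ++ chunks pieces M rest))                  ≡⟨ ∑-concat classes (δ v) ⟩
      ∑ (parts Ks ++ chunks pieces M rest) (occ v)                       ≡⟨ ∑-++ (parts Ks) _ (occ v) ⟩
      ∑ (parts Ks) (occ v) + ∑ (chunks pieces M rest) (occ v)            ≡⟨ cong₂ _+_
          (∑-concat (parts Ks) (δ v)) (∑-concat (chunks pieces M rest) (δ v)) ⟨
      occ v (concat (parts Ks)) + occ v (concat (chunks pieces M rest))  ≡⟨ cong₂ _+_ (occ-parts Ks v)
          (cong (occ v) (concat-chunks pieces M rest rest-fits)) ⟩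
      occ v (vertsAll H Ks) + occ v rest ∎)) (occ-rest v)
      where open ≡-Reasoning

    classes-short : ∀ c → c ∈ classes → length c ≤ M
    classes-short c m with ∈-++⁻ (parts Ks) m
    ... | inj₁ p = ≤-reflexive (proj₁ (∈-parts Ks p))
    ... | inj₂ q = proj₁ (∈-chunks pieces M rest q)

    classes-uniq : ∀ c → c ∈ classes → Uniq c
    classes-uniq c m v with ∈-++⁻ (parts Ks) m
    ... | inj₁ p = ≤-trans (proj₂ (∈-parts Ks p) v)
        (≤-trans (m≤m+n _ (occ v rest)) (≤-trans (m≤m+n _ (𝟙 (F v))) (≤-reflexive (occ-rest v))))
    ... | inj₂ q = ≤-trans (proj₂ (∈-chunks pieces M rest q) v)
        (≤-trans (m≤n+m _ (occ v (vertsAll H Ks))) (≤-trans (m≤m+n _ (𝟙 (F v))) (≤-reflexive (occ-rest v))))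

    total : length Ks * (M * 4) + length rest ≡ count (λ v → not (F v))
    total = +-cancelʳ-≡ (count F) _ _ (begin
      length Ks * (M * 4) + length rest + count F
        ≡⟨ cong (_+ count F) (cong₂ _+_ (sym (trans (length-occ (vertsAll H Ks)) (length-vertsAll H Ks)))
            (sym (length-occ rest))) ⟩
      ∑ V (λ v → occ v (vertsAll H Ks)) + ∑ V (λ v → occ v rest) + count F
        ≡⟨ cong (_+ count F) (sym (∑-+ (V {n}) (λ v → occ v (vertsAll H Ks)) (λ v → occ v rest))) ⟩
      ∑ V (λ v → occ v (vertsAll H Ks) + occ v rest) + count F
        ≡⟨ sym (∑-+ (V {n}) (λ v → occ v (vertsAll H Ks) + occ v rest) (λ v → 𝟙 (F v))) ⟩
      ∑ V (λ v → occ v (vertsAll H Ks) + occ v rest + 𝟙 (F v))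
        ≡⟨ ∑-cong (V {n}) (λ v → trans (occ-rest v) (sym (𝟙-not (F v)))) ⟩
      ∑ V (λ v → 𝟙 (not (F v)) + 𝟙 (F v))
        ≡⟨ ∑-+ (V {n}) (λ v → 𝟙 (not (F v))) (λ v → 𝟙 (F v)) ⟩
      count (λ v → not (F v)) + count F ∎)
      where open ≡-Reasoning

    few-classes : M * length classes ≤ count (λ v → not (F v)) + M
    few-classes = begin
      M * length classes                                ≡⟨ cong (M *_)
          (trans (length-++ (parts Ks)) (cong₂ _+_ (length-parts Ks) (length-chunks pieces M rest))) ⟩
      M * (length Ks * 4 + suc (length rest / M))       ≤⟨ certify
          (M ∷ length Ks ∷ length rest / M ∷ length rest ∷ []) (λ M b q r → con 1 ⊠ q :* M :≤ r ∷ []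
                                                              ⊢ M :* (b :* con 4 :+ (con 1 :+ q)) :≤ b :*
                                                                  (M :* con 4) :+ r :+ M) (m/n*n≤m (length rest)
                                                                  M) ⟩
      length Ks * (M * 4) + length rest + M             ≡⟨ cong (_+ M) total ⟩
      count (λ v → not (F v)) + M ∎
      where open ≤-Reasoning

-- Iteration of the rounds to an almost perfect tiling

module AlmostTiling where
  open Prelude
  open Certificates
  open Sums
  open Multiplicities
  open BlowUp
  open FractionalCover
  open Duality
  open Blocks
  open TilingRound
  open Block

  potential-bound : ∀ d n′ e Q m t φ → 0 < n′ → e * (t * (m * 4)) ≤ n′ →
    d * n′ * φ ≤ m * m * 16 * (suc d * (e * Q)) * (t * t) + t * (m * m * 24 * (d * n′)) →
    d * φ ≤ suc d * Q * (t * (m * 4)) + m * d * 6 * (t * (m * 4))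
  potential-bound d n′ e Q m t φ n′>0 h₁ h₂ = *-cancelˡ-≤ n′ {{>-nonZero n′>0}}
      (certify (d ∷ n′ ∷ e ∷ Q ∷ m ∷ t ∷ φ ∷ []) (λ d n e Q m t φ →
    let x = t :* (m :* con 4) in
    (con 1 :+ d) :* Q :* x ⊠ e :* x :≤ n ∷
    con 1 ⊠ d :* n :* φ :≤ m :* m :* con 16 :* ((con 1 :+ d) :* (e :* Q)) :* (t :* t) :+ t :*
        (m :* m :* con 24 :* (d :* n)) ∷ []
    ⊢ n :* (d :* φ) :≤ n :* ((con 1 :+ d) :* Q :* x :+ m :* d :* con 6 :* x)) h₁ h₂)

  classes-bound : ∀ e Q L n′ x m → 0 < e → e * Q * L ≤ n′ + e * Q → n′ ≤ e * x + m * 4 * e → Q * L ≤ x + m * 4 +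
      Q
  classes-bound e Q L n′ x m e>0 h₁ h₂ = *-cancelˡ-≤ e {{>-nonZero e>0}}
      (certify (e ∷ Q ∷ L ∷ n′ ∷ x ∷ m ∷ []) (λ e Q L n x m →
    con 1 ⊠ e :* Q :* L :≤ n :+ e :* Q ∷ con 1 ⊠ n :≤ e :* x :+ m :* con 4 :* e ∷ [] ⊢ e :* (Q :* L) :≤ e :*
        (x :+ m :* con 4 :+ Q)) h₁ h₂)

  -- To leading order φ is (1 + 1/d)Qx and LQ² is Qx, so that 2Qx cancels and Qx/d remains. The last
  -- two hypotheses bound each lower-order term by half of this.
  variance-bound : ∀ d Q x m φ L W → d * φ ≤ suc d * Q * x + m * d * 6 * x → Q * L ≤ x + m * 4 + Q →
    W + 2 * Q * x ≡ φ + L * (Q * Q) → m * d * 12 ≤ Q → d * 2 * (m * 4 + Q) ≤ x → d * W ≤ 2 * (Q * x)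
  variance-bound d Q x m φ L W h₁ h₂ h₃ h₄ h₅ = *-cancelˡ-≤ 2
      (certify (d ∷ Q ∷ x ∷ m ∷ φ ∷ L ∷ W ∷ []) (λ d Q x m φ L W →
    con 2 ⊠ d :* φ :≤ (con 1 :+ d) :* Q :* x :+ m :* d :* con 6 :* x ∷ con 2 :* d :* Q ⊠ Q :* L :≤ x :+ m :* con
        4 :+ Q ∷
    con 2 :* d ⊠ W :+ con 2 :* Q :* x :≤ φ :+ L :* (Q :* Q) ∷ x ⊠ m :* d :* con 12 :≤ Q ∷ Q ⊠ d :* con 2 :*
        (m :* con 4 :+ Q) :≤ x ∷ []
    ⊢ con 2 :* (d :* W) :≤ con 2 :* (con 2 :* (Q :* x))) h₁ h₂ (≤-reflexive h₃) h₄ h₅)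

  deviation-bound : ∀ v Q x m L W S → 0 < Q → v * v * W ≤ 2 * (Q * x) → Q * L ≤ x + m * 4 + Q →
    2 * Q * v * S ≤ v * v * W + L * (Q * Q) → m * 4 + Q ≤ x → v * S ≤ 2 * x
  deviation-bound v Q x m L W S Q>0 h₁ h₂ h₃ h₄ = *-cancelˡ-≤ (Q * 2)
      {{>-nonZero (*-mono-≤ Q>0 (s≤s {n = 1} z≤n))}}
      (certify (v ∷ Q ∷ x ∷ m ∷ L ∷ W ∷ S ∷ []) (λ v Q x m L W S →
    con 1 ⊠ v :* v :* W :≤ con 2 :* (Q :* x) ∷ Q ⊠ Q :* L :≤ x :+ m :* con 4 :+ Q ∷ con 1 ⊠ con 2 :* Q :* v :* S
        :≤ v :* v :* W :+ L :* (Q :* Q) ∷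
    Q ⊠ m :* con 4 :+ Q :≤ x ∷ [] ⊢ Q :* con 2 :* (v :* S) :≤ Q :* con 2 :* (con 2 :* x)) h₁ h₂ h₃ h₄)

  -- The new blocks cover about n′/e vertices, while the old ones lose about 1/e of what they cover.
  -- The difference is 1/e of the uncovered part, at least n/(ℓe); rounding and deviation use up at
  -- most half of it.
  gain : ∀ n n′ e Q m ℓ x r b S → b * (e * Q * 4) ≤ r + b * (m * 4 + Q * 4) + 4 * S → n′ ≤ e * x + m * 4 * e → ℓ
      * 32 * S ≤ 2 * x →
    ℓ * 32 * m ≤ Q → ℓ * m * e * 32 ≤ n → e * x ≤ n′ → n′ ≤ n → b * (e * Q * 4) ≤ n′ → ℓ * (b * (e * Q * 4)) + n
        ≤ ℓ * n′ →
    ℓ * 2 * e * (b * (e * Q * 4)) + n ≤ ℓ * 2 * e * (x + r)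
  gain n n′ e Q m ℓ x r b S g₁ g₂ g₃ g₄ g₅ g₆ g₇ g₈ g₉ = *-cancelˡ-≤ 16
      (certify (n ∷ n′ ∷ e ∷ Q ∷ m ∷ ℓ ∷ x ∷ r ∷ b ∷ S ∷ []) (λ n n′ e Q m ℓ x r b S →
    con 32 :* ℓ :* e ⊠ b :* (e :* Q :* con 4) :≤ r :+ b :* (m :* con 4 :+ Q :* con 4) :+ con 4 :* S ∷
    con 32 :* ℓ ⊠ n′ :≤ e :* x :+ m :* con 4 :* e ∷ con 4 :* e ⊠ ℓ :* con 32 :* S :≤ con 2 :* x ∷ con 4 :* e :*
        b ⊠ ℓ :* con 32 :* m :≤ Q ∷
    con 4 ⊠ ℓ :* m :* e :* con 32 :≤ n ∷ con 8 ⊠ e :* x :≤ n′ ∷ con 9 ⊠ n′ :≤ n ∷ con 1 ⊠ b :* (e :* Q :* con 4)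
        :≤ n′ ∷
    con 32 ⊠ ℓ :* (b :* (e :* Q :* con 4)) :+ n :≤ ℓ :* n′ ∷ []
    ⊢ con 16 :* (ℓ :* con 2 :* e :* (b :* (e :* Q :* con 4)) :+ n) :≤ con 16 :* (ℓ :* con 2 :* e :* (x :+ r)))
        g₁ g₂ g₃ g₄ g₅ g₆ g₇ g₈ g₉)

  outside-half : ∀ n o f K → 302 ≤ K → K * f ≤ n → o + f ≡ n → n ≤ o * 2
  outside-half n o f K big few split = certify (n ∷ o ∷ f ∷ K ∷ []) (λ n o f K →
    con 1 ⊠ K :* f :≤ n ∷ f ⊠ con 302 :≤ K ∷ con 2 ⊠ n :≤ o :+ f ∷ [] ⊢ n :≤ o :* con 2) few big
        (≤-reflexive (sym split))

  x-large : ∀ n n′ e x m d Q → 0 < e → n ≤ n′ * 2 → n′ ≤ e * x + m * 4 * e →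
      (e * (d * 2 * (m * 4 + Q)) + m * 4 * e) * 2 ≤ n →
    d * 2 * (m * 4 + Q) ≤ x
  x-large n n′ e x m d Q e>0 h₁ h₂ h₃ = *-cancelˡ-≤ e {{>-nonZero e>0}}
      (*-cancelˡ-≤ 2 (certify (n ∷ n′ ∷ e ∷ x ∷ m ∷ d ∷ Q ∷ []) (λ n n′ e x m d Q →
    con 1 ⊠ n :≤ n′ :* con 2 ∷ con 2 ⊠ n′ :≤ e :* x :+ m :* con 4 :* e ∷ con 1 ⊠
        (e :* (d :* con 2 :* (m :* con 4 :+ Q)) :+ m :* con 4 :* e) :* con 2 :≤ n ∷ []
    ⊢ con 2 :* (e :* (d :* con 2 :* (m :* con 4 :+ Q))) :≤ con 2 :* (e :* x)) h₁ h₂ h₃))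

  module Parameters (ℓ K : ℕ) (ℓ>0 : 0 < ℓ) (big : 302 ≤ K) where

    -- The total deviation is at most 2x/v = x/(16ℓ), small against the gain; d = v² since deviation
    -- is the root of variance. By duality at least n³/C₀ triples are low, and new blocks on at most
    -- n/e vertices, e = 6C₀, meet at most half of them.
    v d C₀ e : ℕ
    v  = ℓ * 32
    d  = v * v
    C₀ = K * suc d * (K * suc d)
    e  = C₀ * 6

    -- New blocks cover a fraction 1/e of the vertices, so an old part of size `coarse m` = e ·
    -- `quantum m` loses `quantum m` on average. The factor 12d makes the linear term of the
    -- potential negligible.
    coarse quantum : ℕ → ℕ
    coarse m  = e * (d * 12) * m
    quantum m = d * 12 * m

    K>0 : 0 < K
    K>0 = ≤-trans (s≤s z≤n) big

    d>0 : 0 < d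
    d>0 = *-mono-≤ v>0 v>0
      where
      v>0 : 0 < v
      v>0 = *-mono-≤ ℓ>0 (s≤s {n = 31} z≤n)

    e>0 : 0 < e
    e>0 = *-mono-≤ (*-mono-≤ (*-mono-≤ K>0 (s≤s {n = d} z≤n)) (*-mono-≤ K>0 (s≤s {n = d} z≤n)))
        (s≤s {n = 5} z≤n)

    coarse≡ : ∀ m → coarse m ≡ e * quantum m
    coarse≡ m = *-assoc e (d * 12) m

    threshold : ℕ → ℕ
    threshold m = 1 + ((3 * (m + m)) * blowSize (m + m) 3 (C₀ * 2) +
        ((e * (d * 2 * (m * 4 + quantum m)) + m * 4 * e) * 2 + ℓ * m * e * 32))

    -- The second alternative asserts coverage of in/(2ℓe) vertices, which is impossible once i
    -- exceeds 2ℓe.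
    Cover-or : ∀ {n} (H : Hypergraph3 n) (F : Fin n → Bool) (m i : ℕ) → Set
    Cover-or {n} H F m i = Σ (List (Block H m)) λ Ks → (∀ v → occ v (vertsAll H Ks) + 𝟙 (F v) ≤ 1) ×
      (ℓ * count (λ v → not (F v)) ≤ ℓ * (length Ks * (m * 4)) + n ⊎ i * n ≤ ℓ * 2 * e * (length Ks * (m * 4)))

    module _ {n : ℕ} (H : Hypergraph3 n) (F : Fin n → Bool) (k m i : ℕ) (m>0 : 0 < m) (large : threshold m ≤ n)
        (big′ : k * 252 ≤ K)
      (few : K * count F ≤ n) (deg : MinDegree H K) (nonext : NonExtremal H k) (Ks : List (Block H (coarse m)))
      (avoid : ∀ v → occ v (vertsAll H Ks) + 𝟙 (F v) ≤ 1) where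

      private
        n′ M Q : ℕ
        n′ = count (λ v → not (F v))
        M = coarse m
        Q = quantum m

        n>0 : 0 < n
        n>0 = ≤-trans (s≤s z≤n) large

        large₁ : (3 * (m + m)) * blowSize (m + m) 3 (C₀ * 2) ≤ n
        large₁ = ≤-trans (≤-trans (m≤m+n _ _) (n≤1+n _)) large

        large₂ : (e * (d * 2 * (m * 4 + Q)) + m * 4 * e) * 2 ≤ n
        large₂ = ≤-trans (≤-trans (m≤m+n _ _)
            (≤-trans (m≤n+m _ ((3 * (m + m)) * blowSize (m + m) 3 (C₀ * 2))) (n≤1+n _))) large

        large₃ : ℓ * m * e * 32 ≤ n
        large₃ = ≤-trans (≤-trans (m≤n+m _ ((e * (d * 2 * (m * 4 + Q)) + m * 4 * e) * 2))
            (≤-trans (m≤n+m _ ((3 * (m + m)) * blowSize (m + m) 3 (C₀ * 2))) (n≤1+n _))) large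

        split : n′ + count F ≡ n
        split = count-not F

        half : n ≤ n′ * 2
        half = outside-half n n′ (count F) K big few split

        n′>0 : 0 < n′
        n′>0 = *-cancelʳ-< 2 0 n′ (≤-trans n>0 half)

        n′≤n : n′ ≤ n
        n′≤n = ≤-trans (m≤m+n n′ (count F)) (≤-reflexive split)

        Q>0 : 0 < Q
        Q>0 = *-mono-≤ (*-mono-≤ d>0 (s≤s {n = 11} z≤n)) m>0

        M>0 : 0 < M
        M>0 = subst (0 <_) (sym (coarse≡ m)) (*-mono-≤ e>0 Q>0)

        unit : ℕ
        unit = m * 4 * e

        instance
          unit≢0 : NonZero unit
          unit≢0 = >-nonZero (*-mono-≤ (*-mono-≤ m>0 (s≤s {n = 3} z≤n)) e>0)

        t x : ℕ
        t = n′ / unit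
        x = t * (m * 4)

        x-upper : e * x ≤ n′
        x-upper = ≤-trans (≤-reflexive (trans (*-comm e x) (*-assoc t (m * 4) e))) (m/n*n≤m n′ unit)

        x-lower : n′ ≤ e * x + m * 4 * e
        x-lower = ≤-trans (≤-reflexive (m≡m%n+[m/n]*n n′ unit))
            (≤-trans (+-monoˡ-≤ (t * unit) (<⇒≤ (m%n<n n′ unit)))
          (≤-reflexive (trans (+-comm unit (t * unit))
              (cong (_+ unit) (trans (sym (*-assoc t (m * 4) e)) (*-comm x e))))))

        cls : List (List (Fin n))
        cls = classes H F M M>0 Ks avoid

        open Potential F M cls (classes-short H F M M>0 Ks avoid) (classes-uniq H F M M>0 Ks avoid)
            (occ-classes H F M M>0 Ks avoid)

        abstract
          newBlocks : Σ (List (Block H m)) λ ts → length ts ≡ t × (∀ v → occ v (vertsAll H ts) + 𝟙 (F v) ≤ 1) ×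
            d * n′ * Φ (vertsAll H ts) ≤ m * m * 16 * (suc d * M) * (t * t) + t * (m * m * 24 * (d * n′))
          newBlocks = NewBlock.chain-blocks H F M cls (classes-short H F M M>0 Ks avoid)
              (classes-uniq H F M M>0 Ks avoid) (occ-classes H F M M>0 Ks avoid)
            k d K big big′ n>0 few deg nonext m m>0 d>0 large₁ n′>0 t
                (≤-trans (≤-reflexive (*-comm x e)) (≤-trans x-upper n′≤n))

        ts : List (Block H m)
        ts = proj₁ newBlocks

        X : List (Fin n)
        X = vertsAll H ts

        ts-avoid : ∀ v → occ v X + 𝟙 (F v) ≤ 1
        ts-avoid = proj₁ (proj₂ (proj₂ newBlocks))

        lenX : length X ≡ x
        lenX = trans (length-vertsAll H ts) (cong (_* (m * 4)) (proj₁ (proj₂ newBlocks)))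

        S W L : ℕ
        S = ∑ cls (dev Q X)
        W = ∑ cls (λ c → dev Q X c * dev Q X c)
        L = length cls

        bound₁ : d * Φ X ≤ suc d * Q * x + m * d * 6 * x
        bound₁ = potential-bound d n′ e Q m t (Φ X) n′>0 x-upper
          (subst (λ z → d * n′ * Φ X ≤ m * m * 16 * (suc d * z) * (t * t) + t * (m * m * 24 * (d * n′)))
              (coarse≡ m) (proj₂ (proj₂ (proj₂ newBlocks))))

        bound₂ : Q * L ≤ x + m * 4 + Q
        bound₂ = classes-bound e Q L n′ x m e>0
            (subst (λ z → z * L ≤ n′ + z) (coarse≡ m) (few-classes H F M M>0 Ks avoid)) x-lower

        roomy : d * 2 * (m * 4 + Q) ≤ x
        roomy = x-large n n′ e x m d Q e>0 half x-lower large₂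

        bound₃ : d * W ≤ 2 * (Q * x)
        bound₃ = variance-bound d Q x m (Φ X) L W bound₁ bound₂
          (subst (λ z → W + 2 * Q * z ≡ Φ X + L * (Q * Q)) (trans (loads≡ X ts-avoid) lenX) (variance Q X))
          (≤-reflexive (trans (*-assoc m d 12) (*-comm m (d * 12)))) roomy

        bound₄ : v * S ≤ 2 * x
        bound₄ = deviation-bound v Q x m L W S Q>0 bound₃ bound₂ (amgm v Q X)
          (≤-trans (certify (d ∷ m * 4 + Q ∷ []) (λ d q → con 2 :* q ⊠ con 1 :≤ d ∷ [] ⊢ q :≤ d :* con 2 :* q)
              d>0) roomy)

        open Recut H X M m Q m>0

        abstract
          recuts : Σ (List (Block H m)) λ Ls →
              (∀ v → occ v (vertsAll H Ls) ≤ 𝟙 (free v) * occ v (vertsAll H Ks)) ×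
            length Ks * (M * 4) ≤ length Ls * (m * 4) + length Ks * (m * 4 + Q * 4) + 4 * ∑ Ks deviation
          recuts = recutAll Ks

        Ls : List (Block H m)
        Ls = proj₁ recuts

        deviations : ∑ Ks deviation ≤ S
        deviations = ≤-trans (≤-reflexive (sym (∑-parts H F M M>0 Ks avoid Ks (dev Q X))))
          (≤-trans (m≤m+n _ _) (≤-reflexive
              (sym (∑-++ (parts H F M M>0 Ks avoid Ks)
              (chunks (pieces H F M M>0 Ks avoid) M (rest H F M M>0 Ks avoid)) (dev Q X)))))

        r : ℕ
        r = length Ls * (m * 4)

        size : length Ks * (M * 4) ≤ r + length Ks * (m * 4 + Q * 4) + 4 * S
        size = ≤-trans (proj₂ (proj₂ recuts))
            (+-monoʳ-≤ (r + length Ks * (m * 4 + Q * 4)) (*-monoʳ-≤ 4 deviations))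

        combined : ∀ w → occ w (vertsAll H (ts ++ Ls)) + 𝟙 (F w) ≤ 1
        combined w = ≤-trans (≤-reflexive (cong (_+ 𝟙 (F w)) (vertsAll-++ H ts Ls w)))
          (bool (occ w X) (occ w (vertsAll H Ls)) (occ w (vertsAll H Ks)) (𝟙 (F w)) (ts-avoid w) (avoid w)
              (proj₁ (proj₂ recuts) w))
          where
          bool : ∀ a l b f → a + f ≤ 1 → b + f ≤ 1 → l ≤ 𝟙 (does (a ≟ℕ 0)) * b → a + l + f ≤ 1
          bool zero    l b f h₁ h₂ h₃ = ≤-trans (+-monoˡ-≤ f (≤-trans h₃ (≤-reflexive (+-identityʳ b)))) h₂
          bool (suc a) l b f h₁ h₂ h₃ rewrite n≤0⇒n≡0 h₃ | +-identityʳ a = h₁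

        covered≤ : length Ks * (M * 4) ≤ n′
        covered≤ = ≤-trans (m≤m+n _ (length (rest H F M M>0 Ks avoid))) (≤-reflexive (total H F M M>0 Ks avoid))

        improved : ℓ * (length Ks * (M * 4)) + n ≤ ℓ * n′ → ℓ * 2 * e * (length Ks * (M * 4)) + n ≤ ℓ * 2 * e *
            (length (ts ++ Ls) * (m * 4))
        improved h = subst₂ _≤_ (cong (λ z → ℓ * 2 * e * (length Ks * (z * 4)) + n) (sym (coarse≡ m)))
          (cong (ℓ * 2 * e *_) (trans (cong (_+ r) (cong (_* (m * 4)) (sym (proj₁ (proj₂ newBlocks)))))
              (trans (sym (*-distribʳ-+ (m * 4) (length ts) (length Ls)))
              (cong (_* (m * 4)) (sym (length-++ ts))))))
          (gain n n′ e Q m ℓ x r (length Ks) S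
              (subst (λ z → length Ks * (z * 4) ≤ r + length Ks * (m * 4 + Q * 4) + 4 * S) (coarse≡ m) size)
            x-lower bound₄ quantum-large large₃ x-upper n′≤n
            (subst (λ z → length Ks * (z * 4) ≤ n′) (coarse≡ m) covered≤)
                (subst (λ z → ℓ * (length Ks * (z * 4)) + n ≤ ℓ * n′) (coarse≡ m) h))
          where
          quantum-large : ℓ * 32 * m ≤ Q
          quantum-large = *-monoˡ-≤ m (≤-trans (m≤m*n v v {{>-nonZero (*-mono-≤ ℓ>0 (s≤s {n = 31} z≤n))}})
              (m≤m*n d 12))

        abstract
          refined : Σ (List (Block H m)) λ Rs → (∀ v → occ v (vertsAll H Rs) ≤ occ v (vertsAll H Ks)) × length
              Rs ≡ length Ks * (e * (d * 12))
          refined = refine H m (e * (d * 12)) Ks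

        same : length (proj₁ refined) * (m * 4) ≡ length Ks * (M * 4)
        same = trans (cong (_* (m * 4)) (proj₂ (proj₂ refined)))
            (trans (*-assoc (length Ks) (e * (d * 12)) (m * 4))
            (cong (length Ks *_) (sym (*-assoc (e * (d * 12)) m 4))))

      advance : (ℓ * n′ ≤ ℓ * (length Ks * (M * 4)) + n ⊎ i * n ≤ ℓ * 2 * e * (length Ks * (M * 4))) → Cover-or
          H F m (suc i)
      advance (inj₁ small) = proj₁ refined ,
          (λ w → ≤-trans (+-monoˡ-≤ (𝟙 (F w)) (proj₁ (proj₂ refined) w)) (avoid w)) ,
        inj₁ (subst (λ z → ℓ * n′ ≤ ℓ * z + n) (sym same) small)
      advance (inj₂ progress) = go (≤-total (ℓ * n′) (ℓ * (length Ks * (M * 4)) + n))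
        where
        go : ℓ * n′ ≤ ℓ * (length Ks * (M * 4)) + n ⊎ ℓ * (length Ks * (M * 4)) + n ≤ ℓ * n′ → Cover-or H F m
            (suc i)
        go (inj₁ small) = advance (inj₁ small)
        go (inj₂ h) = ts ++ Ls , combined , inj₂
            (≤-trans (≤-trans (+-monoʳ-≤ n progress) (≤-reflexive (+-comm n _))) (improved h))

    size : ℕ → ℕ → ℕ
    size zero    m = 1
    size (suc i) m = size i (coarse m) + threshold m

    -- The final block size is prescribed and the earlier rounds work with coarser blocks, so the
    -- induction generalises over m.
    rounds : ∀ k i m → 0 < m → ∀ {n} → size i m ≤ n → (H : Hypergraph3 n) (F : Fin n → Bool) → k * 252 ≤ K →
      K * count F ≤ n → MinDegree H K → NonExtremal H k → Cover-or H F m i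
    rounds k zero m m>0 large H F big′ few deg nonext = [] , (λ v → 𝟙≤1 (F v)) , inj₂ z≤n
    rounds k (suc i) m m>0 large H F big′ few deg nonext =
      let Ks , avoid , state = rounds k i (coarse m)
              (subst (0 <_) (sym (coarse≡ m)) (*-mono-≤ e>0 (*-mono-≤ (*-mono-≤ d>0 (s≤s {n = 11} z≤n)) m>0)))
                                 (≤-trans (m≤m+n _ _) large) H F big′ few deg nonext
      in advance H F k m i m>0 (≤-trans (m≤n+m _ (size i (coarse m))) large) big′ few deg nonext Ks avoid state

    abstract
      enough : ℕ → ℕ
      enough m = size (suc (ℓ * 2 * e)) m

      almost-tiling : ∀ k m → 0 < m → ∀ {n} → enough m ≤ n → (H : Hypergraph3 n) (F : Fin n → Bool) → k * 252 ≤
          K →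
        K * count F ≤ n → MinDegree H K → NonExtremal H k →
        Σ (List (Block H m)) λ Ks → (∀ v → occ v (vertsAll H Ks) + 𝟙 (F v) ≤ 1) ×
          ℓ * count (λ v → not (F v)) ≤ ℓ * (length Ks * (m * 4)) + n
      almost-tiling k m m>0 {n} large H F big′ few deg nonext = finish
          (rounds k (suc G) m m>0 large H F big′ few deg nonext)
        where
        G : ℕ
        G = ℓ * 2 * e
        finish : Cover-or H F m (suc G) → Σ (List (Block H m)) λ Ks →
            (∀ v → occ v (vertsAll H Ks) + 𝟙 (F v) ≤ 1) ×
          ℓ * count (λ v → not (F v)) ≤ ℓ * (length Ks * (m * 4)) + n
        finish (Ks , avoid , inj₁ h) = Ks , avoid , h
        finish (Ks , avoid , inj₂ h) = ⊥-elim (<⇒≱ n>0 (+-cancelʳ-≤ (G * n) n 0 (≤-trans h (*-monoʳ-≤ G fits))))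
          where
          n>0 : 0 < n
          n>0 = ≤-trans (≤-trans (s≤s z≤n) (m≤n+m _ (size G (coarse m)))) large
          fits : length Ks * (m * 4) ≤ n
          fits = vertsAll-fit H F Ks avoid

-- Loose paths, absorbing chains and connecting triples

module Paths where
  open Prelude
  open Certificates
  open Sums
  open Multiplicities
  open FractionalCover
  open Blocks
  open Block
  open import Data.Nat.DivMod using (m<n⇒m%n≡m; n%n≡0; _mod_)
  open import Data.Nat.Divisibility using (divides)
  open import Data.Fin.Properties using (toℕ-fromℕ<; toℕ<n)

  module _ {n : ℕ} (H : Hypergraph3 n) where

    -- A loose path from x to y; l lists the vertices after x, so a closed path lists each of its vertices once.
    data LP : Fin n → List (Fin n) → Fin n → Set where
      stop : ∀ {x} → LP x [] x
      step : ∀ {x a b l y} → edge H x a b ≡ true → LP b l y → LP x (a ∷ b ∷ l) y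

    append : ∀ {x l y l′ z} → LP x l y → LP y l′ z → LP x (l ++ l′) z
    append stop       q = q
    append (step e p) q = step e (append p q)

    nth : Fin n → List (Fin n) → ℕ → Fin n
    nth d []      i       = d
    nth d (x ∷ l) zero    = x
    nth d (x ∷ l) (suc i) = nth d l i

    nth-∈ : ∀ d l i → i < length l → nth d l i ∈ l
    nth-∈ d (x ∷ l) zero    _ = here refl
    nth-∈ d (x ∷ l) (suc i) (s≤s h) = there (nth-∈ d l i h)

    nth-inj : ∀ d l → Uniq l → ∀ i j → i < length l → j < length l → nth d l i ≡ nth d l j → i ≡ j
    nth-inj d (x ∷ l) u zero zero _ _ _ = refl
    nth-inj d (x ∷ l) u zero (suc j) _ (s≤s h) e = ⊥-elim
        (<⇒≱ (+-mono-≤ (≤-reflexive (sym (δ-refl x))) (occ-∈ (subst (_∈ l) (sym e) (nth-∈ d l j h)))) (u x))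
    nth-inj d (x ∷ l) u (suc i) zero (s≤s h) _ e = ⊥-elim
        (<⇒≱ (+-mono-≤ (≤-reflexive (sym (δ-refl x))) (occ-∈ (subst (_∈ l) e (nth-∈ d l i h)))) (u x))
    nth-inj d (x ∷ l) u (suc i) (suc j) (s≤s h) (s≤s h′) e = cong suc
        (nth-inj d l (λ v → ≤-trans (m≤n+m _ (δ v x)) (u v)) i j h h′ e)

    LP-last : ∀ {x l y} d → LP x l y → nth d (x ∷ l) (length l) ≡ y
    LP-last d stop = refl
    LP-last d (step e p) = LP-last d p

    LP-edge : ∀ {x l y} d → LP x l y → ∀ i → 2 * i < length l →
      edge H (nth d (x ∷ l) (2 * i)) (nth d (x ∷ l) (2 * i + 1)) (nth d (x ∷ l) (2 * i + 2)) ≡ true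
    LP-edge d (step e p) zero _ = e
    LP-edge {x} d (step {a = a} {b = b} {l = l} e p) (suc i) h =
      subst (λ t → edge H (nth d (x ∷ a ∷ b ∷ l) t) (nth d (x ∷ a ∷ b ∷ l) (t + 1))
          (nth d (x ∷ a ∷ b ∷ l) (t + 2)) ≡ true) (sym (double i))
        (LP-edge d p i (s≤s⁻¹ (s≤s⁻¹ (subst (_< 2 + length l) (double i) h))))
      where
      double : ∀ i → 2 * suc i ≡ 2 + 2 * i
      double i = cong suc (+-suc i (i + 0))

    LP-even : ∀ {x l y} → LP x l y → Σ ℕ λ k → length l ≡ k * 2
    LP-even stop = 0 , refl
    LP-even (step e p) = suc (proj₁ (LP-even p)) , cong (2 +_) (proj₂ (LP-even p))

  closed-path : ∀ {n} (H : Hypergraph3 n) {x l} → 6 ≤ n → LP H x l x → (∀ v → occ v l ≡ 1) → LooseHamiltonCycle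
      H
  closed-path {suc m} H {x} {l} six p once = six , divides (proj₁ (LP-even H p))
      (trans (sym len) (proj₂ (LP-even H p))) , σ , inj , edges
    where
    n = suc m
    len : length l ≡ n
    len = trans (sym (length-occ l)) (trans (∑-cong (allFin n) once) ∑-one)
    at : ℕ → Fin n
    at = nth H x (x ∷ l)
    σ : Fin n → Fin n
    σ i = at (toℕ i)
    uniq : Uniq l
    uniq v = ≤-reflexive (once v)
    last : at n ≡ x
    last = subst (λ t → at t ≡ x) len (LP-last H x p)
    -- The vertex x stands at index 0 of `x ∷ l` and again at the end of `l`. Indices are therefore
    -- shifted cyclically into `l`, where repetitions are excluded.
    pos : ℕ → ℕ
    pos zero    = m
    pos (suc k) = k
    at-pos : ∀ i → at i ≡ nth H x l (pos i)
    at-pos zero    = sym last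
    at-pos (suc k) = refl
    pos< : ∀ i → i < n → pos i < length l
    pos< zero    _ = subst (m <_) (sym len) ≤-refl
    pos< (suc k) h = subst (k <_) (sym len) (<⇒≤ h)
    pos-inj : ∀ i j → i < n → j < n → pos i ≡ pos j → i ≡ j
    pos-inj zero    zero    _ _ _ = refl
    pos-inj zero    (suc k) _ h e = ⊥-elim (<⇒≱ h (s≤s (≤-reflexive e)))
    pos-inj (suc k) zero    h _ e = ⊥-elim (<⇒≱ h (s≤s (≤-reflexive (sym e))))
    pos-inj (suc k) (suc _) _ _ e = cong suc e
    inj : ∀ {i j} → σ i ≡ σ j → i ≡ j
    inj {i} {j} e = toℕ-injective (pos-inj (toℕ i) (toℕ j) (toℕ<n i) (toℕ<n j)
      (nth-inj H x l uniq (pos (toℕ i)) (pos (toℕ j)) (pos< (toℕ i) (toℕ<n i)) (pos< (toℕ j) (toℕ<n j))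
        (trans (sym (at-pos (toℕ i))) (trans e (at-pos (toℕ j))))))
    σ-mod : ∀ t → σ (t mod n) ≡ at (t % n)
    σ-mod t = cong at (toℕ-fromℕ< (m%n<n t n))
    small : ∀ t → t < n → σ (t mod n) ≡ at t
    small t h = trans (σ-mod t) (cong at (m<n⇒m%n≡m h))
    wrap : ∀ t → t ≤ n → σ (t mod n) ≡ at t
    wrap t h with m≤n⇒m<n∨m≡n h
    ... | inj₁ lt   = small t lt
    ... | inj₂ refl = trans (σ-mod n) (trans (cong at (n%n≡0 n)) (sym last))
    -- By parity of n; equality occurs for the last edge, whose third index wraps around to x.
    next : ∀ i → 2 * i < n → 2 * i + 2 ≤ n
    next i h = let k , e = LP-even H p in
      ≤-trans (≤-reflexive (trans (+-comm (2 * i) 2)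
          (sym (trans (*-comm (suc i) 2) (cong suc (+-suc i (i + 0)))))))
        (≤-trans (*-monoˡ-≤ 2 (*-cancelʳ-< 2 i k (subst₂ _<_ (*-comm 2 i) (trans (sym len) e) h)))
            (≤-reflexive (trans (sym e) len)))
    edges : ∀ i → 2 * i < n → edge H (σ ((2 * i) mod n)) (σ ((2 * i + 1) mod n)) (σ ((2 * i + 2) mod n)) ≡ true
    edges i h = subst (λ a → edge H a (σ ((2 * i + 1) mod n)) (σ ((2 * i + 2) mod n)) ≡ true)
        (sym (small (2 * i) h))
      (subst₂ (λ b c → edge H (at (2 * i)) b c ≡ true)
        (sym (small (2 * i + 1) (≤-trans (≤-reflexive (sym (+-suc (2 * i) 1))) (next i h))))
            (sym (wrap (2 * i + 2) (next i h)))
        (LP-edge H x p i (subst (2 * i <_) (sym len) h)))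

  module _ {n : ℕ} (H : Hypergraph3 n) where

    record Segment : Set where
      constructor segment
      field
        start end : Fin n
        inner : List (Fin n)
        path : LP H start inner end
    open Segment

    segVerts : Segment → List (Fin n)
    segVerts s = start s ∷ inner s

    -- The path a₁ c₁ b₁ c′₁ a₂ c₂ b₂ c′₂ …, which misses only the last vertex of C′.
    blockPath : ∀ {m} → 0 < m → (K : Block H m) → Σ Segment λ s → length (segVerts s) + 1 ≡ m * 4 ×
        (∀ v → occ v (segVerts s) ≤ occ v (verts H K))
    blockPath m>0 K =
      let s , len , sub , _ = go (A K) (B K) (C K) (C′ K) (trans (lenA K) (sym (lenB K)))
              (trans (lenB K) (sym (lenC K))) (trans (lenC K) (sym (lenC′ K)))
                            (subst (0 <_) (sym (lenA K)) m>0) (complete K)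
      in s , trans len (cong (_* 4) (lenA K)) , λ v → ≤-trans (sub v) (≤-reflexive (sym (occ-verts H K v)))
      where
      -- The invariant that the start lies in A makes b, c′ and the start of the remaining path an
      -- edge.
      go : ∀ A B C C′ → length A ≡ length B → length B ≡ length C → length C ≡ length C′ → 0 < length A →
        (∀ {a b c} → a ∈ A → b ∈ B → c ∈ C ⊎ c ∈ C′ → edge H a b c ≡ true) →
        Σ Segment λ s → length (segVerts s) + 1 ≡ length A * 4 ×
            (∀ v → occ v (segVerts s) ≤ occ v A + (occ v B + (occ v C + occ v C′))) × start s ∈ A
      go (a ∷ []) (b ∷ []) (c ∷ []) (c′ ∷ []) _ _ _ _ com =
        segment a b (c ∷ b ∷ []) (step (trans (sym₂₃ H a c b) (com (here refl) (here refl) (inj₁ (here refl))))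
            stop) , refl
        , (λ v → certify (δ v a ∷ δ v b ∷ δ v c ∷ δ v c′ ∷ []) λ a b c d → [] ⊢ a :+ (c :+ (b :+ con 0)) :≤ a :+
            con 0 :+ (b :+ con 0 :+ (c :+ con 0 :+ (d :+ con 0))))
        , here refl
      go (a ∷ A@(_ ∷ _)) (b ∷ B) (c ∷ C) (c′ ∷ C′) e₁ e₂ e₃ _ com =
        let s , len , sub , st = go A B C C′ (suc-injective e₁) (suc-injective e₂) (suc-injective e₃) (s≤s z≤n)
              (λ x y → λ { (inj₁ z) → com (there x) (there y) (inj₁ (there z)) ; (inj₂ z) → com (there x)
                  (there y) (inj₂ (there z)) })
        in segment a (end s) (c ∷ b ∷ c′ ∷ start s ∷ inner s)
             (step (trans (sym₂₃ H a c b) (com (here refl) (here refl) (inj₁ (here refl))))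
               (step (trans (sym₂₃ H b c′ (start s))
                   (trans (sym₁₂ H b (start s) c′) (com (there st) (here refl) (inj₂ (here refl))))) (path s)))
         , cong (4 +_) len
         , (λ v → certify (δ v a ∷ δ v b ∷ δ v c ∷ δ v c′ ∷ occ v (segVerts s) ∷ occ v A ∷ occ v B ∷ occ v C ∷
             occ v C′ ∷ []) (λ a b c d s A B C D →
             con 1 ⊠ s :≤ A :+ (B :+ (C :+ D)) ∷ [] ⊢ a :+ (c :+ (b :+ (d :+ s))) :≤ a :+ A :+
                 (b :+ B :+ (c :+ C :+ (d :+ D)))) (sub v))
         , here refl

    Pair : Set
    Pair = Fin n × Fin n

    Absorbs : Fin n → List (Fin n) → Fin n → Fin n → Fin n → Set
    Absorbs x l y u w = Σ (List (Fin n)) λ l′ → LP H x l′ y × (∀ v → occ v l′ ≡ occ v l + (δ v u + δ v w))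

    -- A loose path divided into pieces, each of which can still take up certain pairs of vertices.
    data Chain : Fin n → Fin n → Set where
      nil  : ∀ {x} → Chain x x
      cons : ∀ {x y z} (l : List (Fin n)) (p : LP H x l y) (abs : Pair → Bool) →
          (∀ u w → abs (u , w) ≡ true → Absorbs x l y u w) →
        Chain y z → Chain x z

    chainVerts : ∀ {x y} → Chain x y → List (Fin n)
    chainVerts nil = []
    chainVerts (cons l p abs ok c) = l ++ chainVerts c

    hits : ∀ {x y} → Pair → Chain x y → ℕ
    hits q nil = 0
    hits q (cons l p abs ok c) = 𝟙 (abs q) + hits q c

    chainPath : ∀ {x y} (c : Chain x y) → LP H x (chainVerts c) y
    chainPath nil = stop
    chainPath (cons l p abs ok c) = append H p (chainPath c)

    -- The piece used is marked as exhausted, so every pair loses at most one hit. Hence k hits per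
    -- pair allow any k pairs to be absorbed greedily.
    switch : ∀ {x y} u w (c : Chain x y) → 0 < hits (u , w) c →
      Σ (Chain x y) λ c′ → (∀ v → occ v (chainVerts c′) ≡ occ v (chainVerts c) + (δ v u + δ v w)) ×
          (∀ q → hits q c ≤ hits q c′ + 1)
    switch u w (cons l p abs ok c) pos = go (abs (u , w)) refl
      where
      rearr : ∀ a b c → a + b + c ≡ a + c + b
      rearr a b c = trans (+-assoc a b c) (trans (cong (a +_) (+-comm b c)) (sym (+-assoc a c b)))
      go : ∀ b → abs (u , w) ≡ b → Σ (Chain _ _) λ c′ →
          (∀ v → occ v (chainVerts c′) ≡ occ v (l ++ chainVerts c) + (δ v u + δ v w)) ×
          (∀ q → 𝟙 (abs q) + hits q c ≤ hits q c′ + 1)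
      go true e = let l′ , p′ , eq = ok u w e in
        cons l′ p′ (λ _ → false) (λ u w → λ ()) c
        , (λ v → trans (occ-++ v l′ (chainVerts c))
            (trans (cong (_+ occ v (chainVerts c)) (eq v))
            (trans (rearr (occ v l) (δ v u + δ v w) _)
            (cong (_+ (δ v u + δ v w)) (sym (occ-++ v l (chainVerts c)))))))
        , λ q → ≤-trans (+-monoˡ-≤ (hits q c) (𝟙≤1 (abs q))) (≤-reflexive (+-comm 1 _))
      go false e = let c′ , eq , h = switch u w c (subst (λ b → 0 < 𝟙 b + hits (u , w) c) e pos) in
        cons l p abs ok c′
        , (λ v → trans (occ-++ v l (chainVerts c′))
            (trans (cong (occ v l +_) (eq v))
            (trans (sym (+-assoc (occ v l) _ _))
            (cong (_+ (δ v u + δ v w)) (sym (occ-++ v l (chainVerts c)))))))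
        , λ q → ≤-trans (+-monoʳ-≤ (𝟙 (abs q)) (h q)) (≤-reflexive (sym (+-assoc (𝟙 (abs q)) _ 1)))

    absorb-even : ∀ k (l : List (Fin n)) → length l ≡ k * 2 → ∀ {x y} (c : Chain x y) → (∀ q → k ≤ hits q c) →
      Σ (Chain x y) λ c′ → ∀ v → occ v (chainVerts c′) ≡ occ v (chainVerts c) + occ v l
    absorb-even zero [] e c h = c , λ v → sym (+-identityʳ _)
    absorb-even (suc k) (u ∷ w ∷ l) e c h =
      let c₁ , eq₁ , h₁ = switch u w c (≤-trans (s≤s z≤n) (h (u , w)))
          c₂ , eq₂ = absorb-even k l (suc-injective (suc-injective e)) c₁
              (λ q → s≤s⁻¹ (≤-trans (h q) (≤-trans (h₁ q) (≤-reflexive (+-comm _ 1)))))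
      in c₂ , λ v → trans (eq₂ v) (trans (cong (_+ occ v l) (eq₁ v))
          (trans (+-assoc (occ v (chainVerts c)) _ _) (cong (occ v (chainVerts c) +_) (+-assoc (δ v u) _ _))))

    Triple : Set
    Triple = Fin n × Fin n × Fin n

    connects : Pair → Triple → Bool
    connects (x , y) (a , b , c) = edge H x a b ∧ edge H b c y

    connector : ∀ {x y a b c} → connects (x , y) (a , b , c) ≡ true → LP H x (a ∷ b ∷ c ∷ y ∷ []) y
    connector {x} {y} {a} {b} h = let e , f = ∧-true {edge H x a b} h in step e (step f stop)

    tripleVerts : List Triple → List (Fin n)
    tripleVerts [] = []
    tripleVerts ((a , b , c) ∷ R) = a ∷ b ∷ c ∷ tripleVerts R

    connections : Pair → List Triple → ℕ
    connections q R = ∑ R (λ t → 𝟙 (connects q t))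

    Taken : Pair → List Triple → Set
    Taken q R = Σ Triple λ t → Σ (List Triple) λ R′ → connects q t ≡ true ×
      (∀ v → occ v (tripleVerts R) ≡ occ v (tripleVerts (t ∷ [])) + occ v (tripleVerts R′)) ×
          (∀ q′ → connections q′ R ≤ connections q′ R′ + 1) × length R ≡ suc (length R′)

    takeTriple : ∀ q R → 0 < connections q R → Taken q R
    takeTriple q (t@(a , b , c) ∷ R) pos = go (connects q t) refl
      where
      go : ∀ b′ → connects q t ≡ b′ → Taken q (t ∷ R)
      go true e = t , R , e , (λ v → reassoc (δ v a) (δ v b) (δ v c) (occ v (tripleVerts R))) ,
          (λ q′ → ≤-trans (+-monoˡ-≤ _ (𝟙≤1 (connects q′ t))) (≤-reflexive (+-comm 1 _))) , refl
        where
        reassoc : ∀ a b c r → a + (b + (c + r)) ≡ a + (b + (c + 0)) + r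
        reassoc a b c r = equate (a ∷ b ∷ c ∷ r ∷ []) λ a b c r → a :+ (b :+ (c :+ r)) :≡ a :+
            (b :+ (c :+ con 0)) :+ r
      go false e = let t′ , R′ , e′ , eq , h , len = takeTriple q R (subst (λ b → 0 < 𝟙 b + connections q R) e pos) in
        t′ , t ∷ R′ , e′ , (λ v → reassoc (δ v a) (δ v b) (δ v c) {_} {occ v (tripleVerts (t′ ∷ []))}
            {occ v (tripleVerts R′)} (eq v)) ,
            (λ q′ → ≤-trans (+-monoʳ-≤ (𝟙 (connects q′ t)) (h q′))
            (≤-reflexive (sym (+-assoc (𝟙 (connects q′ t)) _ 1)))) , cong suc len
        where
        reassoc : ∀ a b c {r s u} → r ≡ s + u → a + (b + (c + r)) ≡ s + (a + (b + (c + u)))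
        reassoc a b c {_} {s} {u} refl = equate (a ∷ b ∷ c ∷ s ∷ u ∷ []) λ a b c s u → a :+
            (b :+ (c :+ (s :+ u))) :≡ s :+ (a :+ (b :+ (c :+ u)))

    segsVerts : List Segment → List (Fin n)
    segsVerts [] = []
    segsVerts (s ∷ ss) = segVerts s ++ segsVerts ss

    -- One triple is spent per link, and each removal costs any pair at most one connection. The
    -- additional link returns to x.
    join : ∀ y (ss : List Segment) x (R : List Triple) → (∀ q → length ss + 1 ≤ connections q R) →
      Σ (List (Fin n)) λ l → Σ (List Triple) λ R′ → LP H y l x × length R ≡ length R′ + (length ss + 1) ×
        (∀ v → occ v l + occ v (tripleVerts R′) ≡ occ v (segsVerts ss) + δ v x + occ v (tripleVerts R))
    join y [] x R h =
      let (a , b , c) , R′ , link , eq , _ , len = takeTriple (y , x) R (h (y , x))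
      in a ∷ b ∷ c ∷ x ∷ [] , R′ , connector link , trans len (+-comm 1 _) , λ v →
        lemma (δ v a) (δ v b) (δ v c) (δ v x) (occ v (tripleVerts R′)) (eq v)
      where
      lemma : ∀ a b c x r {s} → s ≡ a + (b + (c + 0)) + r → a + (b + (c + (x + 0))) + r ≡ x + s
      lemma a b c x r refl = equate (a ∷ b ∷ c ∷ x ∷ r ∷ []) λ a b c x r → a :+ (b :+ (c :+ (x :+ con 0))) :+ r
          :≡ x :+ (a :+ (b :+ (c :+ con 0)) :+ r)
    join y (s ∷ ss) x R h =
      let (a , b , c) , R₁ , link , eq , h₁ , len = takeTriple (y , start s) R
              (≤-trans (s≤s z≤n) (h (y , start s)))
          l , R′ , p , len′ , eq′ = join (end s) ss x R₁
              (λ q → s≤s⁻¹ (≤-trans (h q) (≤-trans (h₁ q) (≤-reflexive (+-comm _ 1)))))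
      in (a ∷ b ∷ c ∷ start s ∷ []) ++ (inner s ++ l) , R′ , append H (connector link) (append H (path s) p)
       , trans len (trans (cong suc len′) (sym (+-suc (length R′) _)))
       , λ v → lemma (δ v a) (δ v b) (δ v c) (δ v (start s)) (occ v (inner s)) (occ v l)
           (occ v (tripleVerts R′)) (occ v (segsVerts ss)) (δ v x) (occ v (tripleVerts R₁))
           (occ-++ v (inner s) l) (occ-++ v (inner s) (segsVerts ss)) (eq v) (eq′ v)
      where
      lemma : ∀ a b c s i l r ss x r₁ {il iss R} → il ≡ i + l → iss ≡ i + ss → R ≡ a + (b + (c + 0)) + r₁ → l +
          r ≡ ss + x + r₁ →
        a + (b + (c + (s + il))) + r ≡ s + iss + x + R
      lemma a b c s i l r ss x r₁ refl refl refl h = ≤-antisym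
        (certify (a ∷ b ∷ c ∷ s ∷ i ∷ l ∷ r ∷ ss ∷ x ∷ r₁ ∷ [])
            (λ a b c s i l r ss x r₁ → con 1 ⊠ l :+ r :≤ ss :+ x :+ r₁ ∷ []
          ⊢ a :+ (b :+ (c :+ (s :+ (i :+ l)))) :+ r :≤ s :+ (i :+ ss) :+ x :+ (a :+ (b :+ (c :+ con 0)) :+ r₁))
              (≤-reflexive h))
        (certify (a ∷ b ∷ c ∷ s ∷ i ∷ l ∷ r ∷ ss ∷ x ∷ r₁ ∷ [])
            (λ a b c s i l r ss x r₁ → con 1 ⊠ ss :+ x :+ r₁ :≤ l :+ r ∷ []
          ⊢ s :+ (i :+ ss) :+ x :+ (a :+ (b :+ (c :+ con 0)) :+ r₁) :≤ a :+ (b :+ (c :+ (s :+ (i :+ l)))) :+ r)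
              (≤-reflexive (sym h)))

-- Selection by multiplicative weights

module Derandomisation where
  open Prelude
  open Certificates
  open Sums

  ^-distribʳ-* : ∀ k a b → (a * b) ^ k ≡ a ^ k * b ^ k
  ^-distribʳ-* zero    a b = refl
  ^-distribʳ-* (suc k) a b = trans (cong (a * b *_) (^-distribʳ-* k a b))
      ([m*n]*[o*p]≡[m*o]*[n*p] a b (a ^ k) (b ^ k))

  bernoulli : ∀ a k → a ^ k * (a + k) ≤ a * (a + 1) ^ k
  bernoulli a zero    = certify (a ∷ []) λ a → [] ⊢ con 1 :* (a :+ con 0) :≤ a :* con 1
  bernoulli a (suc k) = certify (a ∷ k ∷ a ^ k ∷ (a + 1) ^ k ∷ [])
      (λ a k p q → a :+ con 1 ⊠ p :* (a :+ k) :≤ a :* q ∷ []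
    ⊢ a :* p :* (a :+ (con 1 :+ k)) :≤ a :* ((a :+ con 1) :* q)) (bernoulli a k)

  -- Bernoulli's inequality for (1 + 1/a)^(a + 1).
  power-gap : ∀ a → 0 < a → 2 * a ^ (a + 1) ≤ (a + 1) ^ (a + 1)
  power-gap a a>0 = *-cancelˡ-≤ a {{>-nonZero a>0}}
      (certify (a ∷ a ^ (a + 1) ∷ (a + 1) ^ (a + 1) ∷ []) (λ a p q →
    con 1 ⊠ p :* (a :+ (a :+ con 1)) :≤ a :* q ∷ [] ⊢ a :* (con 2 :* p) :≤ a :* q) (bernoulli a (a + 1)))

  power-gaps : ∀ a j → 0 < a → 2 ^ j * a ^ ((a + 1) * j) ≤ (a + 1) ^ ((a + 1) * j)
  power-gaps a j a>0 = begin
    2 ^ j * a ^ ((a + 1) * j)       ≡⟨ cong (2 ^ j *_) (^-*-assoc a (a + 1) j) ⟨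
    2 ^ j * (a ^ (a + 1)) ^ j       ≡⟨ ^-distribʳ-* j 2 (a ^ (a + 1)) ⟨
    (2 * a ^ (a + 1)) ^ j           ≤⟨ ^-monoˡ-≤ j (power-gap a a>0) ⟩
    ((a + 1) ^ (a + 1)) ^ j         ≡⟨ ^-*-assoc (a + 1) (a + 1) j ⟩
    (a + 1) ^ ((a + 1) * j) ∎
    where open ≤-Reasoning

  -- Derandomised selection: an index that is not hit doubles its weight, so choosing in every round
  -- an object that hits a 1/C fraction of the total weight makes the total grow by at most 2 - 1/C per
  -- round, and an index that is rarely hit would exceed the total.
  module Selection {A : Set} (I : List A) (I>0 : 0 < length I) (St : ℕ → Set) (hit : ∀ t → St t → A → ℕ)
      (c T : ℕ)
    (next : ∀ t → t < T → (s : St t) (ω : A → ℕ) → 0 < ∑ I ω → Σ (St (suc t)) λ s′ → Σ (A → Bool) λ b →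
      (∀ i → hit t s i + 𝟙 (b i) ≤ hit (suc t) s′ i) × ∑ I ω ≤ suc c * ∑ I (λ i → ω i * 𝟙 (b i))) where

    private
      a : ℕ
      a = c + suc c

      Weighted : ∀ t → St t → Set
      Weighted t s = Σ (A → ℕ) λ ω → (∀ i → 2 ^ t ≤ ω i * 2 ^ hit t s i) × suc c ^ t * ∑ I ω ≤ a ^ t * length I

      positive : ∀ t s → ((ω , _) : Weighted t s) → 0 < ∑ I ω
      positive t s (ω , big , _) = go I I>0
        where
        pos : ∀ i → 0 < ω i
        pos i with ω i | big i
        ... | zero  | h = ⊥-elim (<⇒≱ (m^n>0 2 t) h)
        ... | suc _ | _ = s≤s z≤n
        go : ∀ l → 0 < length l → 0 < ∑ l ω
        go (i ∷ l) _ = ≤-trans (pos i) (m≤m+n (ω i) _)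

      growth : ∀ C Σω Σω′ Σb p q N → Σω ≤ suc C * Σb → Σω′ + Σb ≡ Σω + Σω → p * Σω ≤ q * N →
        suc C * p * Σω′ ≤ (C + suc C) * q * N
      growth C Σω Σω′ Σb p q N h₁ h₂ h₃ = certify (C ∷ Σω ∷ Σω′ ∷ Σb ∷ p ∷ q ∷ N ∷ []) (λ C w w′ b p q N →
        p ⊠ w :≤ (con 1 :+ C) :* b ∷ (con 1 :+ C) :* p ⊠ w′ :+ b :≤ w :+ w ∷ C :+ (con 1 :+ C) ⊠ p :* w :≤ q :*
            N ∷ []
        ⊢ (con 1 :+ C) :* p :* w′ :≤ (C :+ (con 1 :+ C)) :* q :* N) h₁ (≤-reflexive h₂) h₃

      run : ∀ t → t ≤ T → St 0 → Σ (St t) (Weighted t)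
      run zero    _ s₀ = s₀ , (λ _ → 1) , (λ i → ≤-trans (m^n>0 2 (hit 0 s₀ i)) (m≤m+n _ 0)) ,
        ≤-reflexive (cong (_+ 0) (trans (∑-const I 1) (*-identityʳ _)))
      run (suc t) le s₀ =
        let s , W = run t (<⇒≤ le) s₀
            ω , big , total = W
            s′ , b , more , dense = next t le s ω (positive t s W)
            ω′ : A → ℕ
            ω′ i = ω i + ω i * 𝟙 (not (b i))
        in s′ , ω′ , (λ i → ≤-trans (double (b i) (ω i) (2 ^ t) (hit t s i) (big i))
            (*-monoʳ-≤ (ω′ i) (^-monoʳ-≤ 2 (more i))))
         , growth c (∑ I ω) (∑ I ω′) (∑ I (λ i → ω i * 𝟙 (b i))) (suc c ^ t) (a ^ t) (length I) dense
             (conserve ω b) total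
        where
        double : ∀ b w p h → p ≤ w * 2 ^ h → 2 * p ≤ (w + w * 𝟙 (not b)) * 2 ^ (h + 𝟙 b)
        double true  w p h le rewrite +-comm h 1 = certify (w ∷ p ∷ 2 ^ h ∷ [])
            (λ w p h → con 2 ⊠ p :≤ w :* h ∷ []
          ⊢ con 2 :* p :≤ (w :+ w :* con 0) :* (con 2 :* h)) le
        double false w p h le rewrite +-identityʳ h = certify (w ∷ p ∷ 2 ^ h ∷ [])
            (λ w p h → con 2 ⊠ p :≤ w :* h ∷ []
          ⊢ con 2 :* p :≤ (w :+ w :* con 1) :* h) le
        conserve : ∀ ω b → ∑ I (λ i → ω i + ω i * 𝟙 (not (b i))) + ∑ I (λ i → ω i * 𝟙 (b i)) ≡ ∑ I ω + ∑ I ω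
        conserve ω b = trans (sym (∑-+ I (λ i → ω i + ω i * 𝟙 (not (b i))) (λ i → ω i * 𝟙 (b i))))
            (trans (∑-cong I (λ i → split (ω i) (b i))) (∑-+ I ω ω))
          where
          split : ∀ w b → w + w * 𝟙 (not b) + w * 𝟙 b ≡ w + w
          split w true  rewrite *-zeroʳ w | *-identityʳ w | +-identityʳ w = refl
          split w false rewrite *-zeroʳ w | *-identityʳ w | +-identityʳ (w + w) = refl

    abstract
      -- With a = 2c + 1 and J = a + 1 the final weights give 2^T ≤ (2a/J)^T · |I| · 2^hit. Since
      -- (J/a)^T ≥ 2^(2q) for T = 2qJ and |I| ≤ 2^q, the exponent hit is at least q.
      select : ∀ q → T ≡ (c + suc c + 1) * (q + q) → length I ≤ 2 ^ q → St 0 → Σ (St T) λ s → ∀ i → i ∈ I → q ≤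
          hit T s i
      select q T≡ small s₀ =
        let s , ω , big , total = run T ≤-refl s₀
        in s , λ i m → ≮⇒≥ λ lt → <⇒≱ (^-monoʳ-< 2 (s≤s (s≤s z≤n)) (+-monoʳ-< q lt))
            (contradiction′ s ω big total i m)
        where
        J : ℕ
        J = c + suc c + 1
        a>0 : 0 < a
        a>0 = ≤-trans (s≤s z≤n) (m≤n+m (suc c) c)
        contradiction′ : ∀ (s : St T) (ω : A → ℕ) → (∀ i → 2 ^ T ≤ ω i * 2 ^ hit T s i) → suc c ^ T * ∑ I ω ≤ a
            ^ T * length I → ∀ i → i ∈ I → 2 ^ (q + q) ≤ 2 ^ (q + hit T s i)
        contradiction′ s ω big total i m = *-cancelʳ-≤ _ _ (a ^ T) {{>-nonZero (m^n>0 a {{>-nonZero a>0}} T)}}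
            (begin
          2 ^ (q + q) * a ^ T                         ≡⟨ cong (λ z → 2 ^ (q + q) * a ^ z) T≡ ⟩
          2 ^ (q + q) * a ^ (J * (q + q))             ≤⟨ power-gaps a (q + q) a>0 ⟩
          J ^ (J * (q + q))                           ≡⟨ cong₂ _^_ J≡ (sym T≡) ⟩
          (suc c * 2) ^ T                             ≡⟨ ^-distribʳ-* T (suc c) 2 ⟩
          suc c ^ T * 2 ^ T                           ≤⟨ *-monoʳ-≤ (suc c ^ T)
              (≤-trans (big i) (*-monoˡ-≤ (2 ^ hit T s i) (∈-≤-∑ I ω m))) ⟩
          suc c ^ T * (∑ I ω * 2 ^ hit T s i)           ≡⟨ *-assoc (suc c ^ T) _ _ ⟨
          suc c ^ T * ∑ I ω * 2 ^ hit T s i             ≤⟨ *-monoˡ-≤ (2 ^ hit T s i)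
              (≤-trans total (*-monoʳ-≤ (a ^ T) small)) ⟩
          a ^ T * 2 ^ q * 2 ^ hit T s i                 ≡⟨ trans (*-assoc (a ^ T) _ _)
              (trans (cong (a ^ T *_) (sym (^-distribˡ-+-* 2 q (hit T s i)))) (*-comm (a ^ T) _)) ⟩
          2 ^ (q + hit T s i) * a ^ T ∎)
          where
          open ≤-Reasoning
          J≡ : J ≡ suc c * 2
          J≡ = equate (c ∷ []) λ c → c :+ (con 1 :+ c) :+ con 1 :≡ (con 1 :+ c) :* con 2

  square≤2^ : ∀ k → k * k ≤ 2 ^ (k + 1)
  square≤2^ 0 = z≤n
  square≤2^ 1 = s≤s z≤n
  square≤2^ 2 = ≤ᵇ⇒≤ 4 8 tt
  square≤2^ 3 = ≤ᵇ⇒≤ 9 16 tt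
  square≤2^ (suc (suc (suc (suc k)))) = certify (k ∷ 2 ^ (k + 1) ∷ []) (λ k p →
    con 2 ⊠ (con 3 :+ k) :* (con 3 :+ k) :≤ con 2 :* (con 2 :* (con 2 :* p)) ∷ []
    ⊢ (con 4 :+ k) :* (con 4 :+ k) :≤ con 2 :* (con 2 :* (con 2 :* (con 2 :* p))))
        (square≤2^ (suc (suc (suc k))))

-- Exchanges and connections counted in links

module Links where
  open Prelude
  open Certificates
  open Sums
  open Multiplicities
  open FractionalCover
  open Duality

  -- Counts triangles in a graph with e edges by the Kruskal–Katona bound e^{3/2}, in the linearised form
  -- "every vertex of degree d lies in at most (28/37) n d ordered triangles".
  triangle-vertex : ∀ n e d t → t ≤ d * d → t ≤ e → e * 1369 ≤ n * n * 784 → t * 37 ≤ n * d * 28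
  triangle-vertex n e d t h₁ h₂ h₃ = go (≤-total (d * 37) (n * 28))
    where
    go : d * 37 ≤ n * 28 ⊎ n * 28 ≤ d * 37 → t * 37 ≤ n * d * 28
    go (inj₁ le) = certify (n ∷ d ∷ t ∷ [])
        (λ n d t → con 37 ⊠ t :≤ d :* d ∷ d ⊠ d :* con 37 :≤ n :* con 28 ∷ []
      ⊢ t :* con 37 :≤ n :* d :* con 28) h₁ le
    go (inj₂ le) = *-cancelˡ-≤ 37 (certify (n ∷ e ∷ d ∷ t ∷ [])
        (λ n e d t → con 1369 ⊠ t :≤ e ∷ con 1 ⊠ e :* con 1369 :≤ n :* n :* con 784 ∷ con 28 :* n ⊠ n :* con 28
        :≤ d :* con 37 ∷ []
      ⊢ con 37 :* (t :* con 37) :≤ con 37 :* (n :* d :* con 28)) h₂ h₃ le)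

  -- (28/37)³ is about 0.4334 and 7/16 = 0.4375. A third of the difference, less the error 1/(16K),
  -- still exceeds 1/1000.
  kruskal-katona-count : ∀ n K N t E e → 1000 ≤ K → K * 7 * (n * n * n) ≤ K * 16 * E + n * n * n → E ≤ N + N + N
      + t →
    t * 37 ≤ n * 28 * e → e * 1369 ≤ n * n * 784 → n * n * n ≤ N * 1000
  kruskal-katona-count n K N t E e big h₁ h₂ h₃ h₄ = *-cancelˡ-≤ K {{>-nonZero (≤-trans (s≤s z≤n) big)}}
      (*-cancelˡ-≤ 2432 (certify (n ∷ K ∷ N ∷ t ∷ E ∷ e ∷ []) (λ n K N t E e →
    let n³ = n :* n :* n in
    con 50653 ⊠ K :* con 7 :* n³ :≤ K :* con 16 :* E :+ n³ ∷ K :* con 810448 ⊠ E :≤ N :+ N :+ N :+ t ∷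
    K :* con 21904 ⊠ t :* con 37 :≤ n :* con 28 :* e ∷ K :* n :* con 448 ⊠ e :* con 1369 :≤ n :* n :* con 784 ∷
        n³ :* con 51 ⊠ con 1000 :≤ K ∷ []
    ⊢ con 2432 :* (K :* n³) :≤ con 2432 :* (K :* (N :* con 1000))) h₁ h₂ h₃ h₄ big))

  rich-arith : ∀ n s d w K → 1000 ≤ K → K * 7 * (n * n) ≤ K * 16 * d + n * n → d ≤ s * s + (w + w) → w * 100 ≤ n
      * n → n * 3 ≤ s * 5
  rich-arith zero s d w K big h₁ h₂ h₃ = z≤n
  rich-arith n@(suc _) s d w K big h₁ h₂ h₃ = ≮⇒≥ λ lt → <⇒≱ (s≤s z≤n)
      (*-cancelˡ-≤ K {{>-nonZero (≤-trans (s≤s z≤n) big)}} (certify (n ∷ s ∷ d ∷ w ∷ K ∷ []) (λ n s d w K →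
    con 25 ⊠ K :* con 7 :* (n :* n) :≤ K :* con 16 :* d :+ n :* n ∷ K :* con 400 ⊠ d :≤ s :* s :+ (w :+ w) ∷ K
        :* con 8 ⊠ w :* con 100 :≤ n :* n ∷
    K :* con 80 :* s ⊠ s :* con 5 :≤ n :* con 3 ∷ K :* con 48 :* n ⊠ s :* con 5 :≤ n :* con 3 ∷ n :* n ⊠ con
        1000 :≤ K ∷ []
    ⊢ K :* (n :* n) :≤ K :* con 0) h₁ h₂ h₃ (<⇒≤ lt) (<⇒≤ lt) big))

  module _ {n : ℕ} (H : Hypergraph3 n) (K : ℕ) (big : 1000 ≤ K) (deg : MinDegree H K) where

    private
      edge-rot : ∀ a b c → edge H a b c ≡ edge H b c a
      edge-rot a b c = trans (sym₁₂ H a b c) (sym₂₃ H b a c)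

      all-edges : K * 7 * (n * n * n) ≤ K * 16 * ∑ V (D H) + n * n * n
      all-edges = begin
        K * 7 * (n * n * n)                         ≡⟨ trans (cong (K * 7 *_) (*-comm (n * n) n))
            (*-swap (K * 7) n (n * n)) ⟩
        n * (K * 7 * (n * n))                       ≡⟨ ∑-Fin-const n (K * 7 * (n * n)) ⟨
        ∑ (V {n}) (λ _ → K * 7 * (n * n))                 ≤⟨ ∑-mono (V {n}) deg ⟩
        ∑ V (λ v → K * 16 * D H v + n * n)          ≡⟨ trans (∑-+ (V {n}) (λ v → K * 16 * D H v) (λ _ → n * n))
            (cong₂ _+_ (∑-*ˡ (V {n}) (K * 16) (D H)) (trans (∑-Fin-const n (n * n)) (*-comm n (n * n)))) ⟩
        K * 16 * ∑ V (D H) + n * n * n ∎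
        where open ≤-Reasoning

    module _ (x : Fin n) where

      private
        G : Fin n → Fin n → ℕ
        G p q = 𝟙 (not (edge H x p q))

        f : Fin n → Fin n → Fin n → ℕ
        f p q r = E H x p q * E H p q r

        dG : Fin n → ℕ
        dG p = ∑ V (G p)

        eG : ℕ
        eG = ∑² G

        tri : Fin n → ℕ
        tri p = ∑² (λ q r → G p q * G p r * G q r)

        split : eG + D H x ≡ n * n
        split = trans (sym (∑²-+ G (E H x)))
            (trans (∑-cong (V {n}) (λ a → ∑-cong (V {n}) (λ b → 𝟙-not (edge H x a b))))
            (trans (∑²-fst {n} (λ _ → 1)) (cong (n *_) (∑-one {n}))))

        -- 784/1369 = (28/37)² lies slightly above 9/16, which leaves room for the error in the
        -- degree, and it has a rational root.
        eG-small : eG * 1369 ≤ n * n * 784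
        eG-small = lemma n eG (D H x) K big (deg x) split
          where
          lemma : ∀ n e d K → 1000 ≤ K → K * 7 * (n * n) ≤ K * 16 * d + n * n → e + d ≡ n * n → e * 1369 ≤ n * n
              * 784
          lemma n e d K big h s = *-cancelˡ-≤ K {{>-nonZero (≤-trans (s≤s z≤n) big)}}
              (*-cancelˡ-≤ 16 (certify (n ∷ e ∷ d ∷ K ∷ []) (λ n e d K →
            con 1369 ⊠ K :* con 7 :* (n :* n) :≤ K :* con 16 :* d :+ n :* n ∷ K :* con 21904 ⊠ e :+ d :≤ n :* n
                ∷ con 2 :* (n :* n) ⊠ con 1000 :≤ K ∷ []
            ⊢ con 16 :* (K :* (e :* con 1369)) :≤ con 16 :* (K :* (n :* n :* con 784))) h (≤-reflexive s) big))

        tri≤ : ∀ p → tri p * 37 ≤ n * dG p * 28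
        tri≤ p = triangle-vertex n eG (dG p) (tri p)
          (≤-trans (∑²-mono (λ q r → ≤-trans (*-monoʳ-≤ (G p q * G p r) (𝟙≤1 (not (edge H x q r))))
              (≤-reflexive (*-identityʳ _)))) (≤-reflexive (∑²-* (G p) (G p))))
          (∑²-mono (λ q r → ≤-trans (*-monoˡ-≤ (G q r)
              (*-mono-≤ (𝟙≤1 (not (edge H x p q))) (𝟙≤1 (not (edge H x p r))))) (≤-reflexive (+-identityʳ _))))
          eG-small

        tri-total : ∑ V tri * 37 ≤ n * 28 * eG
        tri-total = begin
          ∑ V tri * 37                 ≡⟨ ∑-*ʳ (V {n}) tri 37 ⟨
          ∑ V (λ p → tri p * 37)       ≤⟨ ∑-mono (V {n}) tri≤ ⟩
          ∑ V (λ p → n * dG p * 28)    ≡⟨ ∑-cong (V {n})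
              (λ p → trans (*-assoc n (dG p) 28)
              (trans (cong (n *_) (*-comm (dG p) 28)) (sym (*-assoc n 28 (dG p))))) ⟩
          ∑ V (λ p → n * 28 * dG p)    ≡⟨ ∑-*ˡ (V {n}) (n * 28) dG ⟩
          n * 28 * eG ∎
          where open ≤-Reasoning

        N : ℕ
        N = ∑³ f

        -- An edge pqr either has one of its three pairs in the link of x or is a triangle of the
        -- complement.
        classified : ∑ V (D H) ≤ N + N + N + ∑ V tri
        classified = ≤-trans (∑³-mono pt)
            (≤-reflexive (trans (∑³-+ (λ p q r → f p q r + f p r q + f q r p) (λ p q r → G p q * G p r * G q r))
          (cong (_+ ∑ V tri) (trans (∑³-+ (λ p q r → f p q r + f p r q) (λ p q r → f q r p))
              (cong₂ _+_ (trans (∑³-+ f (λ p q r → f p r q))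
              (cong (N +_) (∑-cong (V {n}) (λ p → ∑-swap (V {n}) (V {n}) (λ q r → f p r q)))))
            (trans (∑-swap (V {n}) (V {n}) (λ p q → ∑ V (λ r → f q r p)))
                (∑-cong (V {n}) (λ q → ∑-swap (V {n}) (V {n}) (λ p r → f q r p)))))))))
          where
          pt : ∀ p q r → E H p q r ≤ f p q r + f p r q + f q r p + G p q * G p r * G q r
          pt p q r rewrite sym (sym₂₃ H p q r) | sym (edge-rot p q r) = bool (edge H x p q) (edge H x p r)
              (edge H x q r) (edge H p q r)
            where
            bool : ∀ a b c e → 𝟙 e ≤ 𝟙 a * 𝟙 e + 𝟙 b * 𝟙 e + 𝟙 c * 𝟙 e + 𝟙 (not a) * 𝟙 (not b) * 𝟙 (not c)
            bool a b c false = z≤n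
            bool true b c true = s≤s z≤n
            bool false true c true = s≤s z≤n
            bool false false true true = s≤s z≤n
            bool false false false true = s≤s z≤n

      -- Triples (p, q, r) along which x can be exchanged for r in the path p r q.
      exchange-count : n * n * n ≤ ∑³ (λ p q r → E H x p q * E H p q r) * 1000
      exchange-count = kruskal-katona-count n K N (∑ V tri) (∑ V (D H)) eG big all-edges classified tri-total
          eG-small

      codeg : Fin n → ℕ
      codeg b = ∑ V (λ a → E H x a b)

      rich : Fin n → Bool
      rich b = does (n ≤? codeg b * 100)

      private
        poor : ∑ V (λ b → 𝟙 (not (rich b)) * codeg b) * 100 ≤ n * n
        poor = begin
          ∑ V (λ b → 𝟙 (not (rich b)) * codeg b) * 100     ≡⟨ ∑-*ʳ (V {n}) (λ b → 𝟙 (not (rich b)) * codeg b)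
              100 ⟨
          ∑ V (λ b → 𝟙 (not (rich b)) * codeg b * 100)     ≤⟨ ∑-mono (V {n}) pt ⟩
          ∑ (V {n}) (λ _ → n)                                    ≡⟨ ∑-Fin-const n n ⟩
          n * n ∎
          where
          open ≤-Reasoning
          pt : ∀ b → 𝟙 (not (rich b)) * codeg b * 100 ≤ n
          pt b = bool (n ≤? codeg b * 100)
            where
            bool : (d : Dec (n ≤ codeg b * 100)) → 𝟙 (not (does d)) * codeg b * 100 ≤ n
            bool (yes _) = z≤n
            bool (no ¬p) rewrite +-identityʳ (codeg b) = <⇒≤ (≰⇒> ¬p)

        link-rich : D H x ≤ count rich * count rich +
            (∑ V (λ b → 𝟙 (not (rich b)) * codeg b) + ∑ V (λ b → 𝟙 (not (rich b)) * codeg b))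
        link-rich = ≤-trans (∑²-mono pt)
            (≤-reflexive (trans (∑²-+ (λ a b → 𝟙 (rich a) * 𝟙 (rich b))
            (λ a b → 𝟙 (not (rich a)) * E H x a b + 𝟙 (not (rich b)) * E H x a b))
          (cong₂ _+_ (∑²-* (λ a → 𝟙 (rich a)) (λ b → 𝟙 (rich b)))
              (trans (∑²-+ (λ a b → 𝟙 (not (rich a)) * E H x a b) (λ a b → 𝟙 (not (rich b)) * E H x a b))
              (cong₂ _+_
            (∑-cong (V {n}) (λ a → trans (∑-*ˡ (V {n}) (𝟙 (not (rich a))) (E H x a))
                (cong (𝟙 (not (rich a)) *_) (∑-cong (V {n}) (λ b → cong 𝟙 (sym₂₃ H x a b))))))
            (trans (∑-swap (V {n}) (V {n}) (λ a b → 𝟙 (not (rich b)) * E H x a b))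
                (∑-cong (V {n}) (λ b → ∑-*ˡ (V {n}) (𝟙 (not (rich b))) (λ a → E H x a b)))))))))
          where
          pt : ∀ a b → E H x a b ≤ 𝟙 (rich a) * 𝟙 (rich b) +
              (𝟙 (not (rich a)) * E H x a b + 𝟙 (not (rich b)) * E H x a b)
          pt a b = bool (rich a) (rich b) (edge H x a b)
            where
            bool : ∀ a b e → 𝟙 e ≤ 𝟙 a * 𝟙 b + (𝟙 (not a) * 𝟙 e + 𝟙 (not b) * 𝟙 e)
            bool a b false = z≤n
            bool true true true = s≤s z≤n
            bool true false true = s≤s z≤n
            bool false b true = s≤s z≤n

      -- A link pair with a poor end is one of at most 2n²/100, so the rich vertices number nearly
      -- √(7/16)·n, about 0.65n. What matters is that 3/5 exceeds 1/2.
      rich-many : n * 3 ≤ count rich * 5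
      rich-many = rich-arith n (count rich) (D H x) (∑ V (λ b → 𝟙 (not (rich b)) * codeg b)) K big (deg x)
          link-rich poor

    -- At least n/5 vertices b are rich for both x and y, and each has at least n/100 choices on
    -- either side: 5 · 100² = 50000.
    connect-count : ∀ x y → n * n * n ≤ ∑³ (λ a b c → E H x a b * E H b c y) * 50000
    connect-count x y = lemma n (∑ V (λ b → 𝟙 (rich x b) * 𝟙 (rich y b))) (count (rich x)) (count (rich y))
        (∑ V (λ b → codeg x b * codeg y b))
        (∑³ (λ a b c → E H x a b * E H b c y)) (rich-many x) (rich-many y) both weighted paths
      where
      lemma : ∀ n i s t w N → n * 3 ≤ s * 5 → n * 3 ≤ t * 5 → s + t ≤ i + n → n * n * i ≤ w * 10000 → w ≡ N → n
          * n * n ≤ N * 50000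
      lemma n i s t w .w h₁ h₂ h₃ h₄ refl = certify (n ∷ i ∷ s ∷ t ∷ w ∷ []) (λ n i s t w →
        n :* n ⊠ n :* con 3 :≤ s :* con 5 ∷ n :* n ⊠ n :* con 3 :≤ t :* con 5 ∷ n :* n :* con 5 ⊠ s :+ t :≤ i :+
            n ∷ con 5 ⊠ n :* n :* i :≤ w :* con 10000 ∷ []
        ⊢ n :* n :* n :≤ w :* con 50000) h₁ h₂ h₃ h₄
      both : count (rich x) + count (rich y) ≤ ∑ V (λ b → 𝟙 (rich x b) * 𝟙 (rich y b)) + n
      both = ≤-trans (≤-reflexive (sym (∑-+ (V {n}) (λ b → 𝟙 (rich x b)) (λ b → 𝟙 (rich y b)))))
          (≤-trans (∑-mono (V {n}) (λ b → bool (rich x b) (rich y b)))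
        (≤-reflexive (trans (∑-+ (V {n}) (λ b → 𝟙 (rich x b) * 𝟙 (rich y b)) (λ _ → 1))
            (cong (∑ V (λ b → 𝟙 (rich x b) * 𝟙 (rich y b)) +_) ∑-one))))
        where
        bool : ∀ a b → 𝟙 a + 𝟙 b ≤ 𝟙 a * 𝟙 b + 1
        bool true true = s≤s (s≤s z≤n)
        bool true false = s≤s z≤n
        bool false true = s≤s z≤n
        bool false false = z≤n
      weighted : n * n * ∑ V (λ b → 𝟙 (rich x b) * 𝟙 (rich y b)) ≤ ∑ V (λ b → codeg x b * codeg y b) * 10000
      weighted = ≤-trans (≤-reflexive (sym (∑-*ˡ (V {n}) (n * n) (λ b → 𝟙 (rich x b) * 𝟙 (rich y b)))))
          (≤-trans (∑-mono (V {n}) pt) (≤-reflexive (∑-*ʳ (V {n}) (λ b → codeg x b * codeg y b) 10000)))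
        where
        pt : ∀ b → n * n * (𝟙 (rich x b) * 𝟙 (rich y b)) ≤ codeg x b * codeg y b * 10000
        pt b = bool (n ≤? codeg x b * 100) (n ≤? codeg y b * 100)
          where
          bool : (d : Dec (n ≤ codeg x b * 100)) (d′ : Dec (n ≤ codeg y b * 100)) → n * n *
              (𝟙 (does d) * 𝟙 (does d′)) ≤ codeg x b * codeg y b * 10000
          bool (no _) d′ rewrite *-zeroʳ (n * n) = z≤n
          bool (yes _) (no _) rewrite *-zeroʳ (n * n) = z≤n
          bool (yes p) (yes q) = certify (n ∷ codeg x b ∷ codeg y b ∷ [])
              (λ n a c → n ⊠ n :≤ a :* con 100 ∷ a :* con 100 ⊠ n :≤ c :* con 100 ∷ []
            ⊢ n :* n :* con 1 :≤ a :* c :* con 10000) p q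
      paths : ∑ V (λ b → codeg x b * codeg y b) ≡ ∑³ (λ a b c → E H x a b * E H b c y)
      paths = sym (trans (∑-cong (V {n})
          (λ a → ∑-cong (V {n}) (λ b → ∑-*ˡ (V {n}) (E H x a b) (λ c → E H b c y))))
        (trans (∑-swap (V {n}) (V {n}) (λ a b → E H x a b * ∑ V (λ c → E H b c y)))
          (∑-cong (V {n}) (λ b → trans (∑-*ʳ (V {n}) (λ a → E H x a b) (∑ V (λ c → E H b c y)))
            (cong (codeg x b *_) (∑-cong (V {n})
                (λ c → cong 𝟙 (trans (sym₁₂ H b c y) (trans (sym₂₃ H c b y) (sym₁₂ H c y b))))))))))

-- Absorbers as blow-ups of a nine-vertex template

module Absorbers where
  open Prelude
  open Certificates
  open Sums
  open Multiplicities
  open BlowUp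
  open FractionalCover
  open Duality
  open TilingRound using (∑-allVec₃; ∈∈₃)
  open Paths
  open Links

  module _ {n : ℕ} where

    ∑-allVec-3+ : ∀ k (f : Vec (Fin n) (3 + k) → ℕ) → ∑ (allVec (3 + k)) f ≡ ∑³
        (λ a b c → ∑ (allVec k) (λ v → f (a ∷ b ∷ c ∷ v)))
    ∑-allVec-3+ k f = trans (∑-allVec (2 + k) f)
        (∑-cong (V {n}) (λ a → trans (∑-allVec (1 + k) (λ v → f (a ∷ v)))
        (∑-cong (V {n}) (λ b → ∑-allVec k (λ v → f (a ∷ b ∷ v))))))

    ∑³-cong : ∀ {f g : Fin n → Fin n → Fin n → ℕ} → (∀ a b c → f a b c ≡ g a b c) → ∑³ f ≡ ∑³ g
    ∑³-cong h = ∑-cong (V {n}) (λ a → ∑-cong (V {n}) (λ b → ∑-cong (V {n}) (h a b)))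

    ∑³-*ˡ : ∀ c (f : Fin n → Fin n → Fin n → ℕ) → ∑³ (λ x y z → c * f x y z) ≡ c * ∑³ f
    ∑³-*ˡ c f = trans (∑-cong (V {n})
        (λ x → trans (∑-cong (V {n}) (λ y → ∑-*ˡ (V {n}) c (f x y))) (∑-*ˡ (V {n}) c (λ y → ∑ V (f x y)))))
        (∑-*ˡ (V {n}) c (λ x → ∑² (f x)))

    ∑³-*ʳ : ∀ (f : Fin n → Fin n → Fin n → ℕ) c → ∑³ (λ x y z → f x y z * c) ≡ ∑³ f * c
    ∑³-*ʳ f c = trans (∑-cong (V {n})
        (λ x → trans (∑-cong (V {n}) (λ y → ∑-*ʳ (V {n}) (f x y) c)) (∑-*ʳ (V {n}) (λ y → ∑ V (f x y)) c)))
        (∑-*ʳ (V {n}) (λ x → ∑² (f x)) c)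

  weighted-dense : ∀ {A : Set} (I : List A) (ω cnt : A → ℕ) N C → (∀ i → N ≤ cnt i * C) → N * ∑ I ω ≤ C * ∑ I
      (λ i → ω i * cnt i)
  weighted-dense I ω cnt N C h = begin
    N * ∑ I ω                      ≡⟨ ∑-*ˡ I N ω ⟨
    ∑ I (λ i → N * ω i)            ≤⟨ ∑-mono I
        (λ i → certify (N ∷ ω i ∷ cnt i ∷ C ∷ []) (λ N w c C → w ⊠ N :≤ c :* C ∷ [] ⊢ N :* w :≤ C :* (w :* c))
        (h i)) ⟩
    ∑ I (λ i → C * (ω i * cnt i))  ≡⟨ ∑-*ˡ I C (λ i → ω i * cnt i) ⟩
    C * ∑ I (λ i → ω i * cnt i) ∎
    where open ≤-Reasoning

  𝟙-mono : ∀ {a b} → (a ≡ true → b ≡ true) → 𝟙 a ≤ 𝟙 b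
  𝟙-mono {false} h = z≤n
  𝟙-mono {true} h rewrite h refl = ≤-refl

  -- Connectors need single vertices. Templates need three copies of each vertex, because an
  -- absorber uses three copies of r and b; their density constant is 1000 · 1000 · 50000, for two
  -- exchanges and one connection.
  connectSize connectLoss templateSize templateLoss : ℕ
  connectSize  = blowSize 1 3 50000
  connectLoss  = blowDensity 1 3 50000
  templateSize = blowSize 3 9 50000000000
  templateLoss = blowDensity 3 9 50000000000

  module _ {n : ℕ} (H : Hypergraph3 n) (K : ℕ) (big : 1000 ≤ K) (deg : MinDegree H K) (n>0 : 0 < n) where

    private
      ρ : Pair H → Vec (Fin n) 3 → Bool
      ρ q (a ∷ b ∷ c ∷ []) = connects H q (a , b , c)

      ρ-count : ∀ q → n ^ 3 ≤ ∑ (allVec 3) (λ v → 𝟙 (ρ q v)) * 50000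
      ρ-count q@(x , y) = ≤-trans (certify (n ∷ []) λ n → [] ⊢ n :* (n :* (n :* con 1)) :≤ n :* n :* n)
          (≤-trans (connect-count H K big deg x y)
        (≤-reflexive (cong (_* 50000) (sym
            (trans (∑-allVec₃ (λ v → 𝟙 (ρ q v))) (∑³-cong (λ a b c → 𝟙-∧ (edge H x a b) (edge H b c y))))))))

    abstract
      pickTriple : (I : List (Pair H)) (ω : Pair H → ℕ) (F : List (Fin n)) → Uniq F → (length F + 3) *
          connectSize ≤ n → 0 < ∑ I ω →
        Σ (Triple H) λ t → (∀ v → occ v (tripleVerts H (t ∷ [])) + occ v F ≤ 1) × ∑ I ω ≤ connectLoss * ∑ I
            (λ q → ω q * 𝟙 (connects H q t))
      pickTriple I ω F u size pos = finish
          (blow 3 1 50000 I ω ρ F n>0 u size pos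
          (weighted-dense I ω (λ q → ∑ (allVec 3) (λ v → 𝟙 (ρ q v))) (n ^ 3) 50000 ρ-count))
        where
        finish : (Σ (Vec (List (Fin n)) 3) λ L → AllV (λ l → length l ≡ 1) L ×
            (∀ v → occ v (flat L) + occ v F ≤ 1) ×
          ∑ I ω ≤ connectLoss * ∑ I (λ i → ω i * 𝟙 (good 3 (ρ i) L))) →
          Σ (Triple H) λ t → (∀ v → occ v (tripleVerts H (t ∷ [])) + occ v F ≤ 1) × ∑ I ω ≤ connectLoss * ∑ I
              (λ q → ω q * 𝟙 (connects H q t))
        finish (((a ∷ []) ∷ (b ∷ []) ∷ (c ∷ []) ∷ []) , _ , fresh , bound) = (a , b , c) , fresh ,
          ≤-trans bound (*-monoʳ-≤ connectLoss
              (∑-mono I (λ i → *-monoʳ-≤ (ω i)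
              (𝟙-mono λ g → good-∈ 3 (ρ i) {(a ∷ []) ∷ (b ∷ []) ∷ (c ∷ []) ∷ []} g
              (∈∈₃ (here refl) (here refl) (here refl))))))
        finish (([] ∷ _) , (() ∷ _) , _)
        finish (((_ ∷ _ ∷ _) ∷ _) , (() ∷ _) , _)
        finish ((_ ∷ [] ∷ _) , (_ ∷ () ∷ _) , _)
        finish ((_ ∷ (_ ∷ _ ∷ _) ∷ _) , (_ ∷ () ∷ _) , _)
        finish ((_ ∷ _ ∷ [] ∷ _) , (_ ∷ _ ∷ () ∷ _) , _)
        finish ((_ ∷ _ ∷ (_ ∷ _ ∷ _) ∷ _) , (_ ∷ _ ∷ () ∷ _) , _)

      findTriple : ∀ x y (F : List (Fin n)) → Uniq F → (length F + 3) * connectSize ≤ n →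
        Σ (Triple H) λ t → (∀ v → occ v (tripleVerts H (t ∷ [])) + occ v F ≤ 1) × connects H (x , y) t ≡ true
      findTriple x y F u size =
        let t , fresh , bound = pickTriple ((x , y) ∷ []) (λ _ → 1) F u size (s≤s z≤n)
        in t , fresh , 𝟙-true (≤-trans (*-positiveʳ connectLoss bound)
            (≤-reflexive (trans (+-identityʳ _) (+-identityʳ _))))

    -- Two triples in which x and y can be exchanged for r and s, and a path from r to s.
    template : Pair H → Vec (Fin n) 9 → Bool
    template (x , y) (p ∷ q ∷ r ∷ u ∷ v ∷ s ∷ a ∷ b ∷ c ∷ []) =
      (edge H x p q ∧ edge H p q r) ∧ ((edge H y u v ∧ edge H u v s) ∧ (edge H r a b ∧ edge H b c s))

    template-count : ∀ q → n ^ 9 ≤ ∑ (allVec 9) (λ v → 𝟙 (template q v)) * 50000000000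
    template-count (x , y) = ≤-trans
        (ninth n S S′ (exchange-count H K big deg x) (exchange-count H K big deg y))
        (≤-trans (*-monoˡ-≤ 1000000 lower)
        (≤-reflexive (*-assoc (∑ (allVec 9) (λ v → 𝟙 (template (x , y) v))) 50000 1000000)))
      where
      f g : Fin n → Fin n → Fin n → ℕ
      f p q r = E H x p q * E H p q r
      g u v s = E H y u v * E H u v s
      h : Fin n → Fin n → ℕ
      h r s = ∑³ (λ a b c → E H r a b * E H b c s)
      S S′ : ℕ
      S = ∑³ f
      S′ = ∑³ g
      ninth : ∀ n S S′ → n * n * n ≤ S * 1000 → n * n * n ≤ S′ * 1000 → n ^ 9 ≤ S * S′ * (n * n * n) * 1000000
      ninth n S S′ h₁ h₂ = certify (n ∷ S ∷ S′ ∷ []) (λ n S S′ → let n³ = n :* n :* n in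
        n³ :* n³ ⊠ n³ :≤ S :* con 1000 ∷ n³ :* S :* con 1000 ⊠ n³ :≤ S′ :* con 1000 ∷ []
        ⊢ n :* (n :* (n :* (n :* (n :* (n :* (n :* (n :* (n :* con 1)))))))) :≤ S :* S′ :* n³ :* con 1000000) h₁
            h₂
      unfold : ∑ (allVec 9) (λ v → 𝟙 (template (x , y) v)) ≡ ∑³
          (λ p q r → ∑³ (λ u v s → f p q r * (g u v s * h r s)))
      unfold = trans (∑-allVec-3+ 6 (λ v → 𝟙 (template (x , y) v)))
          (∑³-cong λ p q r → trans (∑-allVec-3+ 3 (λ w → 𝟙 (template (x , y) (p ∷ q ∷ r ∷ w))))
          (∑³-cong λ u v s →
        trans (∑-allVec₃ (λ w → 𝟙 (template (x , y) (p ∷ q ∷ r ∷ u ∷ v ∷ s ∷ w))))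
            (trans (∑³-cong (λ a b c → factor (edge H x p q) (edge H p q r) (edge H y u v) (edge H u v s)
            (edge H r a b) (edge H b c s)))
          (trans (∑³-*ˡ (f p q r) (λ a b c → g u v s * (E H r a b * E H b c s)))
              (cong (f p q r *_) (∑³-*ˡ (g u v s) (λ a b c → E H r a b * E H b c s)))))))
        where
        factor : ∀ a b c d e f → 𝟙 ((a ∧ b) ∧ ((c ∧ d) ∧ (e ∧ f))) ≡ 𝟙 a * 𝟙 b * (𝟙 c * 𝟙 d * (𝟙 e * 𝟙 f))
        factor a b c d e f rewrite 𝟙-∧ (a ∧ b) ((c ∧ d) ∧ (e ∧ f)) | 𝟙-∧ a b | 𝟙-∧ (c ∧ d) (e ∧ f) | 𝟙-∧ c d |
            𝟙-∧ e f = refl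
      lower : S * S′ * (n * n * n) ≤ ∑ (allVec 9) (λ v → 𝟙 (template (x , y) v)) * 50000
      lower = begin
        S * S′ * (n * n * n)                                             ≡⟨ *-assoc S S′ (n * n * n) ⟩
        S * (S′ * (n * n * n))                                           ≡⟨ trans (∑³-*ʳ f (S′ * (n * n * n)))
            refl ⟨
        ∑³ (λ p q r → f p q r * (S′ * (n * n * n)))                      ≤⟨ ∑³-mono
            (λ p q r → *-monoʳ-≤ (f p q r) (middle r)) ⟩
        ∑³ (λ p q r → f p q r * (∑³ (λ u v s → g u v s * h r s) * 50000))  ≡⟨ ∑³-cong
            (λ p q r → trans (sym (*-assoc (f p q r) _ 50000))
            (cong (_* 50000) (sym (∑³-*ˡ (f p q r) (λ u v s → g u v s * h r s))))) ⟩
        ∑³ (λ p q r → ∑³ (λ u v s → f p q r * (g u v s * h r s)) * 50000)  ≡⟨ ∑³-*ʳ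
            (λ p q r → ∑³ (λ u v s → f p q r * (g u v s * h r s))) 50000 ⟩
        ∑³ (λ p q r → ∑³ (λ u v s → f p q r * (g u v s * h r s))) * 50000  ≡⟨ cong (_* 50000) unfold ⟨
        ∑ (allVec 9) (λ v → 𝟙 (template (x , y) v)) * 50000 ∎
        where
        open ≤-Reasoning
        middle : ∀ r → S′ * (n * n * n) ≤ ∑³ (λ u v s → g u v s * h r s) * 50000
        middle r = begin
          S′ * (n * n * n)                               ≡⟨ ∑³-*ʳ g (n * n * n) ⟨
          ∑³ (λ u v s → g u v s * (n * n * n))          ≤⟨ ∑³-mono
              (λ u v s → *-monoʳ-≤ (g u v s) (connect-count H K big deg r s)) ⟩
          ∑³ (λ u v s → g u v s * (h r s * 50000))      ≡⟨ ∑³-cong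
              (λ u v s → sym (*-assoc (g u v s) (h r s) 50000)) ⟩
          ∑³ (λ u v s → g u v s * h r s * 50000)        ≡⟨ ∑³-*ʳ (λ u v s → g u v s * h r s) 50000 ⟩
          ∑³ (λ u v s → g u v s * h r s) * 50000 ∎

    record Three (l : List (Fin n)) : Set where
      field
        e₀ e₁ e₂ : Fin n
        m₀ : e₀ ∈ l
        m₁ : e₁ ∈ l
        m₂ : e₂ ∈ l
        total : ∀ v → occ v l ≡ δ v e₀ + (δ v e₁ + (δ v e₂ + 0))

    three : ∀ l → length l ≡ 3 → Three l
    three (a ∷ b ∷ c ∷ []) _ = record
        { e₀ = a ; e₁ = b ; e₂ = c ; m₀ = here refl ; m₁ = there (here refl) ; m₂ = there (there (here refl)) ;
        total = λ v → refl }

    private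
      p132 : ∀ {a b c} → edge H a b c ≡ true → edge H a c b ≡ true
      p132 {a} {b} {c} e = trans (sym (sym₂₃ H a b c)) e
      p213 : ∀ {a b c} → edge H a b c ≡ true → edge H b a c ≡ true
      p213 {a} {b} {c} e = trans (sym (sym₁₂ H a b c)) e
      p231 : ∀ {a b c} → edge H a b c ≡ true → edge H b c a ≡ true
      p231 e = p132 (p213 e)
      p312 : ∀ {a b c} → edge H a b c ≡ true → edge H c a b ≡ true
      p312 e = p213 (p132 e)

    -- The chain grows at its front. Every absorber contributes 28 vertices: 12 in its own paths,
    -- and 16 in the connectors with the endpoints they lead to.
    State : ℕ → Fin n → Set
    State t end = Σ (Fin n) λ x → Σ (Chain H x end) λ c → Uniq (x ∷ chainVerts H c) × length
        (x ∷ chainVerts H c) ≡ 1 + t * 28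

    reach : ∀ {end} t → State t end → Pair H → ℕ
    reach t (x , c , _) q = hits H q c

    -- The absorber that a blow-up of the template provides for a pair y, z consists of four paths, joined by
    -- connectors.  Primes count copies in the blow-up; before and after y and z are taken up they are
    --   p r q             p y q
    --   u s w             u z w
    --   d b s′ b′ d′      d s′ b r′ a r b′ s d′
    --   r″ a b″ r′ a′     r″ b″ a′
    module Extend {end : Fin n} (x : Fin n) (c : Chain H x end) (L₁ L₂ L₃ L₄ L₅ L₆ L₇ L₈ L₉ : List (Fin n))
      (p : Three L₁) (q : Three L₂) (r : Three L₃) (u : Three L₄) (w : Three L₅) (s : Three L₆) (a : Three L₇)
          (b : Three L₈) (d : Three L₉) where
      open Three

      L : Vec (List (Fin n)) 9
      L = L₁ ∷ L₂ ∷ L₃ ∷ L₄ ∷ L₅ ∷ L₆ ∷ L₇ ∷ L₈ ∷ L₉ ∷ []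

      abs : Pair H → Bool
      abs y = good 9 (template y) L

      edges : ∀ {y z} → abs (y , z) ≡ true → ∀ {p′ q′ r′ u′ w′ s′ a′ b′ d′} → p′ ∈ L₁ → q′ ∈ L₂ → r′ ∈ L₃ → u′ ∈
          L₄ → w′ ∈ L₅ → s′ ∈ L₆ → a′ ∈ L₇ → b′ ∈ L₈ → d′ ∈ L₉ →
        (edge H y p′ q′ ≡ true × edge H p′ q′ r′ ≡ true) × (edge H z u′ w′ ≡ true × edge H u′ w′ s′ ≡ true) ×
            (edge H r′ a′ b′ ≡ true × edge H b′ d′ s′ ≡ true)
      edges {y} {z} g {p′} {q′} {r′} {u′} {w′} {s′} {a′} {b′} {d′} i₁ i₂ i₃ i₄ i₅ i₆ i₇ i₈ i₉ =
        let h = good-∈ 9 (template (y , z)) {L} {p′ ∷ q′ ∷ r′ ∷ u′ ∷ w′ ∷ s′ ∷ a′ ∷ b′ ∷ d′ ∷ []} g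
                (i₁ ∷ i₂ ∷ i₃ ∷ i₄ ∷ i₅ ∷ i₆ ∷ i₇ ∷ i₈ ∷ i₉ ∷ [])
            h₁ , h₂ = ∧-true {edge H y p′ q′ ∧ edge H p′ q′ r′} h
            h₃ , h₄ = ∧-true {edge H z u′ w′ ∧ edge H u′ w′ s′} h₂
        in ∧-true {edge H y p′ q′} h₁ , ∧-true {edge H z u′ w′} h₃ , ∧-true {edge H r′ a′ b′} h₄

      module _ {y z : Fin n} (g : abs (y , z) ≡ true) where

        ypq : edge H y (e₀ p) (e₀ q) ≡ true
        ypq = proj₁ (proj₁ (edges g (m₀ p) (m₀ q) (m₀ r) (m₀ u) (m₀ w) (m₀ s) (m₀ a) (m₀ b) (m₀ d)))
        pqr : edge H (e₀ p) (e₀ q) (e₀ r) ≡ true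
        pqr = proj₂ (proj₁ (edges g (m₀ p) (m₀ q) (m₀ r) (m₀ u) (m₀ w) (m₀ s) (m₀ a) (m₀ b) (m₀ d)))
        zuw : edge H z (e₀ u) (e₀ w) ≡ true
        zuw = proj₁ (proj₁ (proj₂ (edges g (m₀ p) (m₀ q) (m₀ r) (m₀ u) (m₀ w) (m₀ s) (m₀ a) (m₀ b) (m₀ d))))
        uws : edge H (e₀ u) (e₀ w) (e₀ s) ≡ true
        uws = proj₂ (proj₁ (proj₂ (edges g (m₀ p) (m₀ q) (m₀ r) (m₀ u) (m₀ w) (m₀ s) (m₀ a) (m₀ b) (m₀ d))))
        rab : ∀ {r′ a′ b′} → r′ ∈ L₃ → a′ ∈ L₇ → b′ ∈ L₈ → edge H r′ a′ b′ ≡ true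
        rab i j k = proj₁ (proj₂ (proj₂ (edges g (m₀ p) (m₀ q) i (m₀ u) (m₀ w) (m₀ s) j k (m₀ d))))
        bds : ∀ {b′ d′ s′} → b′ ∈ L₈ → d′ ∈ L₉ → s′ ∈ L₆ → edge H b′ d′ s′ ≡ true
        bds i j k = proj₂ (proj₂ (proj₂ (edges g (m₀ p) (m₀ q) (m₀ r) (m₀ u) (m₀ w) k (m₀ a) i j)))

      module _ (t₁ t₂ t₃ t₄ : Triple H) (k₁ : connects H (e₀ q , e₀ u) t₁ ≡ true)
          (k₂ : connects H (e₀ w , e₀ d) t₂ ≡ true)
        (k₃ : connects H (e₁ d , e₂ r) t₃ ≡ true) (k₄ : connects H (e₁ a , x) t₄ ≡ true) where

        bridge : Triple H → Fin n → List (Fin n)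
        bridge (i , j , k) y = i ∷ j ∷ k ∷ y ∷ []

        base : List (Fin n)
        base = (e₀ r ∷ e₀ q ∷ []) ++ (bridge t₁ (e₀ u) ++
            ((e₀ s ∷ e₀ w ∷ []) ++ (bridge t₂ (e₀ d) ++ ((e₀ b ∷ e₁ s ∷ e₁ b ∷ e₁ d ∷ []) ++
          (bridge t₃ (e₂ r) ++ ((e₀ a ∷ e₂ b ∷ e₁ r ∷ e₁ a ∷ []) ++ bridge t₄ x))))))

        after-with : Fin n → Fin n → List (Fin n)
        after-with y z = (y ∷ e₀ q ∷ []) ++
            (bridge t₁ (e₀ u) ++ ((z ∷ e₀ w ∷ []) ++
            (bridge t₂ (e₀ d) ++ ((e₁ s ∷ e₀ b ∷ e₁ r ∷ e₀ a ∷ e₀ r ∷ e₁ b ∷ e₀ s ∷ e₁ d ∷ []) ++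
          (bridge t₃ (e₂ r) ++ ((e₂ b ∷ e₁ a ∷ []) ++ bridge t₄ x))))))

        module _ {y z : Fin n} (g : abs (y , z) ≡ true) where

          base-path : LP H (e₀ p) base x
          base-path = append H (step (p132 (pqr g)) stop)
              (append H (connector H k₁) (append H (step (p132 (uws g)) stop) (append H (connector H k₂)
            (append H (step (p213 (bds g (m₀ b) (m₀ d) (m₁ s))) (step (p312 (bds g (m₁ b) (m₁ d) (m₁ s))) stop))
                (append H (connector H k₃)
              (append H (step (rab g (m₂ r) (m₀ a) (m₂ b)) (step (p312 (rab g (m₁ r) (m₁ a) (m₂ b))) stop))
                  (connector H k₄)))))))

          absorbing-path : LP H (e₀ p) (after-with y z) x
          absorbing-path = append H (step (p213 (ypq g)) stop)
              (append H (connector H k₁) (append H (step (p213 (zuw g)) stop) (append H (connector H k₂)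
            (append H (step (p231 (bds g (m₀ b) (m₀ d) (m₁ s)))
                (step (p312 (rab g (m₁ r) (m₀ a) (m₀ b)))
                (step (p213 (rab g (m₀ r) (m₀ a) (m₁ b))) (step (p132 (bds g (m₁ b) (m₁ d) (m₀ s))) stop))))
              (append H (connector H k₃) (append H (step (p132 (rab g (m₂ r) (m₁ a) (m₂ b))) stop)
                  (connector H k₄)))))))

        exchange : ∀ y z v → occ v (after-with y z) ≡ occ v base + (δ v y + δ v z)
        exchange y z v = equate
          (δ v y ∷ δ v z ∷ δ v (e₀ q) ∷ δ v (e₀ r) ∷ δ v (e₁ r) ∷ δ v (e₂ r) ∷ δ v (e₀ u) ∷ δ v (e₀ w) ∷ δ v
              (e₀ s) ∷ δ v (e₁ s) ∷
            δ v (e₀ a) ∷ δ v (e₁ a) ∷ δ v (e₀ b) ∷ δ v (e₁ b) ∷ δ v (e₂ b) ∷ δ v (e₀ d) ∷ δ v (e₁ d) ∷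
            δ v (proj₁ t₁) ∷ δ v (proj₁ (proj₂ t₁)) ∷ δ v (proj₂ (proj₂ t₁)) ∷ δ v (proj₁ t₂) ∷ δ v
                (proj₁ (proj₂ t₂)) ∷ δ v (proj₂ (proj₂ t₂)) ∷
            δ v (proj₁ t₃) ∷ δ v (proj₁ (proj₂ t₃)) ∷ δ v (proj₂ (proj₂ t₃)) ∷ δ v (proj₁ t₄) ∷ δ v
                (proj₁ (proj₂ t₄)) ∷ δ v (proj₂ (proj₂ t₄)) ∷ δ v x ∷ [])
          λ y z q0 r0 r1 r2 u0 w0 s0 s1 a0 a1 b0 b1 b2 d0 d1 i1 j1 k1 i2 j2 k2 i3 j3 k3 i4 j4 k4 x →
            y :+ (q0 :+ (i1 :+ (j1 :+ (k1 :+
                (u0 :+ (z :+ (w0 :+ (i2 :+ (j2 :+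
                (k2 :+ (d0 :+ (s1 :+ (b0 :+ (r1 :+
                (a0 :+ (r0 :+ (b1 :+ (s0 :+ (d1 :+
                (i3 :+ (j3 :+ (k3 :+ (r2 :+ (b2 :+
                (a1 :+ (i4 :+ (j4 :+ (k4 :+ (x :+ (con 0))))))))))))))))))))))))))))))
            :≡ r0 :+ (q0 :+ (i1 :+ (j1 :+ (k1 :+
                (u0 :+ (s0 :+ (w0 :+ (i2 :+ (j2 :+
                (k2 :+ (d0 :+ (b0 :+ (s1 :+ (b1 :+
                (d1 :+ (i3 :+ (j3 :+ (k3 :+ (r2 :+
                (a0 :+ (b2 :+ (r1 :+ (a1 :+ (i4 :+ (j4 :+ (k4 :+ (x :+ (con 0)))))))))))))))))))))))))))) :+
                (y :+ z)

        extended : ∀ {y z} → abs (y , z) ≡ true → Chain H (e₀ p) end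
        extended g = cons base (base-path g) abs (λ y z h → after-with y z , absorbing-path h , exchange y z) c

        fits : (∀ v → occ v (tripleVerts H (t₄ ∷ [])) +
            (occ v (tripleVerts H (t₃ ∷ [])) +
            (occ v (tripleVerts H (t₂ ∷ [])) +
            (occ v (tripleVerts H (t₁ ∷ [])) + (occ v (flat L) + occ v (x ∷ chainVerts H c))))) ≤ 1) →
          Uniq (e₀ p ∷ (base ++ chainVerts H c))
        fits h v = ≤-trans (certify
            (δ v (e₀ p) ∷ δ v (e₀ q) ∷ δ v (e₀ r) ∷ δ v (e₁ r) ∷ δ v (e₂ r) ∷ δ v (e₀ u) ∷ δ v (e₀ w) ∷ δ v
                (e₀ s) ∷ δ v (e₁ s) ∷ δ v (e₀ a) ∷ δ v (e₁ a) ∷ δ v (e₀ b) ∷ δ v (e₁ b) ∷ δ v (e₂ b) ∷ δ v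
                (e₀ d) ∷ δ v (e₁ d) ∷
              δ v (proj₁ t₁) ∷ δ v (proj₁ (proj₂ t₁)) ∷ δ v (proj₂ (proj₂ t₁)) ∷ δ v (proj₁ t₂) ∷ δ v
                  (proj₁ (proj₂ t₂)) ∷ δ v (proj₂ (proj₂ t₂)) ∷
              δ v (proj₁ t₃) ∷ δ v (proj₁ (proj₂ t₃)) ∷ δ v (proj₂ (proj₂ t₃)) ∷ δ v (proj₁ t₄) ∷ δ v
                  (proj₁ (proj₂ t₄)) ∷ δ v (proj₂ (proj₂ t₄)) ∷ δ v x ∷ occ v (chainVerts H c) ∷
              occ v L₁ ∷ occ v L₂ ∷ occ v L₃ ∷ occ v L₄ ∷ occ v L₅ ∷ occ v L₆ ∷ occ v L₇ ∷ occ v L₈ ∷ occ v L₉ ∷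
                  [])
            (λ p0 q0 r0 r1 r2 u0 w0 s0 s1 a0 a1 b0 b1 b2 d0 d1 i1 j1 k1 i2 j2 k2 i3 j3 k3 i4 j4 k4 x c l1 l2 l3
                l4 l5 l6 l7 l8 l9 →
              con 1 ⊠ p0 :≤ l1 ∷ con 1 ⊠ q0 :≤ l2 ∷ con 1 ⊠ r0 :+ (r1 :+ r2) :≤ l3 ∷ con 1 ⊠ u0 :≤ l4 ∷ con 1 ⊠
                  w0 :≤ l5 ∷ con 1 ⊠ s0 :+ s1 :≤ l6 ∷
              con 1 ⊠ a0 :+ a1 :≤ l7 ∷ con 1 ⊠ b0 :+ (b1 :+ b2) :≤ l8 ∷ con 1 ⊠ d0 :+ d1 :≤ l9 ∷ []
              ⊢ p0 :+ (r0 :+ (q0 :+ (i1 :+ (j1 :+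
                  (k1 :+ (u0 :+ (s0 :+ (w0 :+ (i2 :+
                  (j2 :+ (k2 :+ (d0 :+ (b0 :+ (s1 :+
                  (b1 :+ (d1 :+ (i3 :+ (j3 :+ (k3 :+
                  (r2 :+ (a0 :+ (b2 :+ (r1 :+ (a1 :+ (i4 :+ (j4 :+ (k4 :+ (x :+ (c)))))))))))))))))))))))))))))
                :≤ i4 :+ (j4 :+ (k4 :+ con 0)) :+
                    (i3 :+ (j3 :+ (k3 :+ con 0)) :+
                    (i2 :+ (j2 :+ (k2 :+ con 0)) :+
                    (i1 :+ (j1 :+ (k1 :+ con 0)) :+
                    (l1 :+ (l2 :+ (l3 :+ (l4 :+ (l5 :+ (l6 :+ (l7 :+ (l8 :+ ((l9 :+ con 0))))))))) :+
                    (x :+ c))))))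
            (one p) (one q) (all₃ r) (one u) (one w) (two s) (two a) (all₃ b) (two d))
          (≤-trans (≤-reflexive (cong (λ z → occ v (tripleVerts H (t₄ ∷ [])) +
              (occ v (tripleVerts H (t₃ ∷ [])) +
              (occ v (tripleVerts H (t₂ ∷ [])) +
              (occ v (tripleVerts H (t₁ ∷ [])) + (z + occ v (x ∷ chainVerts H c))))))
            (sym (++-expand L₁ (++-expand L₂
                (++-expand L₃ (++-expand L₄ (++-expand L₅
                (++-expand L₆ (++-expand L₇ (++-expand L₈ (++-expand L₉ refl)))))))))))) (h v))
          where
          one : ∀ {l} (t : Three l) → δ v (e₀ t) ≤ occ v l
          one t = ≤-trans (m≤m+n _ _) (≤-reflexive (sym (total t v)))
          two : ∀ {l} (t : Three l) → δ v (e₀ t) + δ v (e₁ t) ≤ occ v l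
          two t = ≤-trans (+-monoʳ-≤ (δ v (e₀ t)) (m≤m+n _ _)) (≤-reflexive (sym (total t v)))
          all₃ : ∀ {l} (t : Three l) → δ v (e₀ t) + (δ v (e₁ t) + δ v (e₂ t)) ≤ occ v l
          all₃ t = ≤-trans (+-monoʳ-≤ (δ v (e₀ t)) (+-monoʳ-≤ (δ v (e₁ t)) (m≤m+n _ 0)))
              (≤-reflexive (sym (total t v)))
          ++-expand : ∀ l {m k} → occ v m ≡ k → occ v (l ++ m) ≡ occ v l + k
          ++-expand l {m} e = trans (occ-++ v l m) (cong (occ v l +_) e)

    flat-length : ∀ {k t} (L : Vec (List (Fin n)) k) → AllV (λ l → length l ≡ t) L → length (flat L) ≡ k * t
    flat-length []      []       = refl
    flat-length (l ∷ L) (e ∷ es) = trans (length-++ l) (cong₂ _+_ e (flat-length L es))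

    abstract
      -- Room is needed for 1 + 28t old vertices, 27 of the blow-up and 12 of four connectors,
      -- together 28t + 40.
      extend : ∀ end t (S : State t end) (I : List (Pair H)) (ω : Pair H → ℕ) → 0 < ∑ I ω →
        (t * 28 + 40) * (templateSize + connectSize) ≤ n →
        Σ (State (suc t) end) λ S′ → Σ (Pair H → Bool) λ b → (∀ y → reach t S y + 𝟙 (b y) ≤ reach (suc t) S′ y)
            ×
          ∑ I ω ≤ templateLoss * ∑ I (λ y → ω y * 𝟙 (b y))
      extend end t (x , c , u , len) I ω pos size = stage₁
        (blow 9 3 50000000000 I ω template (x ∷ chainVerts H c) n>0 u
          (≤-trans (*-mono-≤ (≤-trans (≤-reflexive (cong (_+ 27) len))
              (certify (t ∷ []) λ t → [] ⊢ con 1 :+ t :* con 28 :+ con 27 :≤ t :* con 28 :+ con 40))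
              (m≤m+n templateSize connectSize)) size)
          pos (weighted-dense I ω (λ q → ∑ (allVec 9) (λ v → 𝟙 (template q v))) (n ^ 9) 50000000000
              template-count))
        where
        Result : Set
        Result = Σ (State (suc t) end) λ S′ → Σ (Pair H → Bool) λ b →
            (∀ y → hits H y c + 𝟙 (b y) ≤ reach (suc t) S′ y) ×
          ∑ I ω ≤ templateLoss * ∑ I (λ y → ω y * 𝟙 (b y))
        room : ∀ {l} → l + 3 ≤ t * 28 + 40 → (l + 3) * connectSize ≤ n
        room h = ≤-trans (*-mono-≤ h (m≤n+m connectSize templateSize)) size
        stage₁ : (Σ (Vec (List (Fin n)) 9) λ L → AllV (λ l → length l ≡ 3) L ×
            (∀ v → occ v (flat L) + occ v (x ∷ chainVerts H c) ≤ 1) ×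
          ∑ I ω ≤ templateLoss * ∑ I (λ i → ω i * 𝟙 (good 9 (template i) L))) → Result
        stage₁ ((L₁ ∷ L₂ ∷ L₃ ∷ L₄ ∷ L₅ ∷ L₆ ∷ L₇ ∷ L₈ ∷ L₉ ∷ []) ,
            lens@(l₁ ∷ l₂ ∷ l₃ ∷ l₄ ∷ l₅ ∷ l₆ ∷ l₇ ∷ l₈ ∷ l₉ ∷ []) , fresh , bound) =
          connect₁ (findTriple (e₀ q) (e₀ w′) F₁ u₁ (room {length F₁} (grow 0)))
          where
          open Three
          p : Three L₁
          p = three L₁ l₁
          q : Three L₂
          q = three L₂ l₂
          r : Three L₃
          r = three L₃ l₃
          w′ : Three L₄
          w′ = three L₄ l₄
          w : Three L₅
          w = three L₅ l₅
          s : Three L₆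
          s = three L₆ l₆
          a : Three L₇
          a = three L₇ l₇
          b : Three L₈
          b = three L₈ l₈
          d : Three L₉
          d = three L₉ l₉
          open Extend x c L₁ L₂ L₃ L₄ L₅ L₆ L₇ L₈ L₉ p q r w′ w s a b d
          F₁ : List (Fin n)
          F₁ = flat L ++ (x ∷ chainVerts H c)
          u₁ : Uniq F₁
          u₁ v = ≤-trans (≤-reflexive (occ-++ v (flat L) (x ∷ chainVerts H c))) (fresh v)
          len₁ : length F₁ ≡ 27 + (1 + t * 28)
          len₁ = trans (length-++ (flat L)) (cong₂ _+_ (flat-length L lens) len)
          grow : ∀ k {_ : T (k ≤ᵇ 9)} → k + length F₁ + 3 ≤ t * 28 + 40
          grow k {h} = subst (λ z → k + z + 3 ≤ t * 28 + 40) (sym len₁)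
              (certify (t ∷ k ∷ []) (λ t k → con 1 ⊠ k :≤ con 9 ∷ [] ⊢ k :+ (con 27 :+ (con 1 :+ t :* con 28))
              :+ con 3 :≤ t :* con 28 :+ con 40) (≤ᵇ⇒≤ k 9 h))
          -- The path `base` contains neither vertex of the pair, but its edges are known only
          -- through `abs`. One absorbed pair certifies them, and positive weight provides one.
          someGood : Σ (Pair H) λ y → abs y ≡ true
          someGood = let y , _ , h = ∑-nonempty I (λ y → ω y * 𝟙 (abs y)) (*-positiveʳ templateLoss (≤-trans pos bound)) in y , 𝟙-true (*-positiveʳ (ω y) h)
          Found : Fin n → Fin n → List (Fin n) → Set
          Found y z F = Σ (Triple H) λ t → (∀ v → occ v (tripleVerts H (t ∷ [])) + occ v F ≤ 1) × connects H
              (y , z) t ≡ true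
          join-uniq : ∀ T′ F → (∀ v → occ v (tripleVerts H (T′ ∷ [])) + occ v F ≤ 1) → Uniq
              (tripleVerts H (T′ ∷ []) ++ F)
          join-uniq T′ F f v = ≤-trans (≤-reflexive (occ-++ v (tripleVerts H (T′ ∷ [])) F)) (f v)
          connect₁ : Found (e₀ q) (e₀ w′) F₁ → Result
          connect₁ (t₁ , f₁ , k₁) = connect₂
              (findTriple (e₀ w) (e₀ d) F₂ (join-uniq t₁ F₁ f₁) (room {3 + length F₁} (grow 3)))
            where
            F₂ : List (Fin n)
            F₂ = tripleVerts H (t₁ ∷ []) ++ F₁
            connect₂ : Found (e₀ w) (e₀ d) F₂ → Result
            connect₂ (t₂ , f₂ , k₂) = connect₃
                (findTriple (e₁ d) (e₂ r) F₃ (join-uniq t₂ F₂ f₂) (room {6 + length F₁} (grow 6)))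
              where
              F₃ : List (Fin n)
              F₃ = tripleVerts H (t₂ ∷ []) ++ F₂
              connect₃ : Found (e₁ d) (e₂ r) F₃ → Result
              connect₃ (t₃ , f₃ , k₃) = connect₄
                  (findTriple (e₁ a) x F₄ (join-uniq t₃ F₃ f₃) (room {9 + length F₁} (grow 9)))
                where
                F₄ : List (Fin n)
                F₄ = tripleVerts H (t₃ ∷ []) ++ F₃
                unfolded : ∀ v → occ v F₄ ≡ occ v (tripleVerts H (t₃ ∷ [])) +
                    (occ v (tripleVerts H (t₂ ∷ [])) +
                    (occ v (tripleVerts H (t₁ ∷ [])) + (occ v (flat L) + occ v (x ∷ chainVerts H c))))
                unfolded v = trans (occ-++ v (tripleVerts H (t₃ ∷ [])) F₃)
                    (cong (occ v (tripleVerts H (t₃ ∷ [])) +_)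
                  (trans (occ-++ v (tripleVerts H (t₂ ∷ [])) F₂)
                      (cong (occ v (tripleVerts H (t₂ ∷ [])) +_)
                      (trans (occ-++ v (tripleVerts H (t₁ ∷ [])) F₁)
                      (cong (occ v (tripleVerts H (t₁ ∷ [])) +_) (occ-++ v (flat L) (x ∷ chainVerts H c)))))))
                connect₄ : Found (e₁ a) x F₄ → Result
                connect₄ (t₄ , f₄ , k₄) =
                  (e₀ p , extended t₁ t₂ t₃ t₄ k₁ k₂ k₃ k₄ (proj₂ someGood)
                    , fits t₁ t₂ t₃ t₄ k₁ k₂ k₃ k₄ (λ v → ≤-trans
                        (≤-reflexive (cong (occ v (tripleVerts H (t₄ ∷ [])) +_) (sym (unfolded v)))) (f₄ v))
                    , cong (29 +_) (suc-injective len))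
                  , abs , (λ y → ≤-reflexive (+-comm (hits H y c) (𝟙 (abs y)))) , bound

-- Building the chain and the reservoir, and closing the cycle

module Assembly where
  open Prelude
  open Certificates
  open Sums
  open Multiplicities
  open FractionalCover
  open Duality
  open Blocks
  open Paths
  open Derandomisation
  open Absorbers
  open import Data.Nat.Divisibility using (_∣_; divides)

  module _ (D : ℕ) (D>0 : 0 < D) where

    private instance D≢0 = >-nonZero D>0

    quotient-upper : ∀ n → (n / D) * D ≤ n
    quotient-upper n = m/n*n≤m n D

    quotient-lower : ∀ n → n < D * (n / D + 1)
    quotient-lower n = ≤-trans (s≤s (≤-reflexive (m≡m%n+[m/n]*n n D)))
        (≤-trans (+-monoˡ-≤ (n / D * D) (m%n<n n D))
      (≤-reflexive (trans (+-comm D (n / D * D))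
          (trans (cong₂ _+_ (*-comm (n / D) D) (sym (*-identityʳ D))) (sym (*-distribˡ-+ D (n / D) 1))))))

    quotient-large : ∀ n x → D * x ≤ n → x ≤ n / D
    quotient-large n x h = s≤s⁻¹ (≤-trans (*-cancelˡ-< D x (n / D + 1) (≤-<-trans h (quotient-lower n)))
        (≤-reflexive (+-comm (n / D) 1)))

  n≤2^n : ∀ n → n ≤ 2 ^ n
  n≤2^n zero    = z≤n
  n≤2^n (suc n) = ≤-trans (+-mono-≤ (m^n>0 2 n) (n≤2^n n))
      (≤-reflexive (cong (2 ^ n +_) (sym (+-identityʳ (2 ^ n)))))

  -- Selection serves at most 2^q indices with q hits each. Here the indices are the n² pairs, so
  -- linear q is affordable.
  square-below-exponential : ∀ D (D>0 : 0 < D) n → D * (4 * (D * 2 + 6)) ≤ n → n * n ≤ 2 ^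
      (_/_ n D {{>-nonZero D>0}})
  square-below-exponential D D>0 n large = begin
    n * n                                    ≤⟨ *-mono-≤ bound bound ⟩
    D * (4 * (k + 1)) * (D * (4 * (k + 1)))  ≤⟨ certify (D ∷ k ∷ 2 ^ D ∷ 2 ^ (k + 1 + 1) ∷ []) (λ D k p q →
                                                  con 16 :* D :* (k :+ con 1) :* (k :+ con 1) ⊠ D :≤ p ∷ con 16
                                                      :* p :* (k :+ con 1) :* (k :+ con 1) ⊠ D :≤ p ∷ con 16 :*
                                                      p :* p ⊠ (k :+ con 1) :* (k :+ con 1) :≤ q ∷ []
                                                  ⊢ D :* (con 4 :* (k :+ con 1)) :*
                                                      (D :* (con 4 :* (k :+ con 1))) :≤ con 16 :* (p :* p :* q))
                                                      (n≤2^n D) (n≤2^n D) (square≤2^ (k + 1)) ⟩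
    16 * (2 ^ D * 2 ^ D * 2 ^ (k + 1 + 1))   ≡⟨ cong (16 *_)
        (trans (cong (_* 2 ^ (k + 1 + 1)) (sym (^-distribˡ-+-* 2 D D)))
        (sym (^-distribˡ-+-* 2 (D + D) (k + 1 + 1)))) ⟩
    2 ^ 4 * 2 ^ (D + D + (k + 1 + 1))        ≡⟨ ^-distribˡ-+-* 2 4 (D + D + (k + 1 + 1)) ⟨
    2 ^ (4 + (D + D + (k + 1 + 1)))          ≤⟨ ^-monoʳ-≤ 2
        (certify (D ∷ k ∷ q ∷ []) (λ D k q → con 1 ⊠ k :* con 4 :≤ q ∷ con 1 ⊠ D :* con 2 :+ con 6 :≤ k ∷ []
                                                  ⊢ con 4 :+ (D :+ D :+ (k :+ con 1 :+ con 1)) :≤ q)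
                                                      (quotient-upper 4 (s≤s z≤n) q) k-large) ⟩
    2 ^ q ∎
    where
    open ≤-Reasoning
    instance D≢0 = >-nonZero D>0
    q k : ℕ
    q = n / D
    k = q / 4
    bound : n ≤ D * (4 * (k + 1))
    bound = ≤-trans (<⇒≤ (quotient-lower D D>0 n))
        (*-monoʳ-≤ D (≤-trans (≤-reflexive (+-comm q 1)) (quotient-lower 4 (s≤s z≤n) q)))
    k-large : D * 2 + 6 ≤ k
    k-large = quotient-large 4 (s≤s z≤n) q (D * 2 + 6) (quotient-large D D>0 n (4 * (D * 2 + 6)) large)

  module _ {n : ℕ} (H : Hypergraph3 n) (K : ℕ) (big : 1000 ≤ K) (deg : MinDegree H K) (n>0 : 0 < n) where

    pairs : List (Pair H)
    pairs = cartesianProductWith _,_ V V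

    pairs-length : length pairs ≡ n * n
    pairs-length = trans (sym (trans (∑-const pairs 1) (*-identityʳ _)))
        (trans (∑-product _,_ (V {n}) (V {n}) (λ _ → 1))
      (trans (∑²-fst {n} (λ _ → 1)) (cong (n *_) ∑-one)))

    pairs-all : ∀ q → q ∈ pairs
    pairs-all (x , y) = ∈-cartesianProductWith⁺ _,_ (∈-allFin x) (∈-allFin y)
      where open import Data.List.Membership.Propositional.Properties using (∈-cartesianProductWith⁺)

    pairs>0 : 0 < length pairs
    pairs>0 = subst (0 <_) (sym pairs-length) (*-mono-≤ n>0 n>0)

    buildChain : ∀ (end : Fin n) q T → T ≡ (templateLoss + suc templateLoss + 1) * (q + q) → n * n ≤ 2 ^ q →
      (T * 28 + 40) * (templateSize + connectSize) ≤ n → Σ (State H K big deg n>0 T end) λ S → ∀ y → q ≤ reach H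
          K big deg n>0 T S y
    buildChain end q T T≡ small room =
      let S , h = Selection.select pairs pairs>0 (λ t → State H K big deg n>0 t end)
              (λ t → reach H K big deg n>0 t) templateLoss T
                    (λ t t<T S ω pos → let S′ , b , more , bound = extend H K big deg n>0 end t S pairs ω pos
                                             (≤-trans (*-monoˡ-≤ (templateSize + connectSize)
                                                 (+-monoˡ-≤ 40 (*-monoˡ-≤ 28 (<⇒≤ t<T)))) room)
                                       in S′ , b , more , ≤-trans bound (*-monoˡ-≤ _ (n≤1+n templateLoss)))
                    q T≡ (subst (_≤ 2 ^ q) (sym pairs-length) small)
                        (end , nil , (λ v → ≤-trans (≤-reflexive (+-identityʳ _)) (δ≤1 v end)) , refl)
      in S , λ y → h y (pairs-all y)

    Reservoir : List (Fin n) → ℕ → Set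
    Reservoir U t = Σ (List (Triple H)) λ R → length R ≡ t × (∀ v → occ v (tripleVerts H R) + occ v U ≤ 1)

    tripleVerts-length : ∀ R → length (tripleVerts H R) ≡ length R * 3
    tripleVerts-length []      = refl
    tripleVerts-length (t ∷ R) = cong (3 +_) (tripleVerts-length R)

    buildReservoir : ∀ (U : List (Fin n)) → Uniq U → ∀ q T → T ≡ (connectLoss + suc connectLoss + 1) * (q + q) →
        n * n ≤ 2 ^ q →
      (T * 3 + length U + 3) * connectSize ≤ n → Σ (Reservoir U T) λ R → ∀ y → q ≤ connections H y (proj₁ R)
    buildReservoir U u q T T≡ small room =
      let R , h = Selection.select pairs pairs>0 (Reservoir U) (λ t R y → connections H y (proj₁ R)) connectLoss
              T
                    (λ t t<T → more t (<⇒≤ t<T)) q T≡ (subst (_≤ 2 ^ q) (sym pairs-length) small)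
                        ([] , refl , u)
      in R , λ y → h y (pairs-all y)
      where
      more : ∀ t → t ≤ T → (R : Reservoir U t) (ω : Pair H → ℕ) → 0 < ∑ pairs ω → Σ (Reservoir U (suc t)) λ R′ →
          Σ (Pair H → Bool) λ b →
        (∀ y → connections H y (proj₁ R) + 𝟙 (b y) ≤ connections H y (proj₁ R′)) × ∑ pairs ω ≤ suc connectLoss *
            ∑ pairs (λ y → ω y * 𝟙 (b y))
      more t t≤T (R , len , fresh) ω pos =
        let T′ , fresh′ , bound = pickTriple H K big deg n>0 pairs ω (tripleVerts H R ++ U)
                (λ v → ≤-trans (≤-reflexive (occ-++ v (tripleVerts H R) U)) (fresh v))
              (≤-trans (*-monoˡ-≤ connectSize
                  (+-monoˡ-≤ 3 (≤-trans (≤-reflexive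
                  (trans (length-++ (tripleVerts H R))
                  (cong (_+ length U) (trans (tripleVerts-length R) (cong (_* 3) len)))))
                (+-monoˡ-≤ (length U) (*-monoˡ-≤ 3 t≤T))))) room) pos
        in (T′ ∷ R , cong suc len , λ v → ≤-trans
            (≤-reflexive (reassoc (δ v (proj₁ T′)) (δ v (proj₁ (proj₂ T′))) (δ v (proj₂ (proj₂ T′)))
            (occ-++ v (tripleVerts H R) U))) (fresh′ v))
         , (λ y → connects H y T′) , (λ y → ≤-reflexive (+-comm (connections H y R) _)) , ≤-trans bound
             (*-monoˡ-≤ _ (n≤1+n connectLoss))
        where
        reassoc : ∀ a b c {r u w} → w ≡ r + u → a + (b + (c + r)) + u ≡ a + (b + (c + 0)) + w
        reassoc a b c {r} {u} refl = equate (a ∷ b ∷ c ∷ r ∷ u ∷ []) λ a b c r u → a :+ (b :+ (c :+ r)) :+ u :≡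
            a :+ (b :+ (c :+ con 0)) :+ (r :+ u)

    blockPaths : ∀ {m} → 0 < m → (Ks : List (Block H m)) → Σ (List (Segment H)) λ ss → length ss ≡ length Ks ×
      length (segsVerts H ss) + length Ks ≡ length Ks * (m * 4) ×
          (∀ v → occ v (segsVerts H ss) ≤ occ v (vertsAll H Ks))
    blockPaths m>0 [] = [] , refl , refl , λ v → z≤n
    blockPaths {m} m>0 (B ∷ Ks) =
      let s , len , sub = blockPath H m>0 B
          ss , num , lens , subs = blockPaths m>0 Ks
      in s ∷ ss , cong suc num , trans (cong (_+ suc (length Ks)) (length-++ (segVerts H s)))
          (shuffle (length (segVerts H s)) (length (segsVerts H ss)) (length Ks) len lens)
       , λ v → ≤-trans (≤-reflexive (occ-++ v (segVerts H s) (segsVerts H ss)))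
           (≤-trans (+-mono-≤ (sub v) (subs v)) (≤-reflexive (sym (occ-++ v (verts H B) (vertsAll H Ks)))))
      where
      shuffle : ∀ a b c {x y} → a + 1 ≡ x → b + c ≡ y → a + b + suc c ≡ x + y
      shuffle a b c refl refl = equate (a ∷ b ∷ c ∷ []) λ a b c → a :+ b :+ (con 1 :+ c) :≡ a :+ con 1 :+
          (b :+ c)

  -- The closed path has even length, as loose paths add vertices two at a time. Since n is even,
  -- the vertices left over can be absorbed in pairs, and `covered` bounds their number by 2q.
  close-up : ∀ {n} (H : Hypergraph3 n) {x y : Fin n} (c : Chain H x y) (R : List (Triple H))
      (ss : List (Segment H)) q → 6 ≤ n → 2 ∣ n →
    (∀ v → occ v (x ∷ chainVerts H c) + (occ v (tripleVerts H R) + occ v (segsVerts H ss)) ≤ 1) →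
    (∀ p → q ≤ hits H p c) → (∀ p → length ss + 1 ≤ connections H p R) →
    n ≤ q * 2 + (length (chainVerts H c) + length (segsVerts H ss)) → LooseHamiltonCycle H
  close-up {n} H {x} {y} c R ss q six even disjoint absorbing connecting covered = finish
      (join H y ss x R connecting)
    where
    finish : (Σ (List (Fin n)) λ l → Σ (List (Triple H)) λ R′ → LP H y l x × length R ≡ length R′ +
        (length ss + 1) ×
        (∀ v → occ v l + occ v (tripleVerts H R′) ≡ occ v (segsVerts H ss) + δ v x + occ v (tripleVerts H R))) →
            LooseHamiltonCycle H
    finish (l , R′ , p , len , counts) = closed
        (absorb-even H k left left-even c (λ z → ≤-trans k≤q (absorbing z)))
      where
      once : ∀ v → occ v (chainVerts H c) + occ v l ≤ 1
      once v = lemma (occ v (chainVerts H c)) (occ v l) (occ v (tripleVerts H R′)) (occ v (segsVerts H ss))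
          (δ v x) (occ v (tripleVerts H R)) (counts v) (disjoint v)
        where
        lemma : ∀ c l r′ s d r → l + r′ ≡ s + d + r → d + c + (r + s) ≤ 1 → c + l ≤ 1
        lemma c l r′ s d r e h = certify (c ∷ l ∷ r′ ∷ s ∷ d ∷ r ∷ [])
            (λ c l r′ s d r → con 1 ⊠ l :+ r′ :≤ s :+ d :+ r ∷ con 1 ⊠ d :+ c :+ (r :+ s) :≤ con 1 ∷ []
          ⊢ c :+ l :≤ con 1) (≤-reflexive e) h
      left : List (Fin n)
      left = keep (λ v → does (occ v (chainVerts H c) + occ v l ≟ℕ 0)) V
      left-occ : ∀ v → occ v (chainVerts H c) + occ v l + occ v left ≡ 1
      left-occ v = trans (cong (occ v (chainVerts H c) + occ v l +_)
          (trans (occ-keep _ v V) (trans (cong (𝟙 (does (occ v (chainVerts H c) + occ v l ≟ℕ 0)) *_)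
          (occ-allFin v)) (*-identityʳ _))))
        (bool (occ v (chainVerts H c) + occ v l) (once v))
        where
        bool : ∀ o → o ≤ 1 → o + 𝟙 (does (o ≟ℕ 0)) ≡ 1
        bool zero h = refl
        bool (suc zero) h = refl
        bool (suc (suc o)) (s≤s ())
      total : length (chainVerts H c) + length l + length left ≡ n
      total = trans (cong₂ _+_ (cong₂ _+_ (sym (length-occ (chainVerts H c))) (sym (length-occ l)))
          (sym (length-occ left)))
        (trans (cong (_+ ∑ V (λ v → occ v left))
            (sym (∑-+ (V {n}) (λ v → occ v (chainVerts H c)) (λ v → occ v l))))
          (trans (sym (∑-+ (V {n}) (λ v → occ v (chainVerts H c) + occ v l) (λ v → occ v left)))
              (trans (∑-cong (V {n}) left-occ) ∑-one)))
      l-long : length (segsVerts H ss) ≤ length l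
      l-long = +-cancelʳ-≤ (length (tripleVerts H R′)) _ _
          (≤-trans (+-monoʳ-≤ (length (segsVerts H ss)) R-larger)
        (≤-trans (+-monoˡ-≤ (length (tripleVerts H R)) (m≤m+n (length (segsVerts H ss)) 1))
            (≤-reflexive (sym lengths))))
        where
        lengths : length l + length (tripleVerts H R′) ≡ length (segsVerts H ss) + 1 + length (tripleVerts H R)
        lengths = begin
          length l + length (tripleVerts H R′)                                             ≡⟨ cong₂ _+_
              (length-occ l) (length-occ (tripleVerts H R′)) ⟨
          ∑ V (λ v → occ v l) + ∑ V (λ v → occ v (tripleVerts H R′))                       ≡⟨ ∑-+ (V {n})
              (λ v → occ v l) (λ v → occ v (tripleVerts H R′)) ⟨
          ∑ V (λ v → occ v l + occ v (tripleVerts H R′))                                   ≡⟨ ∑-cong (V {n})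
              counts ⟩
          ∑ V (λ v → occ v (segsVerts H ss) + δ v x + occ v (tripleVerts H R))             ≡⟨ trans
              (∑-+ (V {n}) (λ v → occ v (segsVerts H ss) + δ v x) (λ v → occ v (tripleVerts H R)))
              (cong (_+ ∑ V (λ v → occ v (tripleVerts H R)))
              (∑-+ (V {n}) (λ v → occ v (segsVerts H ss)) (λ v → δ v x))) ⟩
          ∑ V (λ v → occ v (segsVerts H ss)) + ∑ V (λ v → δ v x) + ∑ V (λ v → occ v (tripleVerts H R))
            ≡⟨ cong₂ _+_ (cong₂ _+_ (length-occ (segsVerts H ss))
                (trans (∑-cong (V {n}) (λ v → sym (+-identityʳ (δ v x)))) (length-occ (x ∷ []))))
                (length-occ (tripleVerts H R)) ⟩
          length (segsVerts H ss) + 1 + length (tripleVerts H R) ∎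
          where open ≡-Reasoning
        tv : ∀ R → length (tripleVerts H R) ≡ length R * 3
        tv []      = refl
        tv (t ∷ R) = cong (3 +_) (tv R)
        R-larger : length (tripleVerts H R′) ≤ length (tripleVerts H R)
        R-larger = subst₂ _≤_ (sym (tv R′)) (sym (tv R))
            (*-monoˡ-≤ 3 (≤-trans (m≤m+n (length R′) (length ss + 1)) (≤-reflexive (sym len))))
      parity : Σ ℕ λ k → length left ≡ k * 2
      parity = go even (LP-even H (chainPath H c)) (LP-even H p)
        where
        go : 2 ∣ n → (Σ ℕ λ i → length (chainVerts H c) ≡ i * 2) → (Σ ℕ λ j → length l ≡ j * 2) → Σ ℕ λ k →
            length left ≡ k * 2
        go (divides h e) (i , e₁) (j , e₂) = h ∸ (i + j) , sym
            (trans (*-distribʳ-∸ 2 h (i + j))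
            (trans (cong₂ _∸_ (trans (sym e) (sym total))
            (trans (*-distribʳ-+ 2 i j) (cong₂ _+_ (sym e₁) (sym e₂))))
          (m+n∸m≡n (length (chainVerts H c) + length l) (length left))))
      k : ℕ
      k = proj₁ parity
      left-even : length left ≡ k * 2
      left-even = proj₂ parity
      k≤q : k ≤ q
      k≤q = *-cancelʳ-≤ k q 2 (certify
          (n ∷ k * 2 ∷ q ∷ length (chainVerts H c) ∷ length (segsVerts H ss) ∷ length l ∷ length left ∷ [])
          (λ n k q c s l f →
        con 1 ⊠ c :+ l :+ f :≤ n ∷ con 1 ⊠ k :≤ f ∷ con 1 ⊠ n :≤ q :* con 2 :+ (c :+ s) ∷ con 1 ⊠ s :≤ l ∷ [] ⊢
            k :≤ q :* con 2)
        (≤-reflexive total) (≤-reflexive (sym left-even)) covered l-long)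
      closed : (Σ (Chain H x y) λ c′ → ∀ v → occ v (chainVerts H c′) ≡ occ v (chainVerts H c) + occ v left) →
          LooseHamiltonCycle H
      closed (c′ , eq) = closed-path H six (append H (chainPath H c′) p) λ v → trans
          (occ-++ v (chainVerts H c′) l) (trans (cong (_+ occ v l) (eq v))
        (trans (+-assoc (occ v (chainVerts H c)) _ _)
            (trans (cong (occ v (chainVerts H c) +_) (+-comm (occ v left) (occ v l)))
            (trans (sym (+-assoc (occ v (chainVerts H c)) _ _)) (left-occ v)))))

-- Choice of the constants

module Constants where
  open Prelude
  open Certificates
  open Sums
  open Multiplicities
  open FractionalCover
  open Duality
  open Blocks
  open AlmostTiling
  open Paths
  open Absorbers
  open Assembly
  open import Data.Nat.Divisibility using (_∣_)
  open import Data.Fin using (fromℕ<)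

  -- After multiplication by w the 56·JA·qA vertices of the absorbers take at most n/2, which
  -- explains 112. The reservoir and the additive constant take at most n/4 each.
  budget : ∀ n w W JA JB qA qB → w ≤ W → 0 < JA → qA * (JA * 112 * W) ≤ n → qB * (JA * 112 * W * JB * 24) ≤ n →
      w * 16 ≤ n →
    (JB * (qB + qB) * 3 + (1 + JA * (qA + qA) * 28) + 3) * w ≤ n
  budget n w W JA JB qA qB h₀ h₁ h₂ h₃ h₄ = *-cancelˡ-≤ 4
      (certify (n ∷ w ∷ W ∷ JA ∷ JB ∷ qA ∷ qB ∷ []) (λ n w W JA JB qA qB →
    con 2 ⊠ qA :* (JA :* con 112 :* W) :≤ n ∷ con 1 ⊠ qB :* (JA :* con 112 :* W :* JB :* con 24) :≤ n ∷ con 1 ⊠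
        w :* con 16 :≤ n ∷
    JA :* qA :* con 224 :+ JB :* qB :* con 24 ⊠ w :≤ W ∷ JB :* qB :* W :* con 24 ⊠ con 1 :≤ JA ∷ []
    ⊢ con 4 :* ((JB :* (qB :+ qB) :* con 3 :+ (con 1 :+ JA :* (qA :+ qA) :* con 28) :+ con 3) :* w) :≤ con 4 :*
        n) h₂ h₃ h₄ h₀ h₁)

  chain-budget : ∀ n SA K JA qA → qA * (JA * 112 * (SA + K)) ≤ n → SA * 80 ≤ n → (JA * (qA + qA) * 28 + 40) * SA
      ≤ n
  chain-budget n SA K JA qA h₁ h₂ = *-cancelˡ-≤ 2 (certify (n ∷ SA ∷ K ∷ JA ∷ qA ∷ []) (λ n SA K JA qA →
    con 1 ⊠ qA :* (JA :* con 112 :* (SA :+ K)) :≤ n ∷ con 1 ⊠ SA :* con 80 :≤ n ∷ []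
    ⊢ con 2 :* ((JA :* (qA :+ qA) :* con 28 :+ con 40) :* SA) :≤ con 2 :* n) h₁ h₂)

  -- A block with parts of size `DB` has 4 · `DB` vertices, so the blocks number at most a quarter
  -- of the connections available to every pair. This is why `DB` is also the block size.
  segments-few : ∀ n DB β qB → n < DB * (qB + 1) → β * (DB * 4) ≤ n → β * 4 ≤ qB
  segments-few n DB β qB h₁ h₂ = s≤s⁻¹
      (≤-trans (*-cancelˡ-< DB (β * 4) (qB + 1) (≤-<-trans (≤-trans (≤-reflexive (lemma β DB)) h₂) h₁))
      (≤-reflexive (+-comm qB 1)))
    where
    lemma : ∀ β D → D * (β * 4) ≡ β * (D * 4)
    lemma β D = equate (β ∷ D ∷ []) λ β D → D :* (β :* con 4) :≡ β :* (D :* con 4)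

  reservoir-few : ∀ n DA JB qA qB → n < DA * (qA + 1) → qB * (DA * JB * 24) ≤ n → JB * qB * 24 ≤ qA
  reservoir-few n DA JB qA qB h₁ h₂ = s≤s⁻¹
      (≤-trans (*-cancelˡ-< DA (JB * qB * 24) (qA + 1)
      (≤-<-trans (≤-trans (≤-reflexive (lemma DA JB qB)) h₂) h₁)) (≤-reflexive (+-comm qA 1)))
    where
    lemma : ∀ D J q → D * (J * q * 24) ≡ q * (D * J * 24)
    lemma D J q = equate (D ∷ J ∷ q ∷ []) λ D J q → D :* (J :* q :* con 24) :≡ q :* (D :* J :* con 24)

  uncovered-few : ∀ n DA n′ cov qA → n < DA * (qA + 1) → DA * 4 * n′ ≤ DA * 4 * cov + n → n′ * 4 ≤ cov * 4 + qA
  uncovered-few n DA n′ cov qA h₁ h₂ = s≤s⁻¹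
      (*-cancelˡ-< DA (n′ * 4) (suc (cov * 4 + qA)) (certify (n ∷ DA ∷ n′ ∷ cov ∷ qA ∷ []) (λ n D n′ c q →
    con 1 ⊠ con 1 :+ n :≤ D :* (q :+ con 1) ∷ con 1 ⊠ D :* con 4 :* n′ :≤ D :* con 4 :* c :+ n ∷ []
    ⊢ con 1 :+ D :* (n′ :* con 4) :≤ D :* (con 1 :+ (c :* con 4 :+ q))) h₁ h₂))

  -- What may be left over: qA/4 vertices missed by the tiling, one vertex per block, the reservoir
  -- of 6·JB·qB ≤ qA/4 vertices, and the endpoint of the chain. Together this stays below 2·qA.
  covered-enough : ∀ n n′ c s β cov qA JB qB r f → n′ * 4 ≤ cov * 4 + qA → JB * qB * 24 ≤ qA → β * 4 ≤ qB → 2 ≤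
      qB → 0 < JB → s + β ≡ cov →
    n′ + f ≡ n → f ≡ suc c + r → r ≡ JB * (qB + qB) * 3 → n ≤ qA * 2 + (c + s)
  covered-enough n n′ c s β cov qA JB qB r f h₁ h₂ h₃ h₄ h₅ refl refl refl refl = *-cancelˡ-≤ 4
      (certify (n′ ∷ c ∷ s ∷ β ∷ qA ∷ JB ∷ qB ∷ []) (λ n′ c s β qA JB qB →
    con 1 ⊠ n′ :* con 4 :≤ (s :+ β) :* con 4 :+ qA ∷ con 2 ⊠ JB :* qB :* con 24 :≤ qA ∷ con 1 ⊠ β :* con 4 :≤ qB
        ∷ con 2 ⊠ con 2 :≤ qB ∷ con 24 :* qB ⊠ con 1 :≤ JB ∷ []
    ⊢ con 4 :* (n′ :+ (con 1 :+ c :+ JB :* (qB :+ qB) :* con 3)) :≤ con 4 :* (qA :* con 2 :+ (c :+ s))) h₁ h₂ h₃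
        h₄ h₅)

  module Hamiltonian (k K : ℕ) (big : 1000 ≤ K) (big′ : k * 252 ≤ K) where

    -- The chain holds about 2 JA n/DA absorbers, every pair being absorbed by n/DA of them; the reservoir holds
    -- about 2 JB n/DB triples, every pair being connected by n/DB of them.  DA is so large that both are small
    -- compared with n, and DB so large that the chain can absorb what remains of the reservoir.
    SA JA JB W DA DB : ℕ
    SA = templateSize + connectSize
    JA = templateLoss + suc templateLoss + 1
    JB = connectLoss + suc connectLoss + 1
    W  = SA + K
    DA = JA * 112 * W
    DB = DA * JB * 24

    K>0 : 0 < K
    K>0 = ≤-trans (s≤s z≤n) big

    JA>0 : 0 < JA
    JA>0 = m≤n+m 1 _

    JB>0 : 0 < JB
    JB>0 = m≤n+m 1 _

    DA>0 : 0 < DA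
    DA>0 = *-mono-≤ (*-mono-≤ JA>0 (s≤s {n = 111} z≤n)) (≤-trans K>0 (m≤n+m K SA))

    DB>0 : 0 < DB
    DB>0 = *-mono-≤ (*-mono-≤ DA>0 JB>0) (s≤s {n = 23} z≤n)

    -- With ℓ = 4 · `DA` the tiling misses at most n/(4 · `DA`) vertices outside `F`, about an
    -- eighth of what the chain can absorb.
    module T = Parameters (DA * 4) K (*-mono-≤ DA>0 (s≤s {n = 3} z≤n)) (≤-trans (≤ᵇ⇒≤ 302 1000 tt) big)

    bounds : List ℕ
    bounds = 6 ∷ SA * 80 ∷ connectSize * 16 ∷ K * 16 ∷ DA * (4 * (DA * 2 + 6)) ∷ DB * (4 * (DB * 2 + 6)) ∷
        T.enough DB ∷ []

    n₀ : ℕ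
    n₀ = ∑ bounds id

    module _ {n : ℕ} (H : Hypergraph3 n) (large : n₀ ≤ n) (even : 2 ∣ n) (deg : MinDegree H K)
        (nonext : NonExtremal H k) where

      private
        within : ∀ {b} → b ∈ bounds → b ≤ n
        within m = ≤-trans (∈-≤-∑ bounds id m) large

        six : 6 ≤ n
        six = within (here refl)

        n>0 : 0 < n
        n>0 = ≤-trans (s≤s z≤n) six

        instance
          DA≢0 : NonZero DA
          DA≢0 = >-nonZero DA>0
          DB≢0 : NonZero DB
          DB≢0 = >-nonZero DB>0

        qA qB TA TB : ℕ
        qA = n / DA
        qB = n / DB
        TA = JA * (qA + qA)
        TB = JB * (qB + qB)

        capA : qA * DA ≤ n
        capA = quotient-upper DA DA>0 n

        capB : qB * DB ≤ n
        capB = quotient-upper DB DB>0 n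

        qB≥2 : 2 ≤ qB
        qB≥2 = quotient-large DB DB>0 n 2
            (≤-trans (*-monoʳ-≤ DB (≤-trans (s≤s (s≤s (z≤n {n = 22}))) (*-monoʳ-≤ 4 (m≤n+m 6 (DB * 2)))))
            (within (there (there (there (there (there (here refl))))))))

        abstract
          chain : Σ (State H K big deg n>0 TA (fromℕ< n>0)) λ S → ∀ y → qA ≤ reach H K big deg n>0 TA S y
          chain = buildChain H K big deg n>0 (fromℕ< n>0) qA TA refl
            (square-below-exponential DA DA>0 n (within (there (there (there (there (here refl)))))))
            (chain-budget n SA K JA qA capA (within (there (here refl))))

        x : Fin n
        x = proj₁ (proj₁ chain)

        c : Chain H x (fromℕ< n>0)
        c = proj₁ (proj₂ (proj₁ chain))

        U : List (Fin n)
        U = x ∷ chainVerts H c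

        U-uniq : Uniq U
        U-uniq = proj₁ (proj₂ (proj₂ (proj₁ chain)))

        U-length : length U ≡ 1 + TA * 28
        U-length = proj₂ (proj₂ (proj₂ (proj₁ chain)))

        abstract
          reservoir : Σ (Reservoir H K big deg n>0 U TB) λ R → ∀ y → qB ≤ connections H y (proj₁ R)
          reservoir = buildReservoir H K big deg n>0 U U-uniq qB TB refl
            (square-below-exponential DB DB>0 n (within (there (there (there (there (there (here refl))))))))
            (subst (λ z → (TB * 3 + z + 3) * connectSize ≤ n) (sym U-length)
              (budget n connectSize W JA JB qA qB (≤-trans (m≤n+m connectSize templateSize) (m≤m+n SA K)) JA>0
                  capA capB (within (there (there (here refl))))))

        R : List (Triple H)
        R = proj₁ (proj₁ reservoir)

        used : List (Fin n)
        used = U ++ tripleVerts H R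

        used-uniq : Uniq used
        used-uniq v = ≤-trans (≤-reflexive (trans (occ-++ v U (tripleVerts H R)) (+-comm (occ v U) _)))
            (proj₂ (proj₂ (proj₁ reservoir)) v)

        R-length : length (tripleVerts H R) ≡ TB * 3
        R-length = trans (tripleVerts-length H K big deg n>0 R) (cong (_* 3) (proj₁ (proj₂ (proj₁ reservoir))))

        F : Fin n → Bool
        F v = not (does (occ v used ≟ℕ 0))

        F-occ : ∀ v → 𝟙 (F v) ≡ occ v used
        F-occ v = bool (occ v used) (used-uniq v)
          where
          bool : ∀ o → o ≤ 1 → 𝟙 (not (does (o ≟ℕ 0))) ≡ o
          bool zero h = refl
          bool (suc zero) h = refl
          bool (suc (suc o)) (s≤s ())

        F-count : count F ≡ length U + length (tripleVerts H R)
        F-count = trans (∑-cong (V {n}) F-occ) (trans (length-occ used) (length-++ U))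

        few : K * count F ≤ n
        few = ≤-trans (≤-trans (≤-reflexive (cong (K *_) (trans F-count (cong₂ _+_ U-length R-length))))
            (certify (K ∷ TA ∷ TB ∷ []) λ K a b → [] ⊢ K :* (con 1 :+ a :* con 28 :+ b :* con 3) :≤
                (b :* con 3 :+ (con 1 :+ a :* con 28) :+ con 3) :* K))
          (budget n K W JA JB qA qB (m≤n+m K SA) JA>0 capA capB (within (there (there (there (here refl))))))

        abstract
          tiling : Σ (List (Block H DB)) λ Ks → (∀ v → occ v (vertsAll H Ks) + 𝟙 (F v) ≤ 1) ×
            DA * 4 * count (λ v → not (F v)) ≤ DA * 4 * (length Ks * (DB * 4)) + n
          tiling = T.almost-tiling k DB DB>0
              (within (there (there (there (there (there (there (here refl)))))))) H F big′ few deg nonext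

        Ks : List (Block H DB)
        Ks = proj₁ tiling

        abstract
          paths : Σ (List (Segment H)) λ ss → length ss ≡ length Ks × length (segsVerts H ss) + length Ks ≡
              length Ks * (DB * 4) × (∀ v → occ v (segsVerts H ss) ≤ occ v (vertsAll H Ks))
          paths = blockPaths H K big deg n>0 DB>0 Ks

        ss : List (Segment H)
        ss = proj₁ paths

        Ks-fit : length Ks * (DB * 4) ≤ n
        Ks-fit = vertsAll-fit H F Ks (proj₁ (proj₂ tiling))

        β≤ : length Ks * 4 ≤ qB
        β≤ = segments-few n DB (length Ks) qB (quotient-lower DB DB>0 n) Ks-fit

        connecting : ∀ y → length ss + 1 ≤ connections H y R
        connecting y = ≤-trans (≤-trans (≤-reflexive (cong (_+ 1) (proj₁ (proj₂ paths))))
          (*-cancelˡ-≤ 4 (certify (length Ks ∷ qB ∷ [])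
              (λ b q → con 1 ⊠ b :* con 4 :≤ q ∷ con 3 ⊠ con 2 :≤ q ∷ [] ⊢ con 4 :* (b :+ con 1) :≤ con 4 :* q)
              β≤ qB≥2)))
          (proj₂ reservoir y)

        disjoint : ∀ v → occ v U + (occ v (tripleVerts H R) + occ v (segsVerts H ss)) ≤ 1
        disjoint v = ≤-trans (≤-reflexive
            (trans (sym (+-assoc (occ v U) _ _))
            (trans (cong (_+ occ v (segsVerts H ss)) (sym (trans (F-occ v) (occ-++ v U (tripleVerts H R)))))
            (+-comm (𝟙 (F v)) _))))
          (≤-trans (+-monoˡ-≤ (𝟙 (F v)) (proj₂ (proj₂ (proj₂ paths)) v)) (proj₁ (proj₂ tiling) v))

        split : count (λ v → not (F v)) + count F ≡ n
        split = count-not F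

      hamiltonian : LooseHamiltonCycle H
      hamiltonian = close-up H c R ss qA six even disjoint (proj₂ chain) connecting
        (covered-enough n (count (λ v → not (F v))) (length (chainVerts H c)) (length (segsVerts H ss))
            (length Ks) (length Ks * (DB * 4)) qA JB qB (length (tripleVerts H R)) (count F)
          (uncovered-few n DA (count (λ v → not (F v))) (length Ks * (DB * 4)) qA (quotient-lower DA DA>0 n)
              (proj₂ (proj₂ tiling)))
          (reservoir-few n DA JB qA qB (quotient-lower DA DA>0 n) capB) β≤ qB≥2 JB>0
              (proj₁ (proj₂ (proj₂ paths))) split F-count R-length)

-- From rational hypotheses to natural-number inequalities

module Translation where
  open Prelude
  open Certificates
  open Sums
  open Multiplicities
  open FractionalCover
  open Duality
  open Constants
  open import Data.Nat.Combinatorics using (_C_; nC1≡n; nCk+nC[k+1]≡[n+1]C[k+1])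
  open import Data.Nat.Divisibility using (_∣_)
  open import Data.Fin.Subset using (Subset; ∣_∣)
  open import Data.Vec.Properties using (lookup∘tabulate)
  open import Data.Fin.Properties using () renaming (_<?_ to _<?F_)
  import Data.Integer as ℤ
  import Data.Integer.Properties as ℤ
  import Data.Rational as ℚ
  import Data.Rational.Properties as ℚ
  import Data.Rational.Unnormalised as ℚᵘ
  import Data.Rational.Unnormalised.Properties as ℚᵘ
  open import Data.Fin using () renaming (_<_ to _<F_)
  open import Data.Fin.Properties using () renaming (<-asym to <F-asym)

  twice-C2 : ∀ n → 2 * (n C 2) + n ≡ n * n
  twice-C2 zero    = refl
  twice-C2 (suc n) = begin
    2 * (suc n C 2) + suc n        ≡⟨ cong (λ t → 2 * t + suc n)
        (trans (sym (nCk+nC[k+1]≡[n+1]C[k+1] n 1)) (cong (_+ n C 2) (nC1≡n n))) ⟩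
    2 * (n + n C 2) + suc n        ≡⟨ lemma n (n C 2) (twice-C2 n) ⟩
    suc n * suc n ∎
    where
    open ≡-Reasoning
    lemma : ∀ n c → 2 * c + n ≡ n * n → 2 * (n + c) + suc n ≡ suc n * suc n
    lemma n c h = ≤-antisym (certify (n ∷ c ∷ [])
        (λ n c → con 1 ⊠ con 2 :* c :+ n :≤ n :* n ∷ [] ⊢ con 2 :* (n :+ c) :+ (con 1 :+ n) :≤ (con 1 :+ n) :*
        (con 1 :+ n)) (≤-reflexive h))
                            (certify (n ∷ c ∷ []) (λ n c → con 1 ⊠ n :* n :≤ con 2 :* c :+ n ∷ [] ⊢ (con 1 :+ n)
                                :* (con 1 :+ n) :≤ con 2 :* (n :+ c) :+ (con 1 :+ n)) (≤-reflexive (sym h)))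

  module _ {n : ℕ} (H : Hypergraph3 n) where

    degree≤ : ∀ v → 2 * degree H v ≤ D H v
    degree≤ v = ≤-trans (≤-reflexive
        (trans (cong (λ t → t + (t + 0)) sums)
        (trans (cong (d +_) (+-identityʳ d))
        (trans (cong (d +_) (∑-swap (V {n}) (V {n}) f)) (sym (∑²-+ f (λ w u → f u w))))))) (∑²-mono pt)
      where
      f : Fin n → Fin n → ℕ
      f u w = 𝟙 ((u <ᵇ w) ∧ edge H v u w)
      d : ℕ
      d = ∑² f
      sums : degree H v ≡ d
      sums = trans (∑-sum (V {n}) _) (∑-cong (V {n}) (λ u → ∑-sum (V {n}) (f u)))
      pt : ∀ u w → f u w + f w u ≤ E H v u w
      pt u w rewrite sym₂₃ H v w u = bool (u <?F w) (w <?F u) (edge H v u w)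
        where
        bool : (p : Dec (u <F w)) (q : Dec (w <F u)) → ∀ e → 𝟙 (does p ∧ e) + 𝟙 (does q ∧ e) ≤ 𝟙 e
        bool (yes p) (yes q) e = ⊥-elim (<F-asym p q)
        bool (yes p) (no q)  e = ≤-reflexive (+-identityʳ _)
        bool (no p)  (yes q) e = ≤-refl
        bool (no p)  (no q)  e = z≤n

    edgesIn≤ : ∀ B → edgesIn H (tabulateV B) ≤ inside H B
    edgesIn≤ B = ≤-trans (≤-reflexive
        (trans (∑-sum (V {n}) _) (∑-cong (V {n})
        (λ a → trans (∑-sum (V {n}) _) (∑-cong (V {n}) (λ b → ∑-sum (V {n}) _)))))) (∑³-mono pt)
      where
      pt : ∀ a b c → 𝟙 ((a <ᵇ b) ∧ (b <ᵇ c) ∧ lookup (tabulateV B) a ∧ lookup (tabulateV B) b ∧ lookup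
          (tabulateV B) c ∧ edge H a b c) ≤ 𝟙 (B a) * 𝟙 (B b) * 𝟙 (B c) * E H a b c
      pt a b c rewrite lookup∘tabulate B a | lookup∘tabulate B b | lookup∘tabulate B c = bool (a <ᵇ b) (b <ᵇ c)
          (B a) (B b) (B c) (edge H a b c)
        where
        bool : ∀ x y p q r e → 𝟙 (x ∧ y ∧ p ∧ q ∧ r ∧ e) ≤ 𝟙 p * 𝟙 q * 𝟙 r * 𝟙 e
        bool false y p q r e = z≤n
        bool true false p q r e = z≤n
        bool true true false q r e = z≤n
        bool true true true false r e = z≤n
        bool true true true true false e = z≤n
        bool true true true true true e = ≤-reflexive (sym (+-identityʳ (𝟙 e)))

  ∣tabulate∣ : ∀ {n} (B : Fin n → Bool) → ∣ tabulateV B ∣ ≡ count B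
  ∣tabulate∣ {zero}  B = refl
  ∣tabulate∣ {suc n} B = trans (step (B zero) (tabulateV (B ∘ suc)))
      (trans (cong (𝟙 (B zero) +_) (∣tabulate∣ (B ∘ suc))) (sym (∑-suc {n} (λ v → 𝟙 (B v)))))
    where
    step : ∀ {n} b (p : Subset n) → ∣ b ∷ p ∣ ≡ 𝟙 b + ∣ p ∣
    step true  p = refl
    step false p = refl

  open import Data.Integer using (ℤ; +_; -[1+_])
  open import Data.Rational using (ℚ; mkℚ; 0ℚ)
  open import Data.Rational.Unnormalised using (mkℚᵘ; *≤*)
  import Data.Integer.Tactic.RingSolver as ℤ-Solver

  fraction-≤ : ∀ a b β m → ℚ.↥ β ≡ + suc m → a * ℚ.↧ₙ β ≤ suc m * b → (+ a) ℚ./ 1 ℚ.≤ β ℚ.* ((+ b) ℚ./ 1)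
  fraction-≤ a b β@(mkℚ .(+ suc m) d _) m refl h = ℚ.toℚᵘ-cancel-≤
      (ℚᵘ.≤-respˡ-≃ (ℚᵘ.≃-sym (ℚ.toℚᵘ-fromℚᵘ (mkℚᵘ (+ a) 0)))
    (ℚᵘ.≤-respʳ-≃ (ℚᵘ.≃-sym (ℚᵘ.≃-trans (ℚ.toℚᵘ-homo-* β ((+ b) ℚ./ 1))
        (ℚᵘ.*-congˡ {mkℚᵘ (+ suc m) d} (ℚ.toℚᵘ-fromℚᵘ (mkℚᵘ (+ b) 0)))))
      (*≤* (subst₂ ℤ._≤_ (ℤ.pos-* a (suc (d * 1)))
          (trans (ℤ.pos-* (suc m * b) 1) (cong (ℤ._* + 1) (ℤ.pos-* (suc m) b)))
        (ℤ.+≤+ (subst₂ _≤_ (cong (λ t → a * suc t) (sym (*-identityʳ d))) (sym (*-identityʳ (suc m * b)))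
            h))))))

  γ-degree : ∀ g N t → ((+ 7 ℚ./ 16) ℚ.- (+ 1 ℚ./ suc g)) ℚ.* ((+ N) ℚ./ 1) ℚ.≤ (+ t) ℚ./ 1 → suc g * N * 7 ≤
      suc g * t * 16 + N * 16
  γ-degree g N t h = ℤ.drop‿+≤+ (subst₂ ℤ._≤_ left right
      (ℤ.+-monoˡ-≤ (+ N ℤ.* + 16) (ℚᵘ.drop-*≤* unnormalised)))
    where
    unnormalised : (mkℚᵘ (+ 7) 15 ℚᵘ.- mkℚᵘ (+ 1) g) ℚᵘ.* mkℚᵘ (+ N) 0 ℚᵘ.≤ mkℚᵘ (+ t) 0
    unnormalised = ℚᵘ.≤-respʳ-≃ (ℚ.toℚᵘ-fromℚᵘ (mkℚᵘ (+ t) 0)) (ℚᵘ.≤-respˡ-≃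
      (ℚᵘ.≃-trans (ℚ.toℚᵘ-homo-* ((+ 7 ℚ./ 16) ℚ.- (+ 1 ℚ./ suc g)) ((+ N) ℚ./ 1))
        (ℚᵘ.*-cong (ℚᵘ.≃-trans (ℚ.toℚᵘ-homo-+ (+ 7 ℚ./ 16) (ℚ.- (+ 1 ℚ./ suc g)))
          (ℚᵘ.+-cong (ℚ.toℚᵘ-fromℚᵘ (mkℚᵘ (+ 7) 15))
              (ℚᵘ.≃-trans (ℚ.toℚᵘ-homo‿- (+ 1 ℚ./ suc g)) (ℚᵘ.-‿cong (ℚ.toℚᵘ-fromℚᵘ (mkℚᵘ (+ 1) g))))))
          (ℚ.toℚᵘ-fromℚᵘ (mkℚᵘ (+ N) 0))))
      (ℚ.toℚᵘ-mono-≤ h))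
    left : (+ 7 ℤ.* + suc g ℤ.+ (ℤ.- + 1) ℤ.* + 16) ℤ.* + N ℤ.* + 1 ℤ.+ + N ℤ.* + 16 ≡ + (suc g * N * 7)
    left = trans (identity (+ suc g) (+ N))
        (sym (trans (ℤ.pos-* (suc g * N) 7) (cong (ℤ._* + 7) (ℤ.pos-* (suc g) N))))
      where
      identity : ∀ G N → (+ 7 ℤ.* G ℤ.+ (ℤ.- + 1) ℤ.* + 16) ℤ.* N ℤ.* + 1 ℤ.+ N ℤ.* + 16 ≡ G ℤ.* N ℤ.* + 7
      identity = ℤ-Solver.solve-∀
    right : + t ℤ.* + (16 * suc g * 1) ℤ.+ + N ℤ.* + 16 ≡ + (suc g * t * 16 + N * 16)
    right = trans (cong₂ ℤ._+_ (trans (sym (ℤ.pos-* t (16 * suc g * 1)))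
        (cong +_ (trans (cong (t *_) (*-identityʳ (16 * suc g)))
      (trans (*-comm t (16 * suc g)) (trans (*-assoc 16 (suc g) t) (*-comm 16 (suc g * t)))))))
          (sym (ℤ.pos-* N 16))) (sym (ℤ.pos-+ (suc g * t * 16) (N * 16)))

  -- The admissible error is n²/(16K). The slack 1/(32K + 1) uses at most half of it; the other half
  -- absorbs the n by which twice the binomial coefficient falls short of n², since n ≥ 32K + 1.
  degree-transfer : ∀ n K N t D → 2 * N + n ≡ n * n → 2 * t ≤ D → suc (K * 32) * N * 7 ≤ suc (K * 32) * t * 16 +
      N * 16 → suc (K * 32) ≤ n →
    K * 7 * (n * n) ≤ K * 16 * D + n * n
  degree-transfer n K N t D h₁ h₂ h₃ h₄ = *-cancelˡ-≤ (suc (K * 32)) (certify (n ∷ K ∷ N ∷ t ∷ D ∷ []) (λ n K N t D → let G = con 1 :+ K :* con 32 in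
    G :* K :* con 7 ⊠ n :* n :≤ con 2 :* N :+ n ∷ K :* con 16 ⊠ con 2 :* N :+ n :≤ n :* n ∷ G :* K :* con 16 ⊠
        con 2 :* t :≤ D ∷ K :* con 2 ⊠ G :* N :* con 7 :≤ G :* t :* con 16 :+ N :* con 16 ∷
    K :* n :* con 7 ⊠ G :≤ n ∷ []
    ⊢ G :* (K :* con 7 :* (n :* n)) :≤ G :* (K :* con 16 :* D :+ n :* n)) (≤-reflexive (sym h₁))
        (≤-reflexive h₁) h₂ h₃ h₄)

  cube : ∀ n → n ^ 3 ≡ n * n * n
  cube n = trans (cong (λ t → n * (n * t)) (*-identityʳ n)) (sym (*-assoc n n n))

  -- As β is at least the reciprocal of its denominator, a set with fewer ordered triples would
  -- witness extremality: every edge inside it occurs among them in increasing order.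
  non-extremal : ∀ {n} (H : Hypergraph3 n) β m → ℚ.↥ β ≡ + suc m → ¬ Extremal β H → NonExtremal H (ℚ.↧ₙ β)
  non-extremal {n} H β m e ¬ext B size = ≮⇒≥ λ few → ¬ext (tabulateV B , trans (∣tabulate∣ B) size ,
    fraction-≤ (edgesIn H (tabulateV B)) (n ^ 3) β m e (begin
      edgesIn H (tabulateV B) * ℚ.↧ₙ β   ≤⟨ *-monoˡ-≤ (ℚ.↧ₙ β) (edgesIn≤ H B) ⟩
      inside H B * ℚ.↧ₙ β                ≡⟨ *-comm (inside H B) (ℚ.↧ₙ β) ⟩
      ℚ.↧ₙ β * inside H B                ≤⟨ <⇒≤ few ⟩
      n * n * n                          ≡⟨ cube n ⟨
      n ^ 3                              ≤⟨ m≤m+n (n ^ 3) (m * n ^ 3) ⟩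
      suc m * n ^ 3 ∎))
    where open ≤-Reasoning

  positive-numerator : ∀ β → 0ℚ ℚ.< β → Σ ℕ λ m → ℚ.↥ β ≡ + suc m
  positive-numerator (mkℚ (+ zero)  d _) (ℚ.*<* (ℤ.+<+ ()))
  positive-numerator (mkℚ (+ suc m) d _) h = m , refl
  positive-numerator (mkℚ -[1+ m ]  d _) (ℚ.*<* ())

  slack-positive : ∀ g → 0ℚ ℚ.< + 1 ℚ./ suc g
  slack-positive g = ℚ.positive⁻¹ (+ 1 ℚ./ suc g) {{ℚ.normalize-pos 1 (suc g)}}

  module _ (k : ℕ) where

    abstract
      -- The summand 1000 serves the counts in links, and 252k the contradiction with
      -- non-extremality.
      precision : ℕ
      precision = k * 252 + 1000

      precision-large : 1000 ≤ precision
      precision-large = m≤n+m 1000 (k * 252)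

      precision-fine : k * 252 ≤ precision
      precision-fine = m≤m+n (k * 252) 1000

    slack : ℚ
    slack = + 1 ℚ./ suc (precision * 32)

    slack>0 : 0ℚ ℚ.< slack
    slack>0 = slack-positive (precision * 32)

    order : ℕ
    order = suc (precision * 32) + Hamiltonian.n₀ k precision precision-large precision-fine

    loose-hamilton : ∀ {n} → order ≤ n → 2 ∣ n → (H : Hypergraph3 n) →
      minDegreeAtLeast H (((+ 7 ℚ./ 16) ℚ.- slack) ℚ.* ((+ (n C 2)) ℚ./ 1)) → NonExtremal H k →
          LooseHamiltonCycle H
    loose-hamilton {n} large even H deg nonext = Hamiltonian.hamiltonian k precision precision-large
        precision-fine H (≤-trans (m≤n+m _ (suc (precision * 32))) large) even
      (λ v → degree-transfer n precision (n C 2) (degree H v) (D H v) (twice-C2 n) (degree≤ H v)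
          (γ-degree (precision * 32) (n C 2) (degree H v) (deg v))
          (≤-trans (m≤m+n (suc (precision * 32)) _) large))
      nonext

open import Data.Nat using (ℕ; _>_)
open import Data.Nat.Divisibility using (_∣_)
open import Data.Nat.Combinatorics using (_C_)
open import Data.Product using (Σ; _×_)
open import Data.Integer using (+_)
open import Data.Rational using (ℚ; 0ℚ; _<_; _-_; _*_; _/_)
open import Relation.Nullary using (¬_)
open import Data.Nat.Properties using (<⇒≤)
open import Data.Product using (_,_)
open import Data.Rational using (↧ₙ_)

theorem1p6 : (β : ℚ) → 0ℚ < β →
    Σ ℚ λ γ → (0ℚ < γ) × Σ ℕ λ n₃ →
    (n : ℕ) → n > n₃ → 2 ∣ n → (H : Hypergraph3 n) →
    minDegreeAtLeast H (((+ 7 / 16) - γ) * ((+ (n C 2)) / 1)) →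
    ¬ Extremal β H →
    LooseHamiltonCycle H
theorem1p6 β β>0 =
  let m , e = Translation.positive-numerator β β>0
      k = ↧ₙ β
  in Translation.slack k , Translation.slack>0 k , Translation.order k ,
     λ n large even H deg ¬ext → Translation.loose-hamilton k (<⇒≤ large) even H deg (Translation.non-extremal H β m e ¬ext)
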